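{- For $k^2<\delta n$ we have $R_\delta(\mathrm{Ham}^n_k)=\Omega(k\log(k/\delta))$. Moreover the bound applies even to protocols that may output an arbitrary answer on inputs $(x,y)$ with $\|x-y\|_1\notin\{k-2,k,k+2\}$; that is, any public-coin randomized two-party protocol which, on every input $(x,y)\in\{0,1\}^n\times\{0,1\}^n$ with $\|x-y\|_1\in\{k-2,k,k+2\}$, outputs with probability at least $1-\delta$ the correct value of the predicate "$\|x-y\|_1\le k$", has communication cost $\Omega(k\log(k/\delta))$.
   Context: In a two-party communication problem, Alice receives $x$ and Bob receives $y$; they exchange messages (bit strings) according to a protocol that may use a shared random source, and the protocol outputs a bit. Its error probability is the maximum over inputs of the probability that the output is wrong, and its communication cost is the maximum, over inputs and random strings, of the total number of bits exchanged. The $k$-Hamming distance problem $\mathrm{Ham}^n_k$: inputs $x,y\in\{0,1\}^n$, output $1$ iff $\|x-y\|_1\le k$ (i.e. the Hamming distance is at most $k$). $R_\delta(f)$ denotes the minimum communication cost of a randomized protocol (with any number of rounds) computing $f$ with error probability at most $\delta$.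
   Formalization: The error probability is restricted to 0 < δ ≤ 1/3 and k ≥ 1; without an upper bound on δ the claim fails, since for δ ≥ 1/2 a protocol that guesses at random has cost 0. δ is rational and the public random string is uniform over a finite set, which loses nothing. -}

module Defs where

open import Data.Bool using (Bool; true; false; if_then_else_; _xor_)
open import Data.Nat using (ℕ; zero; suc; _+_; _≤ᵇ_)
open import Data.Fin using (Fin; zero; suc)
open import Data.Vec using (Vec; []; _∷_)
open import Relation.Binary.PropositionalEquality using (_≡_; _≢_)
open import Data.Sum using (_⊎_)

ham : ∀ {n} → Vec Bool n → Vec Bool n → ℕ
ham []       []       = 0
ham (a ∷ xs) (b ∷ ys) = (if a xor b then 1 else 0) + ham xs ys

-- Deterministic two-party protocol tree.  Every message is decomposed into
-- single bits: at an 'alice' node Alice sends the bit f x (depending only on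
-- her input and the history, i.e. the node), at a 'bob' node Bob sends g y.
-- The child followed is the one selected by the sent bit (true = left).
data Protocol (X Y : Set) : Set where
  leaf  : Bool → Protocol X Y
  alice : (X → Bool) → Protocol X Y → Protocol X Y → Protocol X Y
  bob   : (Y → Bool) → Protocol X Y → Protocol X Y → Protocol X Y

run : ∀ {X Y} → Protocol X Y → X → Y → Bool
run (leaf o)      x y = o
run (alice f l r) x y = if f x then run l x y else run r x y
run (bob g l r)   x y = if g y then run l x y else run r x y

bitsOn : ∀ {X Y} → Protocol X Y → X → Y → ℕ
bitsOn (leaf o)      x y = 0
bitsOn (alice f l r) x y = suc (if f x then bitsOn l x y else bitsOn r x y)
bitsOn (bob g l r)   x y = suc (if g y then bitsOn l x y else bitsOn r x y)

countFin : ∀ m → (Fin m → Bool) → ℕ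
countFin zero    p = 0
countFin (suc m) p = (if p zero then 1 else 0) + countFin m (λ i → p (suc i))

_≠ᵇ_ : Bool → Bool → Bool
a ≠ᵇ b = a xor b

-- A public-coin randomized protocol with m equally likely random strings
-- (indexed by Fin m): for each random string r a deterministic protocol.
PublicCoin : ℕ → ℕ → Set
PublicCoin n m = Fin m → Protocol (Vec Bool n) (Vec Bool n)

errors : ∀ {n m} → ℕ → PublicCoin n m → Vec Bool n → Vec Bool n → ℕ
errors {n} {m} k P x y = countFin m (λ r → run (P r) x y ≠ᵇ (ham x y ≤ᵇ k))

-- the "promise" distances k-2, k, k+2 (k-2 only when k ≥ 2)
Promise : ℕ → ℕ → Set
Promise k d = (d + 2 ≡ k) ⊎ (d ≡ k) ⊎ (d ≡ k + 2)

{-# OPTIONS --safe #-}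
module Submission where

-- Let A be the adjacency operator of the cube, X × Y a rectangle, and G_t = ⟨X, A^t Y⟩ the number of
-- t-walks from X to Y; for t² ≪ n almost all t-walks end at distance t.  Write F_i = A^i X and
-- B_i = A^(k-i) Y.  Along a random k-walk x from X to Y, each i < k satisfies
--   G_{k+2} / G_k = E [F_{i+1}(x_{i+1}) B_i(x_i) / (F_i(x_i) B_{i+1}(x_{i+1}))],
-- and the product of these ratios over i telescopes to F_k(x_k) B_0(x_0), so AM-GM over i bounds
-- G_{k+2} / G_k below by about (G_k / 2^n)^(2/k).  The i-th expectation counts (k+2)-walks with an
-- edge retraced at position i.  If G_{k+2} G_{k-2} ≪ G_k² then times j-1 and j+1 of a k-walk have
-- nearly disjoint distributions, since ⟨F_{j+1}, B_{j-1}⟩ = G_{k+2} and ⟨F_{j-1}, B_{j+1}⟩ = G_{k-2};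
-- a noisy binary search then recovers most of i from the (k+2)-walk, and the bound improves by a
-- factor k^Ω(1).  A cheap protocol with small error has a leaf rectangle with G_{k+2} ≪ G_k,
-- G_{k-2} = O(G_k) (normalised) and G_k not too small, which contradicts the improved bound.

open import Defs
open import Data.Bool using (Bool; true; false; not; if_then_else_; _xor_; _∧_; _∨_) renaming (T to IsTrue)
open import Data.Empty using (⊥-elim)
open import Data.Fin using (Fin; zero; suc)
open import Data.List using (List; []; _∷_; _++_; map; concatMap; tabulate)
open import Data.Nat
open import Data.Nat.DivMod using (m/n*n≤m; m≡m%n+[m/n]*n; m%n<n; m≥n⇒m/n>0; m*n/n≡m; /-monoˡ-≤)
open import Data.Nat.Logarithm using (⌊log₂_⌋; ⌊log₂⌋-mono-≤; ⌊log₂[2^n]⌋≡n)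
open import Data.Nat.Properties
open import Data.Nat.Tactic.RingSolver using (solve-∀)
open import Data.Product using (Σ; _×_; _,_; proj₁; proj₂)
open import Data.Sum using (_⊎_; inj₁; inj₂)
open import Data.Unit using (tt)
open import Data.Vec using (Vec; []; _∷_)
open import Relation.Binary.PropositionalEquality
open import Relation.Nullary using (Dec; yes; no)

-- The exponent (l + 4θ) k in `exponent-bound` shows the two sources of the logarithm. The sparsity
-- of G_{k+2}, measured by e = 2^l of order 1/δ, gives k log(1/δ) by AM-GM alone; the term 4θ k, of
-- order k log k, must come from the search, even for constant δ. A test multiplies the weight of a
-- walk by 3 on the side it favours and by 1 on the other. The total weight thus grows to 4^L
-- G_{k+2}, which is 2^L G_{k+2} per leaf, whereas a walk retraced at position i that fails no test
-- receives 3^L in leaf i. The gain (3/2)^L is a power of k because k = 2^L. The obstacle is that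
-- failures are rare only on average over all k-walks, while the ratios have to be bounded along one
-- walk. Convexity of the weight in the number of failures lets their average at a vertex be used
-- instead, and a single walk is then picked that meets few vertices with a large average. All
-- counts are natural numbers, so δ appears as 1/D, quotients are rounded, and expectations over
-- walks become sums compared with multiples of G_k.

-- Sums over the cube and the adjacency operator.

Cube : ℕ → Set
Cube n = Vec Bool n

sumV : ∀ {n} → (Cube n → ℕ) → ℕ
sumV {zero}  f = f []
sumV {suc n} f = sumV (λ z → f (true ∷ z)) + sumV (λ z → f (false ∷ z))

adj : ∀ {n} → (Cube n → ℕ) → Cube n → ℕ
adj f []      = 0
adj f (b ∷ z) = f (not b ∷ z) + adj (λ w → f (b ∷ w)) z

pow : ∀ {n} → ℕ → (Cube n → ℕ) → Cube n → ℕ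
pow zero    f = f
pow (suc t) f = adj (pow t f)

⟨_,_⟩ : ∀ {n} → (Cube n → ℕ) → (Cube n → ℕ) → ℕ
⟨ f , g ⟩ = sumV (λ z → f z * g z)

interchange : ∀ a b c d → (a + b) + (c + d) ≡ (a + c) + (b + d)
interchange = solve-∀

sumV-mono : ∀ {n} {f g : Cube n → ℕ} → (∀ z → f z ≤ g z) → sumV f ≤ sumV g
sumV-mono {zero}  h = h []
sumV-mono {suc n} h = +-mono-≤ (sumV-mono (λ z → h (true ∷ z))) (sumV-mono (λ z → h (false ∷ z)))

sumV-cong : ∀ {n} {f g : Cube n → ℕ} → (∀ z → f z ≡ g z) → sumV f ≡ sumV g
sumV-cong {zero}  h = h []
sumV-cong {suc n} h = cong₂ _+_ (sumV-cong (λ z → h (true ∷ z))) (sumV-cong (λ z → h (false ∷ z)))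

sumV-+ : ∀ {n} (f g : Cube n → ℕ) → sumV (λ z → f z + g z) ≡ sumV f + sumV g
sumV-+ {zero}  f g = refl
sumV-+ {suc n} f g = trans
  (cong₂ _+_ (sumV-+ (λ z → f (true ∷ z)) (λ z → g (true ∷ z)))
             (sumV-+ (λ z → f (false ∷ z)) (λ z → g (false ∷ z))))
  (interchange (sumV λ z → f (true ∷ z)) _ (sumV λ z → f (false ∷ z)) _)

sumV-* : ∀ {n} c (f : Cube n → ℕ) → sumV (λ z → c * f z) ≡ c * sumV f
sumV-* {zero}  c f = refl
sumV-* {suc n} c f = trans
  (cong₂ _+_ (sumV-* c (λ z → f (true ∷ z))) (sumV-* c (λ z → f (false ∷ z))))
  (sym (*-distribˡ-+ c (sumV λ z → f (true ∷ z)) _))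

sumV-const : ∀ n c → sumV {n} (λ _ → c) ≡ 2 ^ n * c
sumV-const zero    c = sym (+-identityʳ c)
sumV-const (suc n) c = trans (cong₂ _+_ (sumV-const n c) (sumV-const n c)) (double (2 ^ n) c)
  where
  double : ∀ p c → p * c + p * c ≡ 2 * p * c
  double = solve-∀

-- If the `true` half of the cube has no mass of `g`, or more mass of `f` than of `g`, then the
-- `false` half inherits both hypotheses.
sumV-average : ∀ {n} (f g : Cube n → ℕ) → 0 < sumV g → sumV f ≤ sumV g →
               Σ (Cube n) λ z → 0 < g z × f z ≤ g z
sumV-average {zero}  f g p q = [] , p , q
sumV-average {suc n} f g p q = pick (0 <? sumV gt) (sumV ft ≤? sumV gt)
  where
  ft = λ z → f (true ∷ z)
  gt = λ z → g (true ∷ z)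
  ff = λ z → f (false ∷ z)
  gf = λ z → g (false ∷ z)
  inFalse : 0 < sumV gf → sumV ff ≤ sumV gf → Σ (Cube (suc n)) λ z → 0 < g z × f z ≤ g z
  inFalse p′ q′ with sumV-average ff gf p′ q′
  ... | z , r = false ∷ z , r
  pick : Dec (0 < sumV gt) → Dec (sumV ft ≤ sumV gt) → Σ (Cube (suc n)) λ z → 0 < g z × f z ≤ g z
  pick (yes p′) (yes q′) with sumV-average ft gt p′ q′
  ... | z , r = true ∷ z , r
  pick (no ¬p) _ = inFalse (subst (λ s → 0 < s + sumV gf) gt≡0 p)
                           (≤-trans (m≤n+m _ (sumV ft)) (subst (λ s → _ ≤ s + sumV gf) gt≡0 q))
    where gt≡0 = n≤0⇒n≡0 (≮⇒≥ ¬p)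
  pick (yes _) (no ¬q) = inFalse (≤-<-trans z≤n smaller) (<⇒≤ smaller)
    where
    smaller : sumV ff < sumV gf
    smaller = +-cancelˡ-< (sumV ft) _ _ (<-≤-trans (s≤s q) (+-monoˡ-< (sumV gf) (≰⇒> ¬q)))

adj-mono : ∀ {n} {f g : Cube n → ℕ} → (∀ z → f z ≤ g z) → ∀ z → adj f z ≤ adj g z
adj-mono h []      = z≤n
adj-mono h (b ∷ z) = +-mono-≤ (h (not b ∷ z)) (adj-mono (λ w → h (b ∷ w)) z)

adj-cong : ∀ {n} {f g : Cube n → ℕ} → (∀ z → f z ≡ g z) → ∀ z → adj f z ≡ adj g z
adj-cong h []      = refl
adj-cong h (b ∷ z) = cong₂ _+_ (h (not b ∷ z)) (adj-cong (λ w → h (b ∷ w)) z)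

adj-+ : ∀ {n} (f g : Cube n → ℕ) z → adj (λ w → f w + g w) z ≡ adj f z + adj g z
adj-+ f g []      = refl
adj-+ f g (b ∷ z) = trans (cong (f (not b ∷ z) + g (not b ∷ z) +_) (adj-+ (λ w → f (b ∷ w)) (λ w → g (b ∷ w)) z))
                          (interchange (f (not b ∷ z)) (g (not b ∷ z)) _ _)

adj-* : ∀ {n} c (f : Cube n → ℕ) z → adj (λ w → c * f w) z ≡ c * adj f z
adj-* c f []      = sym (*-zeroʳ c)
adj-* c f (b ∷ z) = trans (cong (c * f (not b ∷ z) +_) (adj-* c (λ w → f (b ∷ w)) z))
                          (sym (*-distribˡ-+ c (f (not b ∷ z)) _))

adj-const : ∀ {n} c (z : Cube n) → adj (λ _ → c) z ≡ n * c
adj-const c []      = refl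
adj-const c (b ∷ z) = cong (c +_) (adj-const c z)

-- Adjacency of the chosen vertex is recorded extensionally, as f z ≤ adj f w for all f.
adj-average : ∀ {n} (f g : Cube n → ℕ) z → 0 < adj g z → adj f z ≤ adj g z →
              Σ (Cube n) λ w → 0 < g w × f w ≤ g w × (∀ (h : Cube n → ℕ) → h z ≤ adj h w)
adj-average f g (b ∷ z) p q = pick (0 <? g (not b ∷ z)) (f (not b ∷ z) ≤? g (not b ∷ z))
  where
  Goal = Σ (Cube _) λ w → 0 < g w × f w ≤ g w × (∀ (h : Cube _ → ℕ) → h (b ∷ z) ≤ adj h w)
  fb = λ w → f (b ∷ w)
  gb = λ w → g (b ∷ w)
  not-not : ∀ c → not (not c) ≡ c
  not-not true  = refl
  not-not false = refl
  inTail : 0 < adj gb z → adj fb z ≤ adj gb z → Goal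
  inTail p′ q′ with adj-average fb gb z p′ q′
  ... | w , r , s , nb = b ∷ w , r , s , λ h → ≤-trans (nb (λ v → h (b ∷ v))) (m≤n+m _ _)
  pick : Dec (0 < g (not b ∷ z)) → Dec (f (not b ∷ z) ≤ g (not b ∷ z)) → Goal
  pick (yes p′) (yes q′) = not b ∷ z , p′ , q′ , λ h →
    ≤-trans (≤-reflexive (cong (λ c → h (c ∷ z)) (sym (not-not b)))) (m≤m+n _ _)
  pick (no ¬p) _ = inTail (subst (λ s → 0 < s + adj gb z) g≡0 p)
                          (≤-trans (m≤n+m _ _) (subst (λ s → _ ≤ s + adj gb z) g≡0 q))
    where g≡0 = n≤0⇒n≡0 (≮⇒≥ ¬p)
  pick (yes _) (no ¬q) = inTail (≤-<-trans z≤n smaller) (<⇒≤ smaller)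
    where
    smaller : adj fb z < adj gb z
    smaller = +-cancelˡ-< (f (not b ∷ z)) _ _ (<-≤-trans (s≤s q) (+-monoˡ-< (adj gb z) (≰⇒> ¬q)))

adj-self : ∀ {n} (f g : Cube n → ℕ) → ⟨ adj f , g ⟩ ≡ ⟨ f , adj g ⟩
adj-self {zero}  f g = sym (*-zeroʳ (f []))
adj-self {suc n} f g = begin
  sumV (λ z → (ff z + adj ft z) * gt z) + sumV (λ z → (ft z + adj ff z) * gf z)
    ≡⟨ cong₂ _+_ (distʳ ff (adj ft) gt) (distʳ ft (adj ff) gf) ⟩
  (⟨ ff , gt ⟩ + ⟨ adj ft , gt ⟩) + (⟨ ft , gf ⟩ + ⟨ adj ff , gf ⟩)
    ≡⟨ cong₂ (λ s t → (⟨ ff , gt ⟩ + s) + (⟨ ft , gf ⟩ + t)) (adj-self ft gt) (adj-self ff gf) ⟩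
  (⟨ ff , gt ⟩ + ⟨ ft , adj gt ⟩) + (⟨ ft , gf ⟩ + ⟨ ff , adj gf ⟩)
    ≡⟨ shuffle ⟨ ff , gt ⟩ ⟨ ft , adj gt ⟩ ⟨ ft , gf ⟩ ⟨ ff , adj gf ⟩ ⟩
  (⟨ ft , gf ⟩ + ⟨ ft , adj gt ⟩) + (⟨ ff , gt ⟩ + ⟨ ff , adj gf ⟩)
    ≡⟨ sym (cong₂ _+_ (distˡ ft gf (adj gt)) (distˡ ff gt (adj gf))) ⟩
  sumV (λ z → ft z * (gf z + adj gt z)) + sumV (λ z → ff z * (gt z + adj gf z)) ∎
  where
  open ≡-Reasoning
  ft = λ z → f (true ∷ z)
  gt = λ z → g (true ∷ z)
  ff = λ z → f (false ∷ z)
  gf = λ z → g (false ∷ z)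
  distʳ : ∀ (a b c : Cube n → ℕ) → sumV (λ z → (a z + b z) * c z) ≡ ⟨ a , c ⟩ + ⟨ b , c ⟩
  distʳ a b c = trans (sumV-cong (λ z → *-distribʳ-+ (c z) (a z) (b z))) (sumV-+ (λ z → a z * c z) (λ z → b z * c z))
  distˡ : ∀ (a b c : Cube n → ℕ) → sumV (λ z → a z * (b z + c z)) ≡ ⟨ a , b ⟩ + ⟨ a , c ⟩
  distˡ a b c = trans (sumV-cong (λ z → *-distribˡ-+ (a z) (b z) (c z))) (sumV-+ (λ z → a z * b z) (λ z → a z * c z))
  shuffle : ∀ a b c d → (a + b) + (c + d) ≡ (c + b) + (a + d)
  shuffle = solve-∀

pow-mono : ∀ {n} t {f g : Cube n → ℕ} → (∀ z → f z ≤ g z) → ∀ z → pow t f z ≤ pow t g z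
pow-mono zero    h = h
pow-mono (suc t) h = adj-mono (pow-mono t h)

pow-cong : ∀ {n} t {f g : Cube n → ℕ} → (∀ z → f z ≡ g z) → ∀ z → pow t f z ≡ pow t g z
pow-cong zero    h = h
pow-cong (suc t) h = adj-cong (pow-cong t h)

pow-+ : ∀ {n} t (f g : Cube n → ℕ) z → pow t (λ w → f w + g w) z ≡ pow t f z + pow t g z
pow-+ zero    f g z = refl
pow-+ (suc t) f g z = trans (adj-cong (pow-+ t f g) z) (adj-+ _ _ z)

pow-* : ∀ {n} t c (f : Cube n → ℕ) z → pow t (λ w → c * f w) z ≡ c * pow t f z
pow-* zero    c f z = refl
pow-* (suc t) c f z = trans (adj-cong (pow-* t c f) z) (adj-* c _ z)

pow-const : ∀ {n} t c (z : Cube n) → pow t (λ _ → c) z ≡ n ^ t * c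
pow-const     zero    c z = sym (+-identityʳ c)
pow-const {n} (suc t) c z = trans (adj-cong (pow-const t c) z)
                                  (trans (adj-const _ z) (sym (*-assoc n (n ^ t) c)))

pow-pow : ∀ {n} s t (f : Cube n → ℕ) z → pow s (pow t f) z ≡ pow (s + t) f z
pow-pow zero    t f z = refl
pow-pow (suc s) t f z = adj-cong (pow-pow s t f) z

pow-comm : ∀ {n} t (f : Cube n → ℕ) z → pow t (adj f) z ≡ adj (pow t f) z
pow-comm zero    f z = refl
pow-comm (suc t) f z = adj-cong (pow-comm t f) z

⟨⟩-congˡ : ∀ {n} {f f′ : Cube n → ℕ} (g : Cube n → ℕ) → (∀ z → f z ≡ f′ z) → ⟨ f , g ⟩ ≡ ⟨ f′ , g ⟩
⟨⟩-congˡ g p = sumV-cong (λ z → cong (_* g z) (p z))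

⟨⟩-congʳ : ∀ {n} (f : Cube n → ℕ) {g g′ : Cube n → ℕ} → (∀ z → g z ≡ g′ z) → ⟨ f , g ⟩ ≡ ⟨ f , g′ ⟩
⟨⟩-congʳ f p = sumV-cong (λ z → cong (f z *_) (p z))

⟨⟩-monoˡ : ∀ {n} {f f′ : Cube n → ℕ} (g : Cube n → ℕ) → (∀ z → f z ≤ f′ z) → ⟨ f , g ⟩ ≤ ⟨ f′ , g ⟩
⟨⟩-monoˡ g p = sumV-mono (λ z → *-monoˡ-≤ (g z) (p z))

⟨⟩-comm : ∀ {n} (f g : Cube n → ℕ) → ⟨ f , g ⟩ ≡ ⟨ g , f ⟩
⟨⟩-comm f g = sumV-cong (λ z → *-comm (f z) (g z))

⟨⟩-+ˡ : ∀ {n} (f g h : Cube n → ℕ) → ⟨ (λ z → f z + g z) , h ⟩ ≡ ⟨ f , h ⟩ + ⟨ g , h ⟩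
⟨⟩-+ˡ f g h = trans (sumV-cong (λ z → *-distribʳ-+ (h z) (f z) (g z))) (sumV-+ (λ z → f z * h z) (λ z → g z * h z))

⟨⟩-+ʳ : ∀ {n} (f g h : Cube n → ℕ) → ⟨ f , (λ z → g z + h z) ⟩ ≡ ⟨ f , g ⟩ + ⟨ f , h ⟩
⟨⟩-+ʳ f g h = trans (sumV-cong (λ z → *-distribˡ-+ (f z) (g z) (h z))) (sumV-+ (λ z → f z * g z) (λ z → f z * h z))

⟨⟩-*ˡ : ∀ {n} c (f g : Cube n → ℕ) → ⟨ (λ z → c * f z) , g ⟩ ≡ c * ⟨ f , g ⟩
⟨⟩-*ˡ c f g = trans (sumV-cong (λ z → *-assoc c (f z) (g z))) (sumV-* c (λ z → f z * g z))

pow-self : ∀ {n} t (f g : Cube n → ℕ) → ⟨ pow t f , g ⟩ ≡ ⟨ f , pow t g ⟩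
pow-self zero    f g = refl
pow-self (suc t) f g = trans (adj-self (pow t f) g) (trans (pow-self t f (adj g))
  (⟨⟩-congʳ f (pow-comm t g)))

pow-shift : ∀ {n} s t (f g : Cube n → ℕ) → ⟨ pow s f , pow t g ⟩ ≡ ⟨ f , pow (s + t) g ⟩
pow-shift s t f g = trans (pow-self s f (pow t g)) (⟨⟩-congʳ f (pow-pow s t g))

-- Indicators, finite sums and powers of two.

⟦_⟧ : Bool → ℕ
⟦ b ⟧ = if b then 1 else 0

sumN : ℕ → (ℕ → ℕ) → ℕ
sumN zero    f = 0
sumN (suc t) f = f 0 + sumN t (λ i → f (suc i))

prodN : ℕ → (ℕ → ℕ) → ℕ
prodN zero    f = 1
prodN (suc t) f = f 0 * prodN t (λ i → f (suc i))

pow2 : ℕ → ℕ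
pow2 zero    = 1
pow2 (suc l) = pow2 l + pow2 l

pow2≡2^ : ∀ l → pow2 l ≡ 2 ^ l
pow2≡2^ zero    = refl
pow2≡2^ (suc l) = trans (cong₂ _+_ (pow2≡2^ l) (pow2≡2^ l)) (cong (2 ^ l +_) (sym (+-identityʳ (2 ^ l))))

pow2>0 : ∀ l → 0 < pow2 l
pow2>0 zero    = s≤s z≤n
pow2>0 (suc l) = ≤-trans (pow2>0 l) (m≤m+n _ _)

join : ∀ {A : Set} → ℕ → (ℕ → A) → (ℕ → A) → ℕ → A
join zero    u v i       = v i
join (suc h) u v zero    = u 0
join (suc h) u v (suc i) = join h (λ j → u (suc j)) v i

sumN-join : ∀ {A : Set} h t (u v : ℕ → A) (φ : A → ℕ) →
            sumN (h + t) (λ i → φ (join h u v i)) ≡ sumN h (λ i → φ (u i)) + sumN t (λ i → φ (v i))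
sumN-join zero    t u v φ = refl
sumN-join (suc h) t u v φ =
  trans (cong (φ (u 0) +_) (sumN-join h t (λ i → u (suc i)) v φ)) (sym (+-assoc (φ (u 0)) _ _))

join-elim : ∀ {A : Set} h t (u v : ℕ → A) (P : ℕ → A → Set) →
            (∀ i → i < h → P i (u i)) → (∀ i → i < t → P (h + i) (v i)) →
            ∀ i → i < h + t → P i (join h u v i)
join-elim zero    t u v P p q i       i<     = q i i<
join-elim (suc h) t u v P p q zero    i<     = p 0 (s≤s z≤n)
join-elim (suc h) t u v P p q (suc i) (s≤s i<) =
  join-elim h t (λ j → u (suc j)) v (λ j → P (suc j)) (λ j j< → p (suc j) (s≤s j<)) q i i<

-- Convexity bounds for walks weighted by tests.

-- The two children of a search node receive complementary weights, so each level multiplies the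
-- total weight of a walk by exactly 4.
weight : Bool → ℕ
weight fail = if fail then 1 else 3

weight-not : ∀ b → weight b + weight (not b) ≡ 4
weight-not true  = refl
weight-not false = refl

-- u counts walks; f counts them with weight 3 for each of the R tests passed, and T counts them
-- with multiplicity the number of tests failed.  The tangent inequalities are the supporting lines
-- of the Jensen bound f ≥ 3^(R - T/u) u; w pairs with u so that ⟨ T , w ⟩ is a number of failures.
record Side {n} (u w : Cube n → ℕ) (κ E : ℕ) (f T : Cube n → ℕ) (R : ℕ) : Set where
  field
    tangent : ∀ θ z → 3 ^ R * (suc θ * u z) ≤ 3 ^ θ * f z + 3 ^ R * T z
    above   : ∀ z → u z ≤ f z
    charge  : κ * ⟨ T , w ⟩ ≤ R * E
open Side

side-init : ∀ {n} (u w : Cube n → ℕ) κ E → Side u w κ E u (λ _ → 0) 0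
side-init {n} u w κ E .tangent θ z = begin
  1 * (suc θ * u z)     ≡⟨ *-identityˡ _ ⟩
  suc θ * u z           ≤⟨ *-monoˡ-≤ (u z) (suc≤3^ θ) ⟩
  3 ^ θ * u z           ≤⟨ m≤m+n _ _ ⟩
  3 ^ θ * u z + 1 * 0   ∎
  where
  open ≤-Reasoning
  suc≤3^ : ∀ θ → suc θ ≤ 3 ^ θ
  suc≤3^ zero    = ≤-refl
  suc≤3^ (suc θ) = begin
    1 + suc θ         ≤⟨ +-mono-≤ (m^n>0 3 θ) (suc≤3^ θ) ⟩
    3 ^ θ + 3 ^ θ     ≤⟨ +-monoʳ-≤ (3 ^ θ) (m≤m+n _ _) ⟩
    3 * 3 ^ θ         ∎
side-init u w κ E .above z = ≤-refl
side-init {n} u w κ E .charge = ≤-reflexive (trans (cong (κ *_) (trans (sumV-const n 0) (*-zeroʳ (2 ^ n)))) (*-zeroʳ κ))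

-- The fields are linear inequalities in the walk counts and survive `h` further steps; the charge
-- does so because `pow h` is self-adjoint. The test then multiplies `f` by its weight and adds the
-- failing walks to `T`.
side-step : ∀ {n} (u w u′ w′ : Cube n → ℕ) κ E f T R h (fail : Cube n → Bool) →
            (∀ z → pow h u z ≡ u′ z) → (∀ z → pow h w′ z ≡ w z) →
            κ * ⟨ (λ z → ⟦ fail z ⟧ * u′ z) , w′ ⟩ ≤ E → Side u w κ E f T R →
            Side u′ w′ κ E (λ z → weight (fail z) * pow h f z)
                           (λ z → pow h T z + ⟦ fail z ⟧ * u′ z) (suc R)
side-step {n} u w u′ w′ κ E f T R h fail uEq wEq failures S = record
  { tangent = λ θ z → step (fail z) θ z
  ; above   = λ z → ≤-trans (above′ z) (m≤weight* (fail z) (pow h f z))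
  ; charge  = charge′
  }
  where
  open ≤-Reasoning
  m≤weight* : ∀ b m → m ≤ weight b * m
  m≤weight* true  m = m≤m+n m _
  m≤weight* false m = m≤m+n m _
  above′ : ∀ z → u′ z ≤ pow h f z
  above′ z = ≤-trans (≤-reflexive (sym (uEq z))) (pow-mono h (above S) z)
  tangent′ : ∀ θ z → 3 ^ R * (suc θ * u′ z) ≤ 3 ^ θ * pow h f z + 3 ^ R * pow h T z
  tangent′ θ z = begin
    3 ^ R * (suc θ * u′ z)                     ≡⟨ cong (λ m → 3 ^ R * (suc θ * m)) (sym (uEq z)) ⟩
    3 ^ R * (suc θ * pow h u z)                ≡⟨ cong (3 ^ R *_) (sym (pow-* h (suc θ) u z)) ⟩
    3 ^ R * pow h (λ z → suc θ * u z) z        ≡⟨ sym (pow-* h (3 ^ R) (λ z → suc θ * u z) z) ⟩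
    pow h (λ z → 3 ^ R * (suc θ * u z)) z      ≤⟨ pow-mono h (tangent S θ) z ⟩
    pow h (λ z → 3 ^ θ * f z + 3 ^ R * T z) z  ≡⟨ pow-+ h (λ z → 3 ^ θ * f z) (λ z → 3 ^ R * T z) z ⟩
    pow h (λ z → 3 ^ θ * f z) z + pow h (λ z → 3 ^ R * T z) z
      ≡⟨ cong₂ _+_ (pow-* h (3 ^ θ) f z) (pow-* h (3 ^ R) T z) ⟩
    3 ^ θ * pow h f z + 3 ^ R * pow h T z      ∎
  step : ∀ b θ z → 3 ^ suc R * (suc θ * u′ z) ≤
         3 ^ θ * (weight b * pow h f z) + 3 ^ suc R * (pow h T z + ⟦ b ⟧ * u′ z)
  step false θ z = begin
    3 * 3 ^ R * (suc θ * u′ z)                         ≡⟨ *-assoc 3 (3 ^ R) _ ⟩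
    3 * (3 ^ R * (suc θ * u′ z))                       ≤⟨ *-monoʳ-≤ 3 (tangent′ θ z) ⟩
    3 * (3 ^ θ * pow h f z + 3 ^ R * pow h T z)        ≡⟨ ring (3 ^ θ) (pow h f z) (3 ^ R) (pow h T z) ⟩
    3 ^ θ * (3 * pow h f z) + 3 * 3 ^ R * (pow h T z + 0) ∎
    where
    ring : ∀ a p b q → 3 * (a * p + b * q) ≡ a * (3 * p) + 3 * b * (q + 0)
    ring = solve-∀
  -- There is no earlier line to use at θ = 0, but the failing walks now in `T` cover the left side
  -- by themselves.
  step true zero z = begin
    3 * 3 ^ R * (1 * u′ z)                         ≤⟨ *-monoʳ-≤ (3 * 3 ^ R) (m≤n+m (1 * u′ z) (pow h T z)) ⟩
    3 * 3 ^ R * (pow h T z + 1 * u′ z)             ≤⟨ m≤n+m _ _ ⟩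
    1 * (1 * pow h f z) + 3 * 3 ^ R * (pow h T z + 1 * u′ z) ∎
  -- A failed test forfeits the factor 3, so the line at θ + 1 comes from the old line at θ; the
  -- additional copy of `u′` is supplied by `T`.
  step true (suc θ) z = begin
    3 * 3 ^ R * (suc (suc θ) * u′ z)               ≡⟨ ring₁ (3 ^ R) θ (u′ z) ⟩
    3 * (3 ^ R * (suc θ * u′ z)) + 3 * 3 ^ R * u′ z
      ≤⟨ +-monoˡ-≤ _ (*-monoʳ-≤ 3 (tangent′ θ z)) ⟩
    3 * (3 ^ θ * pow h f z + 3 ^ R * pow h T z) + 3 * 3 ^ R * u′ z
      ≡⟨ ring₂ (3 ^ θ) (pow h f z) (3 ^ R) (pow h T z) (u′ z) ⟩
    3 * 3 ^ θ * (1 * pow h f z) + 3 * 3 ^ R * (pow h T z + 1 * u′ z) ∎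
    where
    ring₁ : ∀ a θ v → 3 * a * ((2 + θ) * v) ≡ 3 * (a * ((1 + θ) * v)) + 3 * a * v
    ring₁ = solve-∀
    ring₂ : ∀ a p b q v → 3 * (a * p + b * q) + 3 * b * v ≡ 3 * a * (1 * p) + 3 * b * (q + 1 * v)
    ring₂ = solve-∀
  charge′ : κ * ⟨ (λ z → pow h T z + ⟦ fail z ⟧ * u′ z) , w′ ⟩ ≤ suc R * E
  charge′ = begin
    κ * ⟨ (λ z → pow h T z + ⟦ fail z ⟧ * u′ z) , w′ ⟩
      ≡⟨ cong (κ *_) (⟨⟩-+ˡ (pow h T) (λ z → ⟦ fail z ⟧ * u′ z) w′) ⟩
    κ * (⟨ pow h T , w′ ⟩ + failed)
      ≡⟨ cong (λ m → κ * (m + failed)) (trans (pow-self h T w′) (⟨⟩-congʳ T wEq)) ⟩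
    κ * (⟨ T , w ⟩ + failed)     ≡⟨ *-distribˡ-+ κ _ failed ⟩
    κ * ⟨ T , w ⟩ + κ * failed   ≤⟨ +-mono-≤ (charge S) failures ⟩
    R * E + E                    ≡⟨ +-comm (R * E) E ⟩
    suc R * E                    ∎
    where failed = ⟨ (λ z → ⟦ fail z ⟧ * u′ z) , w′ ⟩

≤ᵇ-cases : ∀ m n → ⟦ m ≤ᵇ n ⟧ * m ≤ n
≤ᵇ-cases m n with m ≤ᵇ n | ≤ᵇ⇒≤ m n
... | true  | le = ≤-trans (≤-reflexive (+-identityʳ m)) (le _)
... | false | _  = z≤n

≰ᵇ-cases : ∀ m n → ⟦ not (m ≤ᵇ n) ⟧ * n ≤ m
≰ᵇ-cases m n with m ≤ᵇ n | ≤⇒≤ᵇ {m} {n}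
... | true  | _  = z≤n
... | false | ge = ≤-trans (≤-reflexive (+-identityʳ n)) (<⇒≤ (≰⇒> ge))

-- The noisy binary search for the retraced position.

-- `f` and `T` belong to the part of the walk that starts in `X`, `g` and `U` to the part that ends
-- in `Y`; `R` and `S` count the turns to the right and to the left.
record Leaf (n : ℕ) : Set where
  field
    f T g U : Cube n → ℕ
    R S     : ℕ

-- `Λ` sets the threshold of the tests; `ν` will be n², the factor by which two more steps multiply
-- the number of walks.
module Tree {n} (X Y : Cube n → ℕ) (Λ ν k : ℕ) where

  G₋ G₊ : ℕ
  G₋ = ⟨ X , pow (k ∸ 2) Y ⟩
  G₊ = ⟨ X , pow (2 + k) Y ⟩

  -- Prefix and suffix both contain the retraced edge, whence the lengths a + 1 and b + 1 although a
  -- + 1 + b = k at a leaf. The function paired with each completes it to a k-walk, so that charges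
  -- count failures on k-walks.
  PrefixSide SuffixSide : ℕ → ℕ → (f T : Cube n → ℕ) → ℕ → Set
  PrefixSide a b f T R = Side (pow (suc a) X) (pow b Y) Λ (ν * G₋) f T R
  SuffixSide b a g U S = Side (pow (suc b) Y) (pow a X) ν (Λ * G₊) g U S

  LeafOK : ℕ → ℕ → Leaf n → Set
  LeafOK L i lf = ∀ b → suc (i + b) ≡ k →
    PrefixSide i b f T R × SuffixSide b i g U S × R + S ≡ L
    where open Leaf lf

  -- A (k+2)-walk obtained by inserting a back-and-forth at position i < j (resp. i ≥ j) visits at time
  -- j + 1 a vertex distributed like time j ∸ 1 (resp. j + 1) of a k-walk; the test compares the two.
  rightFails : ℕ → Cube n → Bool
  rightFails j z = Λ * pow (suc j) X z ≤ᵇ ν * pow (j ∸ 1) X z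

  -- On the failing set `pow (suc j) X` is at most ν/Λ times `pow (j ∸ 1) X`, and exchanging the two
  -- turns k-walks into (k-2)-walks.
  rightFailures : ∀ j q → suc (j + q) ≡ k → 0 < j →
    Λ * ⟨ (λ z → ⟦ rightFails j z ⟧ * pow (suc j) X z) , pow q Y ⟩ ≤ ν * G₋
  rightFailures (suc j) q eq _ = begin
    Λ * ⟨ (λ z → ⟦ rightFails (suc j) z ⟧ * u z) , pow q Y ⟩
      ≡⟨ sym (⟨⟩-*ˡ Λ _ (pow q Y)) ⟩
    ⟨ (λ z → Λ * (⟦ rightFails (suc j) z ⟧ * u z)) , pow q Y ⟩
      ≤⟨ ⟨⟩-monoˡ (pow q Y) (λ z → ≤-trans (≤-reflexive (swap Λ ⟦ rightFails (suc j) z ⟧ (u z)))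
                                             (≤ᵇ-cases (Λ * u z) (ν * pow j X z))) ⟩
    ⟨ (λ z → ν * pow j X z) , pow q Y ⟩   ≡⟨ ⟨⟩-*ˡ ν (pow j X) (pow q Y) ⟩
    ν * ⟨ pow j X , pow q Y ⟩             ≡⟨ cong (ν *_) (pow-shift j q X Y) ⟩
    ν * ⟨ X , pow (j + q) Y ⟩             ≡⟨ cong (λ m → ν * ⟨ X , pow m Y ⟩) (cong (_∸ 2) eq) ⟩
    ν * G₋                                ∎
    where
    open ≤-Reasoning
    u = pow (2 + j) X
    swap : ∀ a b c → a * (b * c) ≡ b * (a * c)
    swap = solve-∀

  -- The mirror image: where the test points right, `pow (j ∸ 1) X` is at most Λ/ν times
  -- `pow (suc j) X`, and the exchange lengthens k-walks to (k+2)-walks.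
  leftFailures : ∀ j q → j + q ≡ k → 0 < j →
    ν * ⟨ (λ z → ⟦ not (rightFails j z) ⟧ * pow (suc q) Y z) , pow (j ∸ 1) X ⟩ ≤ Λ * G₊
  leftFailures (suc j) q eq _ = begin
    ν * ⟨ (λ z → ⟦ φ z ⟧ * v z) , pow j X ⟩
      ≡⟨ sym (sumV-* ν (λ z → ⟦ φ z ⟧ * v z * pow j X z)) ⟩
    sumV (λ z → ν * (⟦ φ z ⟧ * v z * pow j X z))
      ≤⟨ sumV-mono (λ z → ≤-trans (≤-reflexive (swap ν ⟦ φ z ⟧ (v z) (pow j X z)))
                          (*-monoˡ-≤ (v z) (≰ᵇ-cases (Λ * pow (2 + j) X z) (ν * pow j X z)))) ⟩
    ⟨ (λ z → Λ * pow (2 + j) X z) , v ⟩   ≡⟨ ⟨⟩-*ˡ Λ (pow (2 + j) X) v ⟩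
    Λ * ⟨ pow (2 + j) X , v ⟩             ≡⟨ cong (Λ *_) (pow-shift (2 + j) (suc q) X Y) ⟩
    Λ * ⟨ X , pow (2 + j + suc q) Y ⟩     ≡⟨ cong (λ m → Λ * ⟨ X , pow m Y ⟩)
                                               (cong suc (trans (+-suc (suc j) q) (cong suc eq))) ⟩
    Λ * G₊                                ∎
    where
    open ≤-Reasoning
    v = pow (suc q) Y
    φ = λ z → not (rightFails (suc j) z)
    swap : ∀ a b c d → a * (b * c * d) ≡ b * (a * d) * c
    swap = solve-∀

  -- A walk whose midpoint is z enters the left child with `weight (not (φ z))` and the right child
  -- with `weight (φ z)`, which add up to 4.
  halves : ∀ h (φ : Cube n → Bool) (f g : Cube n → ℕ) →
    ⟨ f , pow h (λ z → weight (not (φ z)) * pow h g z) ⟩ +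
    ⟨ (λ z → weight (φ z) * pow h f z) , pow h g ⟩ ≡ 4 * ⟨ f , pow (h + h) g ⟩
  halves h φ f g = begin
    ⟨ f , pow h (λ z → weight (not (φ z)) * pow h g z) ⟩ + ⟨ (λ z → weight (φ z) * pow h f z) , pow h g ⟩
      ≡⟨ cong (_+ ⟨ (λ z → weight (φ z) * pow h f z) , pow h g ⟩) (sym (pow-self h f _)) ⟩
    ⟨ pow h f , (λ z → weight (not (φ z)) * pow h g z) ⟩ + ⟨ (λ z → weight (φ z) * pow h f z) , pow h g ⟩
      ≡⟨ sym (sumV-+ (λ z → pow h f z * (weight (not (φ z)) * pow h g z))
                     (λ z → weight (φ z) * pow h f z * pow h g z)) ⟩
    sumV (λ z → pow h f z * (weight (not (φ z)) * pow h g z) + weight (φ z) * pow h f z * pow h g z)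
      ≡⟨ sumV-cong (λ z → trans (ring (pow h f z) (pow h g z) (weight (φ z)) _)
                                (cong (_* (pow h f z * pow h g z)) (weight-not (φ z)))) ⟩
    sumV (λ z → 4 * (pow h f z * pow h g z))   ≡⟨ sumV-* 4 (λ z → pow h f z * pow h g z) ⟩
    4 * ⟨ pow h f , pow h g ⟩                  ≡⟨ cong (4 *_) (pow-shift h h f g) ⟩
    4 * ⟨ f , pow (h + h) g ⟩                  ∎
    where
    open ≡-Reasoning
    ring : ∀ p q a b → p * (b * q) + a * p * q ≡ (a + b) * (p * q)
    ring = solve-∀

  -- The single `adj` is the step back along the retraced edge, between its first traversal in `f`
  -- and its second in `g`.
  leafMass : Leaf n → ℕ
  leafMass lf = ⟨ f , adj g ⟩
    where open Leaf lf

  -- A node stands for the positions from a to a + 2^l - 1. Turning left pulls the suffix back to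
  -- the midpoint, turning right pushes the prefix forward to it; they meet at time j + 1 of the
  -- (k+2)-walk, where the test is made.
  tree : ∀ l a b → a + pow2 l + b ≡ k → ∀ f T R g U S →
    PrefixSide a (pow2 l + b ∸ 1) f T R → SuffixSide b (a + pow2 l ∸ 1) g U S →
    Σ (ℕ → Leaf n) λ lf → (∀ i → i < pow2 l → LeafOK (R + S + l) (a + i) (lf i)) ×
      sumN (pow2 l) (λ i → leafMass (lf i)) ≡ 4 ^ l * ⟨ f , pow (pow2 l) g ⟩
  tree zero a b eq f T R g U S pre suf = (λ _ → record { f = f ; T = T ; g = g ; U = U ; R = R ; S = S })
    , (λ { zero i< b′ eq′ → ok b′ eq′ ; (suc i) (s≤s ()) })
    , refl
    where
    ok : ∀ b′ → suc (a + 0 + b′) ≡ k →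
      PrefixSide (a + 0) b′ f T R × SuffixSide b′ (a + 0) g U S × R + S ≡ R + S + 0
    ok b′ eq′ with +-cancelˡ-≡ (suc a) b′ b (trans (cong (λ m → suc (m + b′)) (sym (+-identityʳ a)))
                     (trans eq′ (trans (sym eq) (cong (_+ b) (+-comm a 1)))))
    ... | refl = subst (λ i → PrefixSide i b f T R) (sym (+-identityʳ a)) pre
               , subst (λ i → SuffixSide b i g U S) (trans (m+n∸n≡m a 1) (sym (+-identityʳ a))) suf
               , sym (+-identityʳ (R + S))
  tree (suc l) a b eq f T R g U S pre suf = join h (proj₁ left) (proj₁ right)
    , join-elim h h (proj₁ left) (proj₁ right) (λ i → LeafOK (R + S + suc l) (a + i))
        (λ i i< → subst (λ L → LeafOK L (a + i) (proj₁ left i)) idxL (proj₁ (proj₂ left) i i<))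
        (λ i i< → subst₂ (λ L j → LeafOK L j (proj₁ right i)) idxR (+-assoc a h i) (proj₁ (proj₂ right) i i<))
    , mass
    where
    h = pow2 l
    j = a + h
    0<h = pow2>0 l
    0<j : 0 < j
    0<j = ≤-trans 0<h (m≤n+m h a)
    φ = rightFails j
    g′ = λ z → weight (not (φ z)) * pow h g z
    f′ = λ z → weight (φ z) * pow h f z
    h+h+b : ∀ c → h + h + c ∸ 1 ≡ h + (h + c ∸ 1)
    h+h+b c = trans (cong (_∸ 1) (+-assoc h h c)) (+-∸-assoc h (≤-trans 0<h (m≤m+n h c)))
    a+h+h : a + (h + h) ∸ 1 ≡ h + (j ∸ 1)
    a+h+h = trans (cong (_∸ 1) (trans (sym (+-assoc a h h)) (+-comm j h))) (+-∸-assoc h 0<j)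
    sufStep : SuffixSide (b + h) (j ∸ 1) g′ (λ z → pow h U z + ⟦ not (φ z) ⟧ * pow (suc (b + h)) Y z) (suc S)
    sufStep = side-step (pow (suc b) Y) _ (pow (suc (b + h)) Y) (pow (j ∸ 1) X) ν (Λ * G₊) g U S h (λ z → not (φ z))
      (λ z → trans (pow-pow h (suc b) Y z) (cong (λ m → pow m Y z) (trans (+-suc h b) (cong suc (+-comm h b)))))
      (λ z → trans (pow-pow h (j ∸ 1) X z) (cong (λ m → pow m X z) (sym a+h+h)))
      (leftFailures j (b + h) (trans (ring a h b) eq) 0<j) suf
      where
      ring : ∀ a h b → a + h + (b + h) ≡ a + (h + h) + b
      ring = solve-∀
    preStep : PrefixSide j (h + b ∸ 1) f′ (λ z → pow h T z + ⟦ φ z ⟧ * pow (suc j) X z) (suc R)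
    preStep = side-step (pow (suc a) X) _ (pow (suc j) X) (pow (h + b ∸ 1) Y) Λ (ν * G₋) f T R h φ
      (λ z → trans (pow-pow h (suc a) X z) (cong (λ m → pow m X z) (trans (+-suc h a) (cong suc (+-comm h a)))))
      (λ z → trans (pow-pow h (h + b ∸ 1) Y z) (cong (λ m → pow m Y z) (sym (h+h+b b))))
      (rightFailures j (h + b ∸ 1) (trans (sym (+-suc j _))
        (trans (cong (j +_) (m+[n∸m]≡n {1} (≤-trans 0<h (m≤m+n h b)))) (trans (ring a h b) eq))) 0<j) pre
      where
      ring : ∀ a h b → a + h + (h + b) ≡ a + (h + h) + b
      ring = solve-∀
    left = tree l a (b + h) (trans (ring a h b) eq) f T R g′ _ (suc S)
             (subst (λ m → PrefixSide a m f T R) (cong (_∸ 1) (ring′ h b)) pre) sufStep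
      where
      ring : ∀ a h b → a + h + (b + h) ≡ a + (h + h) + b
      ring = solve-∀
      ring′ : ∀ h b → h + h + b ≡ h + (b + h)
      ring′ = solve-∀
    right = tree l j b (trans (cong (_+ b) (+-assoc a h h)) eq) f′ _ (suc R) g U S preStep
              (subst (λ m → SuffixSide b m g U S) (cong (_∸ 1) (sym (+-assoc a h h))) suf)
    idxL : R + suc S + l ≡ R + S + suc l
    idxL = trans (cong (_+ l) (+-suc R S)) (sym (+-suc (R + S) l))
    idxR : suc R + S + l ≡ R + S + suc l
    idxR = sym (+-suc (R + S) l)
    mass : sumN (h + h) (λ i → leafMass (join h (proj₁ left) (proj₁ right) i)) ≡ 4 ^ suc l * ⟨ f , pow (h + h) g ⟩
    mass = begin
      sumN (h + h) (λ i → leafMass (join h (proj₁ left) (proj₁ right) i))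
        ≡⟨ sumN-join h h (proj₁ left) (proj₁ right) leafMass ⟩
      sumN h (λ i → leafMass (proj₁ left i)) + sumN h (λ i → leafMass (proj₁ right i))
        ≡⟨ cong₂ _+_ (proj₂ (proj₂ left)) (proj₂ (proj₂ right)) ⟩
      4 ^ l * ⟨ f , pow h g′ ⟩ + 4 ^ l * ⟨ f′ , pow h g ⟩    ≡⟨ sym (*-distribˡ-+ (4 ^ l) _ _) ⟩
      4 ^ l * (⟨ f , pow h g′ ⟩ + ⟨ f′ , pow h g ⟩)          ≡⟨ cong (4 ^ l *_) (halves h φ f g) ⟩
      4 ^ l * (4 * ⟨ f , pow (h + h) g ⟩)                    ≡⟨ ring (4 ^ l) _ ⟩
      4 ^ suc l * ⟨ f , pow (h + h) g ⟩                      ∎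
      where
      open ≡-Reasoning
      ring : ∀ p q → p * (4 * q) ≡ 4 * p * q
      ring = solve-∀

-- Arithmetic: AM-GM, telescoping products, rounded quotients.

*-pos : ∀ {m n} → 0 < m → 0 < n → 0 < m * n
*-pos = *-mono-≤

*-pos⁻¹ʳ : ∀ m {n} → 0 < m * n → 0 < n
*-pos⁻¹ʳ m {zero}  p = subst (0 <_) (*-zeroʳ m) p
*-pos⁻¹ʳ m {suc n} p = s≤s z≤n

*-pos⁻¹ˡ : ∀ {m} n → 0 < m * n → 0 < m
*-pos⁻¹ˡ {suc m} n p = s≤s z≤n

cancelˡ : ∀ c {m n} → 0 < c → c * m ≤ c * n → m ≤ n
cancelˡ (suc c) _ = *-cancelˡ-≤ (suc c)

cancelʳ : ∀ c {m n} → 0 < c → m * c ≤ n * c → m ≤ n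
cancelʳ (suc c) _ = *-cancelʳ-≤ _ _ (suc c)

*-^ : ∀ a b t → (a * b) ^ t ≡ a ^ t * b ^ t
*-^ a b zero    = refl
*-^ a b (suc t) = trans (cong (a * b *_) (*-^ a b t)) (ring a b (a ^ t) (b ^ t))
  where
  ring : ∀ a b c d → a * b * (c * d) ≡ a * c * (b * d)
  ring = solve-∀

sumN-mono : ∀ t {f g : ℕ → ℕ} → (∀ i → i < t → f i ≤ g i) → sumN t f ≤ sumN t g
sumN-mono zero    h = z≤n
sumN-mono (suc t) h = +-mono-≤ (h 0 (s≤s z≤n)) (sumN-mono t (λ i i< → h (suc i) (s≤s i<)))

sumN-lin : ∀ t c d (f g : ℕ → ℕ) → sumN t (λ i → c * f i + d * g i) ≡ c * sumN t f + d * sumN t g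
sumN-lin zero    c d f g = sym (cong₂ _+_ (*-zeroʳ c) (*-zeroʳ d))
sumN-lin (suc t) c d f g = trans (cong (c * f 0 + d * g 0 +_) (sumN-lin t c d (λ i → f (suc i)) (λ i → g (suc i))))
  (ring c d (f 0) (g 0) (sumN t λ i → f (suc i)) (sumN t λ i → g (suc i)))
  where
  ring : ∀ c d a b x y → c * a + d * b + (c * x + d * y) ≡ c * (a + x) + d * (b + y)
  ring = solve-∀

sumN-const : ∀ t c → sumN t (λ _ → c) ≡ t * c
sumN-const zero    c = refl
sumN-const (suc t) c = cong (c +_) (sumN-const t c)

sumN-split : ∀ s t f → sumN (s + t) f ≡ sumN s f + sumN t (λ i → f (s + i))
sumN-split zero    t f = refl
sumN-split (suc s) t f = trans (cong (f 0 +_) (sumN-split s t (λ i → f (suc i)))) (sym (+-assoc (f 0) _ _))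

prodN-split : ∀ s t f → prodN (s + t) f ≡ prodN s f * prodN t (λ i → f (s + i))
prodN-split zero    t f = sym (+-identityʳ _)
prodN-split (suc s) t f = trans (cong (f 0 *_) (prodN-split s t (λ i → f (suc i)))) (sym (*-assoc (f 0) _ _))

4xy≤[x+y]² : ∀ x y → 4 * (x * y) ≤ (x + y) * (x + y)
4xy≤[x+y]² x y with ≤-total x y
... | inj₁ x≤y = subst (λ y → 4 * (x * y) ≤ (x + y) * (x + y)) (m+[n∸m]≡n x≤y)
                   (≤-trans (m≤m+n _ ((y ∸ x) * (y ∸ x))) (≤-reflexive (ring x (y ∸ x))))
  where
  ring : ∀ x d → 4 * (x * (x + d)) + d * d ≡ (x + (x + d)) * (x + (x + d))
  ring = solve-∀
... | inj₂ y≤x = subst (λ x → 4 * (x * y) ≤ (x + y) * (x + y)) (m+[n∸m]≡n y≤x)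
                   (≤-trans (m≤m+n _ ((x ∸ y) * (x ∸ y))) (≤-reflexive (ring y (x ∸ y))))
  where
  ring : ∀ y d → 4 * ((y + d) * y) + d * d ≡ (y + d + y) * (y + d + y)
  ring = solve-∀

-- The number of terms is a power of two, so Cauchy's halving suffices: the bounds for the two
-- halves are combined by `4xy≤[x+y]²`.
am-gm : ∀ L (r : ℕ → ℕ) → (2 ^ L) ^ pow2 L * prodN (pow2 L) r ≤ sumN (pow2 L) r ^ pow2 L
am-gm zero    r = ≤-reflexive (ring (r 0))
  where
  ring : ∀ a → 1 * (a * 1) ≡ (a + 0) * 1
  ring = solve-∀
am-gm (suc L) r = begin
  (2 * 2 ^ L) ^ (h + h) * prodN (h + h) r
    ≡⟨ cong₂ _*_ (trans (^-distribˡ-+-* (2 * 2 ^ L) h h) (cong₂ _*_ (*-^ 2 (2 ^ L) h) (*-^ 2 (2 ^ L) h)))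
                 (prodN-split h h r) ⟩
  2 ^ h * (2 ^ L) ^ h * (2 ^ h * (2 ^ L) ^ h) * (p₁ * p₂)
    ≡⟨ ring (2 ^ h) ((2 ^ L) ^ h) p₁ p₂ ⟩
  2 ^ h * 2 ^ h * (((2 ^ L) ^ h * p₁) * ((2 ^ L) ^ h * p₂))
    ≤⟨ *-mono-≤ (≤-reflexive (sym (*-^ 2 2 h)))
                (*-mono-≤ (am-gm L r) (am-gm L (λ i → r (h + i)))) ⟩
  4 ^ h * (s₁ ^ h * s₂ ^ h)    ≡⟨ sym (trans (*-^ 4 (s₁ * s₂) h) (cong (4 ^ h *_) (*-^ s₁ s₂ h))) ⟩
  (4 * (s₁ * s₂)) ^ h          ≤⟨ ^-monoˡ-≤ h (4xy≤[x+y]² s₁ s₂) ⟩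
  ((s₁ + s₂) * (s₁ + s₂)) ^ h  ≡⟨ trans (*-^ (s₁ + s₂) (s₁ + s₂) h) (sym (^-distribˡ-+-* (s₁ + s₂) h h)) ⟩
  (s₁ + s₂) ^ (h + h)          ≡⟨ cong (_^ (h + h)) (sym (sumN-split h h r)) ⟩
  sumN (h + h) r ^ (h + h)     ∎
  where
  open ≤-Reasoning
  h = pow2 L
  p₁ = prodN h r
  p₂ = prodN h (λ i → r (h + i))
  s₁ = sumN h r
  s₂ = sumN h (λ i → r (h + i))
  ring : ∀ a b c d → a * b * (a * b) * (c * d) ≡ a * a * ((b * c) * (b * d))
  ring = solve-∀

-- The quotients (F_{i+1} B_i) / (F_i B_{i+1}) multiply to (F_t B_0) / (F_0 B_t). Without division,
-- the induction multiplies the inequalities and cancels the positive factor `F 1 * B 1`.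
telescope : ∀ t c W (F B r β : ℕ → ℕ) →
  (∀ i → i ≤ t → 0 < F i × 0 < B i) →
  (∀ i → i < t → c * (F (suc i) * B i) ≤ W ^ β i * (2 * r i * (F i * B (suc i)))) →
  c ^ t * (F t * B 0) ≤ W ^ sumN t β * (2 ^ t * prodN t r * (F 0 * B t))
telescope zero    c W F B r β pos h = ≤-reflexive (ring (F 0 * B 0))
  where
  ring : ∀ a → 1 * a ≡ 1 * (1 * 1 * a)
  ring = solve-∀
telescope (suc t) c W F B r β pos h = cancelʳ (F 1 * B 1) (*-pos (proj₁ (pos 1 (s≤s z≤n))) (proj₂ (pos 1 (s≤s z≤n)))) (begin
  c * c ^ t * (F (suc t) * B 0) * (F 1 * B 1)
    ≡⟨ ring₁ c (c ^ t) (F (suc t)) (B 0) (F 1) (B 1) ⟩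
  c * (F 1 * B 0) * (c ^ t * (F (suc t) * B 1))
    ≤⟨ *-mono-≤ (h 0 (s≤s z≤n))
         (telescope t c W (λ i → F (suc i)) (λ i → B (suc i)) (λ i → r (suc i)) (λ i → β (suc i))
           (λ i i≤ → pos (suc i) (s≤s i≤)) (λ i i< → h (suc i) (s≤s i<))) ⟩
  W ^ β 0 * (2 * r 0 * (F 0 * B 1)) * (W ^ b * (2 ^ t * p * (F 1 * B (suc t))))
    ≡⟨ ring₂ (W ^ β 0) (W ^ b) (2 ^ t) (r 0) p (F 0) (B 1) (F 1) (B (suc t)) ⟩
  W ^ β 0 * W ^ b * (2 * 2 ^ t * (r 0 * p) * (F 0 * B (suc t))) * (F 1 * B 1)
    ≡⟨ cong (λ m → m * (2 * 2 ^ t * (r 0 * p) * (F 0 * B (suc t))) * (F 1 * B 1)) (sym (^-distribˡ-+-* W (β 0) b)) ⟩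
  W ^ (β 0 + b) * (2 * 2 ^ t * (r 0 * p) * (F 0 * B (suc t))) * (F 1 * B 1) ∎)
  where
  open ≤-Reasoning
  b = sumN t (λ i → β (suc i))
  p = prodN t (λ i → r (suc i))
  ring₁ : ∀ c d a b x y → c * d * (a * b) * (x * y) ≡ c * (x * b) * (d * (a * y))
  ring₁ = solve-∀
  ring₂ : ∀ w v q r p a y x z → w * (2 * r * (a * y)) * (v * (q * p * (x * z))) ≡
                               w * v * (2 * q * (r * p) * (a * z)) * (x * y)
  ring₂ = solve-∀

-- ratio a 0 = a.
ratio : ℕ → ℕ → ℕ
ratio a d = a / suc (pred d)

ratio-upper : ∀ a d → ratio a d * d ≤ a
ratio-upper a zero    = ≤-trans (≤-reflexive (*-zeroʳ (ratio a 0))) z≤n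
ratio-upper a (suc d) = m/n*n≤m a (suc d)

-- As d ≤ a, the rounded quotient is at least 1, and then rounding down loses less than a factor 2.
ratio-lower : ∀ a d → 0 < d → d ≤ a → a ≤ 2 * ratio a d * d
ratio-lower a (suc d) _ d≤a = begin
  a                                    ≡⟨ m≡m%n+[m/n]*n a (suc d) ⟩
  a % suc d + q * suc d                ≤⟨ +-monoˡ-≤ (q * suc d) (<⇒≤ (m%n<n a (suc d))) ⟩
  suc d + q * suc d                    ≤⟨ +-monoˡ-≤ (q * suc d) (m≤n*m (suc d) q {{>-nonZero 0<q}}) ⟩
  q * suc d + q * suc d                ≡⟨ ring q (suc d) ⟩
  2 * q * suc d                        ∎
  where
  open ≤-Reasoning
  q = a / suc d
  0<q : 0 < q
  0<q = m≥n⇒m/n>0 d≤a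
  ring : ∀ a b → a * b + a * b ≡ 2 * a * b
  ring = solve-∀

-- Choosing one cheap walk by averaging.

module _ {n} (Y e : Cube n → ℕ) where

  -- The cost totalled over all t-walks from z into `Y`; `pow t Y w` counts the ways to complete a
  -- walk after the edge being charged.
  pathCost : ℕ → (ℕ → Cube n → Cube n → ℕ) → Cube n → ℕ
  pathCost zero    h z = e z * Y z
  pathCost (suc t) h z = adj (λ w → h 0 z w * pow t Y w + pathCost t (λ i → h (suc i)) w) z

  edgeCost : (Cube n → ℕ) → (Cube n → ℕ) → (Cube n → Cube n → ℕ) → ℕ
  edgeCost u v h = ⟨ u , (λ z → adj (λ w → h z w * v w) z) ⟩

  -- Linearity of expectation: self-adjointness of `adj` moves the first steps of the walks onto
  -- `F`, so that edge i is charged once for each way to arrive and to finish.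
  pathCost-total : ∀ t (F : ℕ → Cube n → ℕ) → (∀ i z → F (suc i) z ≡ adj (F i) z) → ∀ h →
    ⟨ F 0 , pathCost t h ⟩ ≡
    sumN t (λ i → edgeCost (F i) (pow (t ∸ suc i) Y) (h i)) + ⟨ F t , (λ z → e z * Y z) ⟩
  pathCost-total zero    F Fs h = refl
  pathCost-total (suc t) F Fs h = begin
    ⟨ F 0 , pathCost (suc t) h ⟩
      ≡⟨ ⟨⟩-congʳ (F 0) (λ z → adj-+ (λ w → h 0 z w * pow t Y w) rest z) ⟩
    ⟨ F 0 , (λ z → first z + adj rest z) ⟩     ≡⟨ ⟨⟩-+ʳ (F 0) first (adj rest) ⟩
    ⟨ F 0 , first ⟩ + ⟨ F 0 , adj rest ⟩       ≡⟨ cong (⟨ F 0 , first ⟩ +_) (sym (adj-self (F 0) rest)) ⟩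
    ⟨ F 0 , first ⟩ + ⟨ adj (F 0) , rest ⟩
      ≡⟨ cong (⟨ F 0 , first ⟩ +_) (trans (⟨⟩-congˡ rest (λ z → sym (Fs 0 z)))
           (pathCost-total t (λ i → F (suc i)) (λ i → Fs (suc i)) (λ i → h (suc i)))) ⟩
    _ ≡⟨ sym (+-assoc ⟨ F 0 , first ⟩ _ _) ⟩
    _ ∎
    where
    open ≡-Reasoning
    first = λ z → adj (λ w → h 0 z w * pow t Y w) z
    rest = pathCost t (λ i → h (suc i))

  infixr 5 _◂_
  _◂_ : Cube n → (ℕ → Cube n) → ℕ → Cube n
  (z ◂ x) zero    = z
  (z ◂ x) (suc i) = x i

  -- Method of conditional expectations. With `p` the cost already paid, the invariant says that the
  -- average cost over all completions is at most `M`, and some neighbour preserves it.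
  cheapPath : ∀ t (F : ℕ → Cube n → ℕ) → (∀ i z → F (suc i) z ≡ adj (F i) z) → ∀ h M p z →
    0 < M → 0 < F 0 z → 0 < pow t Y z → p * pow t Y z + pathCost t h z ≤ M * pow t Y z →
    Σ (ℕ → Cube n) λ x → x 0 ≡ z × (∀ i → i ≤ t → 0 < F i (x i) × 0 < pow (t ∸ i) Y (x i)) ×
      p + sumN t (λ i → h i (x i) (x (suc i))) + e (x t) ≤ M
  cheapPath zero F Fs h M p z M>0 F>0 Y>0 le = (λ _ → z) , refl , (λ { zero z≤n → F>0 , Y>0 }) ,
    cancelʳ (Y z) Y>0 (≤-trans (≤-reflexive (ring p (e z) (Y z))) le)
    where
    ring : ∀ p e y → (p + 0 + e) * y ≡ p * y + e * y
    ring = solve-∀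
  cheapPath (suc t) F Fs h M p z M>0 F>0 Y>0 le
    with adj-average (λ w → p * pow t Y w + (h 0 z w * pow t Y w + pathCost t (λ i → h (suc i)) w))
           (λ w → M * pow t Y w) z
           (subst (0 <_) (sym (adj-* M (pow t Y) z)) (*-pos M>0 Y>0))
           (subst₂ _≤_ (sym (trans (adj-+ (λ w → p * pow t Y w) _ z) (cong (_+ pathCost (suc t) h z) (adj-* p (pow t Y) z))))
                       (sym (adj-* M (pow t Y) z)) le)
  ... | w , MY>0 , le′ , nb
    with cheapPath t (λ i → F (suc i)) (λ i → Fs (suc i)) (λ i → h (suc i)) M (p + h 0 z w) w M>0
           (subst (0 <_) (sym (Fs 0 w)) (≤-trans F>0 (nb (F 0)))) (*-pos⁻¹ʳ M MY>0)
           (≤-trans (≤-reflexive (ring p (h 0 z w) (pow t Y w) _)) le′)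
    where
    ring : ∀ p h y c → (p + h) * y + c ≡ p * y + (h * y + c)
    ring = solve-∀
  ... | x , refl , pos , cost = z ◂ x , refl
    , (λ { zero _ → F>0 , Y>0 ; (suc i) (s≤s i≤) → pos i i≤ })
    , ≤-trans (≤-reflexive (cong (_+ e (x t)) (sym (+-assoc p (h 0 z w) _)))) cost

summand₁ : ∀ {m} a b c d → a + (b + c) + d ≤ m → a ≤ m
summand₁ a b c d = ≤-trans (≤-trans (m≤m+n a (b + c)) (m≤m+n (a + (b + c)) d))

summand₂ : ∀ {m} a b c d → a + (b + c) + d ≤ m → b ≤ m
summand₂ a b c d = ≤-trans (≤-trans (m≤m+n b c) (≤-trans (m≤n+m (b + c) a) (m≤m+n (a + (b + c)) d)))

summand₃ : ∀ {m} a b c d → a + (b + c) + d ≤ m → c ≤ m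
summand₃ a b c d = ≤-trans (≤-trans (m≤n+m c b) (≤-trans (m≤n+m (b + c) a) (m≤m+n (a + (b + c)) d)))

summand₄ : ∀ {m} a b c d → a + (b + c) + d ≤ m → d ≤ m
summand₄ a b c d = ≤-trans (m≤n+m d (a + (b + c)))

-- Markov bounds for bad and for low vertices.

pow-bound : ∀ {n} t (f : Cube n → ℕ) → (∀ z → f z ≤ 1) → ∀ z → pow t f z ≤ n ^ t
pow-bound {n} t f f≤1 z = ≤-trans (pow-mono t f≤1 z) (≤-reflexive (trans (pow-const t 1 z) (*-identityʳ (n ^ t))))

-- A vertex is bad when the walks to it fail more than θ tests on average. For θ = 0 the search tree
-- is a single leaf without tests, whence the constant `false`.
bad : ∀ {n} → ℕ → (u T : Cube n → ℕ) → Cube n → Bool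
bad zero    u T z = false
bad (suc θ) u T z = not (T z ≤ᵇ suc θ * u z)

-- Insert T ≤ θ u into the tangent line at θ: of the θ + 1 copies of u one survives.
side-good : ∀ {n} θ {u w : Cube n → ℕ} {κ E f T R} → Side u w κ E f T R → R ≤ 16 * θ →
            ∀ z → bad θ u T z ≡ false → 3 ^ R * u z ≤ 3 ^ θ * f z
side-good zero    S z≤n z _ = *-monoʳ-≤ 1 (Side.above S z)
side-good (suc θ) {u} {f = f} {T} {R} S R≤ z good with T z ≤ᵇ suc θ * u z | ≤ᵇ⇒≤ (T z) (suc θ * u z)
... | true | le = +-cancelʳ-≤ (3 ^ R * (suc θ * u z)) _ _ (begin
  3 ^ R * u z + 3 ^ R * (suc θ * u z)    ≡⟨ sym (*-distribˡ-+ (3 ^ R) (u z) _) ⟩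
  3 ^ R * (suc (suc θ) * u z)            ≤⟨ Side.tangent S (suc θ) z ⟩
  3 ^ suc θ * f z + 3 ^ R * T z          ≤⟨ +-monoʳ-≤ (3 ^ suc θ * f z) (*-monoʳ-≤ (3 ^ R) (le tt)) ⟩
  3 ^ suc θ * f z + 3 ^ R * (suc θ * u z) ∎)
  where open ≤-Reasoning

bad-pointwise : ∀ {n} θ (u T : Cube n → ℕ) z → θ * (⟦ bad θ u T z ⟧ * u z) ≤ T z
bad-pointwise zero    u T z = z≤n
bad-pointwise (suc θ) u T z = ≤-trans (≤-reflexive (swap (suc θ) ⟦ bad (suc θ) u T z ⟧ (u z)))
                                      (≰ᵇ-cases (T z) (suc θ * u z))
  where
  swap : ∀ a b c → a * (b * c) ≡ b * (a * c)
  swap = solve-∀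

-- Markov's inequality for the number of failures, whose total is bounded by `charge`. Since θ is at
-- least R/16, the resulting fraction of bad walks does not depend on the depth of the tree.
bad-mass : ∀ {n} θ c {u w : Cube n → ℕ} {κ E f T R} G → Side u w κ E f T R → R ≤ 16 * θ → 0 < κ →
           (0 < θ → c * (16 * E) ≤ κ * G) → c * ⟨ (λ z → ⟦ bad θ u T z ⟧ * u z) , w ⟩ ≤ G
bad-mass {n} zero c G S R≤ κ>0 E≤ =
  ≤-trans (≤-reflexive (trans (cong (c *_) (trans (sumV-const n 0) (*-zeroʳ (2 ^ n)))) (*-zeroʳ c))) z≤n
bad-mass {n} (suc θ′) c {u} {w} {κ} {E} {f} {T} {R} G S R≤ κ>0 E≤ = go (suc θ′) (s≤s z≤n) R≤ (E≤ (s≤s z≤n)) θm≤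
  where
  open ≤-Reasoning
  φu : Cube n → ℕ
  φu z = ⟦ bad (suc θ′) u T z ⟧ * u z
  m = ⟨ φu , w ⟩
  θm≤ : suc θ′ * m ≤ ⟨ T , w ⟩
  θm≤ = ≤-trans (≤-reflexive (sym (⟨⟩-*ˡ (suc θ′) φu w))) (⟨⟩-monoˡ w (bad-pointwise (suc θ′) u T))
  go : ∀ θ → 0 < θ → R ≤ 16 * θ → c * (16 * E) ≤ κ * G → θ * m ≤ ⟨ T , w ⟩ → c * m ≤ G
  go θ θ>0 R≤ E≤ θm≤ = cancelˡ (κ * θ) (*-pos κ>0 θ>0) (begin
    κ * θ * (c * m)              ≡⟨ ring₁ κ θ c m ⟩
    c * (κ * (θ * m))            ≤⟨ *-monoʳ-≤ c (*-monoʳ-≤ κ θm≤) ⟩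
    c * (κ * ⟨ T , w ⟩)          ≤⟨ *-monoʳ-≤ c (Side.charge S) ⟩
    c * (R * E)                  ≤⟨ *-monoʳ-≤ c (*-monoˡ-≤ E R≤) ⟩
    c * (16 * θ * E)             ≡⟨ ring₂ c 16 θ E ⟩
    θ * (c * (16 * E))           ≤⟨ *-monoʳ-≤ θ E≤ ⟩
    θ * (κ * G)                  ≡⟨ ring₃ θ κ G ⟩
    κ * θ * G                    ∎)
    where
    ring₁ : ∀ a b d c → a * b * (d * c) ≡ d * (a * (b * c))
    ring₁ = solve-∀
    ring₂ : ∀ a b c d → a * (b * c * d) ≡ c * (a * (b * d))
    ring₂ = solve-∀
    ring₃ : ∀ a b c → a * (b * c) ≡ b * a * c
    ring₃ = solve-∀

low : ∀ {n} → ℕ → (Cube n → ℕ) → Cube n → Bool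
low {n} G u z = not (G ≤ᵇ 16 * 2 ^ n * u z)

-- There are only 2^n vertices, and each low one contributes at most G / (16 * 2^n).
low-mass : ∀ {n} G (u v : Cube n → ℕ) → (∀ z → v z ≤ 1) → 16 * ⟨ (λ z → ⟦ low G u z ⟧ * u z) , v ⟩ ≤ G
low-mass {n} G u v v≤1 = cancelˡ (2 ^ n) (m^n>0 2 n) (begin
  2 ^ n * (16 * m)              ≡⟨ ring (2 ^ n) 16 m ⟩
  16 * 2 ^ n * m                ≡⟨ sym (⟨⟩-*ˡ (16 * 2 ^ n) (λ z → ⟦ low G u z ⟧ * u z) v) ⟩
  ⟨ (λ z → 16 * 2 ^ n * (⟦ low G u z ⟧ * u z)) , v ⟩
    ≤⟨ sumV-mono (λ z → *-mono-≤ (≤-trans (≤-reflexive (swap (16 * 2 ^ n) ⟦ low G u z ⟧ (u z)))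
                                          (≰ᵇ-cases G (16 * 2 ^ n * u z))) (v≤1 z)) ⟩
  sumV {n} (λ _ → G * 1)        ≡⟨ trans (sumV-const n (G * 1)) (cong (2 ^ n *_) (*-identityʳ G)) ⟩
  2 ^ n * G                     ∎)
  where
  open ≤-Reasoning
  m = ⟨ (λ z → ⟦ low G u z ⟧ * u z) , v ⟩
  ring : ∀ a b c → a * (b * c) ≡ b * a * c
  ring = solve-∀
  swap : ∀ a b c → a * (b * c) ≡ b * (a * c)
  swap = solve-∀

low-false : ∀ {n} G (u : Cube n → ℕ) z → ⟦ low G u z ⟧ ≡ 0 → G ≤ 16 * 2 ^ n * u z
low-false {n} G u z eq with G ≤ᵇ 16 * 2 ^ n * u z | ≤ᵇ⇒≤ G (16 * 2 ^ n * u z)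
... | true  | le = le tt

-- `p` depends on the far end of an edge and `q` on the near end, so summing over the other end
-- turns `u`, respectively `v`, into its `adj`.
edge-bound : ∀ {n} (u v f g p q : Cube n → ℕ) (h : Cube n → Cube n → ℕ) c C →
  (∀ z w → u z * (h z w * v w) ≤ c * (f w * g z) + C * (u z * (p w * v w)) + C * (q z * u z * v w)) →
  ⟨ u , (λ z → adj (λ w → h z w * v w) z) ⟩ ≤
  c * ⟨ f , adj g ⟩ + C * ⟨ (λ z → p z * adj u z) , v ⟩ + C * ⟨ (λ z → q z * adj v z) , u ⟩
edge-bound {n} u v f g p q h c C le = begin
  ⟨ u , (λ z → adj (λ w → h z w * v w) z) ⟩     ≤⟨ sumV-mono pointwise ⟩
  sumV (λ z → c * (adj f z * g z) + C * (u z * adj pv z) + C * (q z * adj v z * u z))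
    ≡⟨ trans (sumV-+ (λ z → c * (adj f z * g z) + C * (u z * adj pv z)) (λ z → C * (q z * adj v z * u z)))
             (cong₂ _+_ (sumV-+ (λ z → c * (adj f z * g z)) (λ z → C * (u z * adj pv z))) refl) ⟩
  sumV (λ z → c * (adj f z * g z)) + sumV (λ z → C * (u z * adj pv z)) + sumV (λ z → C * (q z * adj v z * u z))
    ≡⟨ cong₂ _+_ (cong₂ _+_ (sumV-* c (λ z → adj f z * g z)) (sumV-* C (λ z → u z * adj pv z)))
                 (sumV-* C (λ z → q z * adj v z * u z)) ⟩
  c * ⟨ adj f , g ⟩ + C * ⟨ u , adj pv ⟩ + C * ⟨ (λ z → q z * adj v z) , u ⟩
    ≡⟨ cong₂ (λ a b → c * a + C * b + C * ⟨ (λ z → q z * adj v z) , u ⟩) (adj-self f g)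
        (trans (sym (adj-self u pv)) (sumV-cong (λ z → swap (adj u z) (p z) (v z)))) ⟩
  c * ⟨ f , adj g ⟩ + C * ⟨ (λ z → p z * adj u z) , v ⟩ + C * ⟨ (λ z → q z * adj v z) , u ⟩ ∎
  where
  open ≤-Reasoning
  pv = λ w → p w * v w
  swap : ∀ a b c → a * (b * c) ≡ b * a * c
  swap = solve-∀
  pointwise : ∀ z → u z * adj (λ w → h z w * v w) z ≤
                    c * (adj f z * g z) + C * (u z * adj pv z) + C * (q z * adj v z * u z)
  pointwise z = begin
    u z * adj (λ w → h z w * v w) z    ≡⟨ sym (adj-* (u z) (λ w → h z w * v w) z) ⟩
    adj (λ w → u z * (h z w * v w)) z  ≤⟨ adj-mono (λ w → ≤-trans (le z w) (≤-reflexive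
                                            (ring₁ c (f w) (g z) C (u z) (pv w) (q z) (v w)))) z ⟩
    adj (λ w → c * g z * f w + (C * u z * pv w + C * (q z * u z) * v w)) z
      ≡⟨ trans (adj-+ (λ w → c * g z * f w) (λ w → C * u z * pv w + C * (q z * u z) * v w) z)
               (cong₂ _+_ (adj-* (c * g z) f z)
                 (trans (adj-+ (λ w → C * u z * pv w) (λ w → C * (q z * u z) * v w) z)
                        (cong₂ _+_ (adj-* (C * u z) pv z) (adj-* (C * (q z * u z)) v z)))) ⟩
    c * g z * adj f z + (C * u z * adj pv z + C * (q z * u z) * adj v z)
      ≡⟨ ring₂ c (g z) (adj f z) C (u z) (adj pv z) (q z) (adj v z) ⟩
    c * (adj f z * g z) + C * (u z * adj pv z) + C * (q z * adj v z * u z) ∎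
    where
    ring₁ : ∀ c f g C u p q v → c * (f * g) + C * (u * p) + C * (q * u * v) ≡ c * g * f + (C * u * p + C * (q * u) * v)
    ring₁ = solve-∀
    ring₂ : ∀ c g f C u p q v → c * g * f + (C * u * p + C * (q * u) * v) ≡ c * (f * g) + C * (u * p) + C * (q * v * u)
    ring₂ = solve-∀

-- The improved bound for a single rectangle.

module Rectangle {n} (X Y : Cube n → ℕ) (X≤1 : ∀ z → X z ≤ 1) (Y≤1 : ∀ z → Y z ≤ 1)
  (θ e Λ c : ℕ) (n>0 : 0 < n) where

  L = 16 * θ
  k = pow2 L
  ν = n * n
  K = n ^ k
  V = K * 4 ^ L * ν
  -- Of the L = 16θ powers of 3, prefix and suffix give up θ each in `side-good`.
  W = 3 ^ (14 * θ)

  G : ℕ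
  G = ⟨ X , pow k Y ⟩

  open Tree X Y Λ ν k

  k>0 : 0 < k
  k>0 = pow2>0 L

  V>0 : 0 < V
  V>0 = *-pos (*-pos (m^n>0 n {{>-nonZero n>0}} k) (m^n>0 4 L)) (*-pos n>0 n>0)

  -- If both ends are good, the two `side-good` bounds multiply to 3^(R+S) = 3^L against 3^(2θ). A
  -- bad end gives up the whole of `W`, and then the trivial bounds `above` suffice.
  leaf-bound : ∀ i lf → LeafOK L i lf → ∀ b → suc (i + b) ≡ k → ∀ z w → let open Leaf lf in
    W * (pow (suc i) X w * pow (suc b) Y z) ≤
    W ^ (⟦ bad θ (pow (suc i) X) T w ⟧ + ⟦ bad θ (pow (suc b) Y) U z ⟧) * (f w * g z)
  leaf-bound i lf ok b eq z w with ok b eq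
  ... | pre , suf , R+S = go (bad θ u T w) (bad θ v U z) refl refl
    where
    open Leaf lf
    open ≤-Reasoning
    u = pow (suc i) X
    v = pow (suc b) Y
    crude : ∀ m → 0 < m → W * (u w * v z) ≤ W ^ m * (f w * g z)
    crude (suc m) _ = *-mono-≤ (m≤m*n W (W ^ m) {{m^n≢0 W m {{m^n≢0 3 (14 * θ)}}}})
                              (*-mono-≤ (Side.above pre w) (Side.above suf z))
    go : ∀ p q → bad θ u T w ≡ p → bad θ v U z ≡ q → W * (u w * v z) ≤ W ^ (⟦ p ⟧ + ⟦ q ⟧) * (f w * g z)
    go true  q     _ _ = crude (1 + ⟦ q ⟧) (s≤s z≤n)
    go false true  _ _ = crude 1 (s≤s z≤n)
    go false false p≡ q≡ = cancelˡ (3 ^ θ * 3 ^ θ) (*-pos (m^n>0 3 θ) (m^n>0 3 θ)) (begin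
      3 ^ θ * 3 ^ θ * (W * (u w * v z))      ≡⟨ sym (*-assoc (3 ^ θ * 3 ^ θ) W (u w * v z)) ⟩
      3 ^ θ * 3 ^ θ * W * (u w * v z)        ≡⟨ cong (_* (u w * v z)) powers ⟩
      3 ^ R * 3 ^ S * (u w * v z)            ≡⟨ ring (3 ^ R) (3 ^ S) (u w) (v z) ⟩
      (3 ^ R * u w) * (3 ^ S * v z)
        ≤⟨ *-mono-≤ (side-good θ pre (≤-trans (m≤m+n R S) (≤-reflexive R+S)) w p≡)
                    (side-good θ suf (≤-trans (m≤n+m S R) (≤-reflexive R+S)) z q≡) ⟩
      (3 ^ θ * f w) * (3 ^ θ * g z)          ≡⟨ sym (ring (3 ^ θ) (3 ^ θ) (f w) (g z)) ⟩
      3 ^ θ * 3 ^ θ * (f w * g z)            ≡⟨ cong (3 ^ θ * 3 ^ θ *_) (sym (*-identityˡ (f w * g z))) ⟩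
      3 ^ θ * 3 ^ θ * (1 * (f w * g z))      ∎)
      where
      ring : ∀ a b c d → a * b * (c * d) ≡ (a * c) * (b * d)
      ring = solve-∀
      powers : 3 ^ θ * 3 ^ θ * W ≡ 3 ^ R * 3 ^ S
      powers = begin-equality
        3 ^ θ * 3 ^ θ * W          ≡⟨ cong (_* W) (sym (^-distribˡ-+-* 3 θ θ)) ⟩
        3 ^ (θ + θ) * W            ≡⟨ sym (^-distribˡ-+-* 3 (θ + θ) (14 * θ)) ⟩
        3 ^ (θ + θ + 14 * θ)       ≡⟨ cong (3 ^_) (trans (sixteen θ) (sym R+S)) ⟩
        3 ^ (R + S)                ≡⟨ ^-distribˡ-+-* 3 R S ⟩
        3 ^ R * 3 ^ S              ∎
        where
        sixteen : ∀ θ → θ + θ + 14 * θ ≡ 16 * θ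
        sixteen = solve-∀

  -- With c = 8 * 16 a bad end costs c V, so a budget of 8 k V allows only k/16 of them. The 64
  -- joins the 16 of `bad-mass` to the 4 of the sparsity bounds; `Λ` makes the right tests reliable,
  -- and `e` then has to beat `Λ` for the left ones.
  module _ (G>0 : 0 < G) (sparse₊ : e * G₊ ≤ 4 * (ν * G)) (sparse₋ : 0 < θ → ν * G₋ ≤ 4 * G)
           (c-def : c ≡ 8 * 16) (Λ-large : c * 64 ≤ Λ) (e-large : c * 64 * Λ ≤ e) where

    Λ>0 : 0 < Λ
    Λ>0 = ≤-trans (subst (λ c → 0 < c * 64) (sym c-def) (s≤s z≤n)) Λ-large

    leaves : Σ (ℕ → Leaf n) λ lf → (∀ i → i < k → LeafOK L i (lf i)) ×
             sumN k (λ i → leafMass (lf i)) ≡ 4 ^ L * ⟨ adj X , pow k (adj Y) ⟩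
    leaves = tree L 0 0 (+-identityʳ k) (adj X) _ 0 (adj Y) _ 0
               (side-init (adj X) _ Λ (ν * G₋)) (side-init (adj Y) _ ν (Λ * G₊))

    leafAt : ℕ → Leaf n
    leafAt = proj₁ leaves

    leaf-ok : ∀ i → i < k → LeafOK L i (leafAt i)
    leaf-ok = proj₁ (proj₂ leaves)

    total-mass : sumN k (λ i → leafMass (leafAt i)) ≡ 4 ^ L * G₊
    total-mass = trans (proj₂ (proj₂ leaves)) (cong (4 ^ L *_) (trans (adj-self X _)
      (⟨⟩-congʳ X (λ z → adj-cong (pow-comm k Y) z))))

    r : ℕ → Cube n → Cube n → ℕ
    r i z w = ratio (K * (Leaf.f (leafAt i) w * Leaf.g (leafAt i) z)) (pow i X z * pow (k ∸ suc i) Y w)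

    preBad sufBad : ℕ → Cube n → ℕ
    preBad i w = ⟦ bad θ (pow (suc i) X) (Leaf.T (leafAt i)) w ⟧
    sufBad i z = ⟦ bad θ (pow (suc (k ∸ suc i)) Y) (Leaf.U (leafAt i)) z ⟧

    -- The coefficients here and in lowCost give each contribution a total of O(k V G) over all walks,
    -- so that some walk has small ratios, few bad steps and heavy end points at the same time.
    stepCost : ℕ → Cube n → Cube n → ℕ
    stepCost i z w = k * e * r i z w + c * V * (preBad i w + sufBad i z)

    lowCost : (Cube n → ℕ) → Cube n → ℕ
    lowCost u z = 16 * (k * V) * ⟦ low G u z ⟧

    endCost = lowCost (pow k X)

    split : ∀ i → i < k → suc (i + (k ∸ suc i)) ≡ k
    split i i<k = m+[n∸m]≡n i<k

    step-total : ∀ i → i < k → edgeCost Y endCost (pow i X) (pow (k ∸ suc i) Y) (stepCost i) ≤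
                 k * e * K * leafMass (leafAt i) + V * (2 * G)
    step-total i i<k with leaf-ok i i<k (k ∸ suc i) (split i i<k)
    ... | pre , suf , R+S = begin
      ⟨ u , (λ z → adj (λ w → stepCost i z w * v w) z) ⟩
        ≤⟨ edge-bound u v f g (preBad i) (sufBad i) (stepCost i) (k * e * K) (c * V) pointwise ⟩
      k * e * K * ⟨ f , adj g ⟩ + c * V * m₁ + c * V * m₂
        ≡⟨ ring₁ (k * e * K * ⟨ f , adj g ⟩) c V m₁ m₂ ⟩
      k * e * K * ⟨ f , adj g ⟩ + V * (c * m₁ + c * m₂)
        ≤⟨ +-monoʳ-≤ (k * e * K * ⟨ f , adj g ⟩) (*-monoʳ-≤ V (+-mono-≤
             (bad-mass θ c G pre (≤-trans (m≤m+n R S) (≤-reflexive R+S)) Λ>0 preErr)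
             (≤-trans (bad-mass θ c G suf (≤-trans (m≤n+m S R) (≤-reflexive R+S)) (*-pos n>0 n>0) sufErr)
                      (m≤m+n G 0)))) ⟩
      k * e * K * leafMass (leafAt i) + V * (2 * G) ∎
      where
      open ≤-Reasoning
      open Leaf (leafAt i)
      u = pow i X
      v = pow (k ∸ suc i) Y
      m₁ = ⟨ (λ z → preBad i z * adj u z) , v ⟩
      m₂ = ⟨ (λ z → sufBad i z * adj v z) , u ⟩
      ring₁ : ∀ a c V x y → a + c * V * x + c * V * y ≡ a + V * (c * x + c * y)
      ring₁ = solve-∀
      preErr : 0 < θ → c * (16 * (ν * G₋)) ≤ Λ * G
      preErr θ>0 = begin
        c * (16 * (ν * G₋))   ≤⟨ *-monoʳ-≤ c (*-monoʳ-≤ 16 (sparse₋ θ>0)) ⟩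
        c * (16 * (4 * G))    ≡⟨ ring c G ⟩
        c * 64 * G            ≤⟨ *-monoˡ-≤ G Λ-large ⟩
        Λ * G                 ∎
        where
        ring : ∀ c G → c * (16 * (4 * G)) ≡ c * 64 * G
        ring = solve-∀
      sufErr : 0 < θ → c * (16 * (Λ * G₊)) ≤ ν * G
      sufErr _ = cancelˡ 4 (s≤s z≤n) (begin
        4 * (c * (16 * (Λ * G₊)))   ≡⟨ ring c Λ G₊ ⟩
        c * 64 * Λ * G₊             ≤⟨ *-monoˡ-≤ G₊ e-large ⟩
        e * G₊                      ≤⟨ sparse₊ ⟩
        4 * (ν * G)                 ∎)
        where
        ring : ∀ c Λ g → 4 * (c * (16 * (Λ * g))) ≡ c * 64 * Λ * g
        ring = solve-∀
      pointwise : ∀ z w → u z * (stepCost i z w * v w) ≤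
        k * e * K * (f w * g z) + c * V * (u z * (preBad i w * v w)) + c * V * (sufBad i z * u z * v w)
      pointwise z w = begin
        u z * (stepCost i z w * v w)
          ≡⟨ ring (u z) (v w) (k * e) (r i z w) (c * V) (preBad i w) (sufBad i z) ⟩
        k * e * (r i z w * (u z * v w)) + c * V * (u z * (preBad i w * v w)) + c * V * (sufBad i z * u z * v w)
          ≤⟨ +-monoˡ-≤ _ (+-monoˡ-≤ _ (≤-trans (*-monoʳ-≤ (k * e) (ratio-upper (K * (f w * g z)) (u z * v w)))
                                               (≤-reflexive (sym (*-assoc (k * e) K (f w * g z)))))) ⟩
        k * e * K * (f w * g z) + c * V * (u z * (preBad i w * v w)) + c * V * (sufBad i z * u z * v w) ∎
        where
        ring : ∀ u v c r C p q → u * ((c * r + C * (p + q)) * v) ≡ c * (r * (u * v)) + C * (u * (p * v)) + C * (q * u * v)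
        ring = solve-∀

    -- In units of k V: 4 for the ratios, 2 for the bad ends of edges, 1 for each end point of the
    -- walk.
    M = 8 * (k * V)

    lowCost-total : ∀ u v → (∀ z → v z ≤ 1) → ⟨ (λ z → lowCost u z * u z) , v ⟩ ≤ k * V * G
    lowCost-total u v v≤1 = begin
      ⟨ (λ z → lowCost u z * u z) , v ⟩
        ≡⟨ ⟨⟩-congˡ v (λ z → ring (k * V) 16 ⟦ low G u z ⟧ (u z)) ⟩
      ⟨ (λ z → k * V * 16 * (⟦ low G u z ⟧ * u z)) , v ⟩       ≡⟨ ⟨⟩-*ˡ (k * V * 16) (λ z → ⟦ low G u z ⟧ * u z) v ⟩
      k * V * 16 * ⟨ (λ z → ⟦ low G u z ⟧ * u z) , v ⟩         ≡⟨ *-assoc (k * V) 16 _ ⟩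
      k * V * (16 * ⟨ (λ z → ⟦ low G u z ⟧ * u z) , v ⟩)       ≤⟨ *-monoʳ-≤ (k * V) (low-mass G u v v≤1) ⟩
      k * V * G                                                ∎
      where
      open ≤-Reasoning
      ring : ∀ c d a b → d * c * a * b ≡ c * d * (a * b)
      ring = solve-∀

    walkCost = pathCost Y endCost k stepCost

    walkCost-total : ⟨ X , walkCost ⟩ ≤ 7 * (k * V * G)
    walkCost-total = begin
      ⟨ X , walkCost ⟩
        ≡⟨ pathCost-total Y endCost k (λ i → pow i X) (λ _ _ → refl) stepCost ⟩
      sumN k (λ i → edgeCost Y endCost (pow i X) (pow (k ∸ suc i) Y) (stepCost i)) + ⟨ pow k X , (λ z → endCost z * Y z) ⟩
        ≤⟨ +-mono-≤ (sumN-mono k step-total) ends ⟩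
      sumN k (λ i → k * e * K * leafMass (leafAt i) + V * (2 * G)) + k * V * G
        ≡⟨ cong (_+ k * V * G) (trans (sumN-lin k (k * e * K) V (λ i → leafMass (leafAt i)) (λ _ → 2 * G))
                                      (cong₂ (λ a b → k * e * K * a + V * b) total-mass (sumN-const k (2 * G)))) ⟩
      k * e * K * (4 ^ L * G₊) + V * (k * (2 * G)) + k * V * G
        ≡⟨ cong (λ m → m + V * (k * (2 * G)) + k * V * G) (ring₁ k e K (4 ^ L) G₊) ⟩
      k * (K * 4 ^ L) * (e * G₊) + V * (k * (2 * G)) + k * V * G
        ≤⟨ +-monoˡ-≤ (k * V * G) (+-monoˡ-≤ (V * (k * (2 * G))) (*-monoʳ-≤ (k * (K * 4 ^ L)) sparse₊)) ⟩
      k * (K * 4 ^ L) * (4 * (ν * G)) + V * (k * (2 * G)) + k * V * G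
        ≡⟨ ring₂ k (K * 4 ^ L) ν G ⟩
      7 * (k * V * G) ∎
      where
      open ≤-Reasoning
      ring₁ : ∀ k e K q p → k * e * K * (q * p) ≡ k * (K * q) * (e * p)
      ring₁ = solve-∀
      ring₂ : ∀ k Q n G → k * Q * (4 * (n * G)) + Q * n * (k * (2 * G)) + k * (Q * n) * G ≡ 7 * (k * (Q * n) * G)
      ring₂ = solve-∀
      ends : ⟨ pow k X , (λ z → endCost z * Y z) ⟩ ≤ k * V * G
      ends = ≤-trans (≤-reflexive (sumV-cong (λ z → swap (pow k X z) (endCost z) (Y z)))) (lowCost-total (pow k X) Y Y≤1)
        where
        swap : ∀ a b c → a * (b * c) ≡ b * a * c
        swap = solve-∀

    GoodWalk : (ℕ → Cube n) → Set
    GoodWalk x = (∀ i → i ≤ k → 0 < pow i X (x i) × 0 < pow (k ∸ i) Y (x i)) ×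
      lowCost (pow k Y) (x 0) + sumN k (λ i → stepCost i (x i) (x (suc i))) + endCost (x k) ≤ M

    M>0 : 0 < M
    M>0 = *-pos {8} (s≤s z≤n) (*-pos k>0 V>0)

    startCost : Cube n → ℕ
    startCost z = X z * (lowCost (pow k Y) z * pow k Y z + walkCost z)

    budget : Cube n → ℕ
    budget z = M * (X z * pow k Y z)

    startCost-total : sumV startCost ≤ sumV budget
    startCost-total = begin
      sumV startCost
        ≡⟨ ⟨⟩-+ʳ X (λ z → lowCost (pow k Y) z * pow k Y z) walkCost ⟩
      ⟨ X , (λ z → lowCost (pow k Y) z * pow k Y z) ⟩ + ⟨ X , walkCost ⟩
        ≤⟨ +-mono-≤ (≤-trans (≤-reflexive (⟨⟩-comm X (λ z → lowCost (pow k Y) z * pow k Y z)))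
                             (lowCost-total (pow k Y) X X≤1)) walkCost-total ⟩
      8 * (k * V * G)       ≡⟨ sym (*-assoc 8 (k * V) G) ⟩
      8 * (k * V) * G       ≡⟨ sym (sumV-* M (λ z → X z * pow k Y z)) ⟩
      sumV budget           ∎
      where open ≤-Reasoning

    walkFrom : (Σ (Cube n) λ z → 0 < budget z × startCost z ≤ budget z) → Σ (ℕ → Cube n) GoodWalk
    walkFrom (z , pos , le) = rest (cheapPath Y endCost k (λ i → pow i X) (λ _ _ → refl) stepCost M (lowCost (pow k Y) z) z
      M>0 X>0 (*-pos⁻¹ʳ (X z) XY>0)
      (cancelˡ (X z) X>0 (≤-trans le (≤-reflexive (swap M (X z) (pow k Y z))))))
      where
      XY>0 : 0 < X z * pow k Y z
      XY>0 = *-pos⁻¹ʳ M pos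
      X>0 : 0 < X z
      X>0 = *-pos⁻¹ˡ (pow k Y z) XY>0
      swap : ∀ a b c → a * (b * c) ≡ b * (a * c)
      swap = solve-∀
      rest : (Σ (ℕ → Cube n) λ x → x 0 ≡ z × (∀ i → i ≤ k → 0 < pow i X (x i) × 0 < pow (k ∸ i) Y (x i)) ×
                lowCost (pow k Y) z + sumN k (λ i → stepCost i (x i) (x (suc i))) + endCost (x k) ≤ M) →
             Σ (ℕ → Cube n) GoodWalk
      rest (x , refl , posn , cost) = x , posn , cost

    goodWalk : Σ (ℕ → Cube n) GoodWalk
    goodWalk = walkFrom (sumV-average startCost budget
      (subst (0 <_) (sym (sumV-* M (λ z → X z * pow k Y z))) (*-pos M>0 G>0)) startCost-total)

    x : ℕ → Cube n
    x = proj₁ goodWalk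

    rs βs : ℕ → ℕ
    rs i = r i (x i) (x (suc i))
    βs i = preBad i (x (suc i)) + sufBad i (x i)

    cost-bound : lowCost (pow k Y) (x 0) + (k * e * sumN k rs + c * V * sumN k βs) + endCost (x k) ≤ 8 * (k * V)
    cost-bound = subst (λ m → lowCost (pow k Y) (x 0) + m + endCost (x k) ≤ M)
                       (sumN-lin k (k * e) (c * V) rs βs) (proj₂ (proj₂ goodWalk))

    c₁ = lowCost (pow k Y) (x 0)
    c₂ = k * e * sumN k rs
    c₃ = c * V * sumN k βs
    c₄ = endCost (x k)

    ratio-sum : e * sumN k rs ≤ 8 * V
    ratio-sum = cancelˡ k k>0 (begin
      k * (e * sumN k rs)     ≡⟨ sym (*-assoc k e _) ⟩
      k * e * sumN k rs       ≤⟨ summand₂ c₁ c₂ c₃ c₄ cost-bound ⟩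
      8 * (k * V)             ≡⟨ swap 8 k V ⟩
      k * (8 * V)             ∎)
      where
      open ≤-Reasoning
      swap : ∀ a b c → a * (b * c) ≡ b * (a * c)
      swap = solve-∀

    bad-sum : 16 * sumN k βs ≤ k
    bad-sum = cancelˡ (8 * V) (*-pos {8} (s≤s z≤n) V>0) (begin
      8 * V * (16 * sumN k βs)   ≡⟨ ring 8 V 16 (sumN k βs) ⟩
      8 * 16 * V * sumN k βs     ≡⟨ cong (λ c → c * V * sumN k βs) (sym c-def) ⟩
      c * V * sumN k βs          ≤⟨ summand₃ c₁ c₂ c₃ c₄ cost-bound ⟩
      8 * (k * V)                ≡⟨ swap 8 k V ⟩
      8 * V * k                  ∎)
      where
      open ≤-Reasoning
      ring : ∀ a V b s → a * V * (b * s) ≡ a * b * V * s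
      ring = solve-∀
      swap : ∀ a b c → a * (b * c) ≡ a * c * b
      swap = solve-∀

    -- One low end point would cost 16 k V, twice the whole budget.
    not-low : ∀ b → 16 * (k * V) * ⟦ b ⟧ ≤ 8 * (k * V) → ⟦ b ⟧ ≡ 0
    not-low false _  = refl
    not-low true  le with cancelʳ (k * V) {16} {8} (*-pos k>0 V>0) (≤-trans (≤-reflexive (sym (*-identityʳ (16 * (k * V))))) le)
    ... | s≤s (s≤s (s≤s (s≤s (s≤s (s≤s (s≤s (s≤s ())))))))

    start-heavy : G ≤ 16 * 2 ^ n * pow k Y (x 0)
    start-heavy = low-false G (pow k Y) (x 0) (not-low (low G (pow k Y) (x 0))
      (summand₁ c₁ c₂ c₃ c₄ cost-bound))

    end-heavy : G ≤ 16 * 2 ^ n * pow k X (x k)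
    end-heavy = low-false G (pow k X) (x k) (not-low (low G (pow k X) (x k)) (summand₄ c₁ c₂ c₃ c₄ cost-bound))

    walk-product : (K * W) ^ k * (pow k X (x k) * pow k Y (x 0)) ≤ W ^ sumN k βs * (2 ^ k * prodN k rs)
    walk-product = ≤-trans (telescope k (K * W) W (λ i → pow i X (x i)) (λ i → pow (k ∸ i) Y (x i)) rs βs
                             (proj₁ (proj₂ goodWalk)) step)
                   (*-monoʳ-≤ (W ^ sumN k βs) (≤-trans (*-monoʳ-≤ (2 ^ k * prodN k rs) (*-mono-≤ (X≤1 (x 0)) Y-end))
                                                       (≤-reflexive (*-identityʳ _))))
      where
      open ≤-Reasoning
      Y-end : pow (k ∸ k) Y (x k) ≤ 1
      Y-end = subst (λ m → pow m Y (x k) ≤ 1) (sym (n∸n≡0 k)) (Y≤1 (x k))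
      step : ∀ i → i < k → K * W * (pow (suc i) X (x (suc i)) * pow (k ∸ i) Y (x i)) ≤
                           W ^ βs i * (2 * rs i * (pow i X (x i) * pow (k ∸ suc i) Y (x (suc i))))
      step i i<k = begin
        K * W * (u * pow (k ∸ i) Y (x i))    ≡⟨ cong (λ m → K * W * (u * pow m Y (x i))) (∸-suc i<k) ⟩
        K * W * (u * v)                      ≡⟨ *-assoc K W (u * v) ⟩
        K * (W * (u * v))                    ≤⟨ *-monoʳ-≤ K (leaf-bound i (leafAt i) (leaf-ok i i<k) b (split i i<k) (x i) (x (suc i))) ⟩
        K * (W ^ βs i * fg)                  ≡⟨ swap K (W ^ βs i) fg ⟩
        W ^ βs i * (K * fg)                  ≤⟨ *-monoʳ-≤ (W ^ βs i) (ratio-lower (K * fg) d d>0 d≤) ⟩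
        W ^ βs i * (2 * rs i * d)            ∎
        where
        open Leaf (leafAt i)
        b = k ∸ suc i
        u = pow (suc i) X (x (suc i))
        v = pow (suc b) Y (x i)
        fg = f (x (suc i)) * g (x i)
        d = pow i X (x i) * pow b Y (x (suc i))
        posn = proj₁ (proj₂ goodWalk)
        ∸-suc : i < k → k ∸ i ≡ suc b
        ∸-suc i<k = trans (sym (cong (_∸ i) (trans (+-suc i b) (split i i<k)))) (m+n∸m≡n i (suc b))
        swap : ∀ a b c → a * (b * c) ≡ b * (a * c)
        swap = solve-∀
        d>0 : 0 < d
        d>0 = *-pos (proj₁ (posn i (<⇒≤ i<k))) (proj₂ (posn (suc i) i<k))
        sides = leaf-ok i i<k b (split i i<k)
        fg>0 : 0 < fg
        fg>0 = *-pos (≤-trans (proj₁ (posn (suc i) i<k)) (Side.above (proj₁ sides) (x (suc i))))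
                     (≤-trans (subst (λ m → 0 < pow m Y (x i)) (∸-suc i<k) (proj₂ (posn i (<⇒≤ i<k))))
                              (Side.above (proj₁ (proj₂ sides)) (x i)))
        -- The scale `K` was introduced for this: `d` counts at most n^i n^b pairs of walks, so the
        -- quotient is at least 1 and rounding it costs only a factor 2.
        d≤ : d ≤ K * fg
        d≤ = begin
          d                    ≤⟨ *-mono-≤ (pow-bound i X X≤1 (x i)) (pow-bound b Y Y≤1 (x (suc i))) ⟩
          n ^ i * n ^ b        ≡⟨ sym (^-distribˡ-+-* n i b) ⟩
          n ^ (i + b)          ≤⟨ ^-monoʳ-≤ n {{>-nonZero n>0}} (≤-trans (n≤1+n _) (≤-reflexive (split i i<k))) ⟩
          K                    ≤⟨ m≤m*n K fg {{>-nonZero fg>0}} ⟩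
          K * fg               ∎

    -- At most k/16 bad ends, each costing 14θ powers of 3, amount to less than θ powers per step.
    W-bound : W ^ sumN k βs ≤ (3 ^ θ) ^ k
    W-bound = begin
      W ^ sumN k βs                ≡⟨ ^-*-assoc 3 (14 * θ) (sumN k βs) ⟩
      3 ^ (14 * θ * sumN k βs)     ≤⟨ ^-monoʳ-≤ 3 (≤-trans (≤-reflexive (ring 14 θ (sumN k βs)))
                                        (*-monoʳ-≤ θ (≤-trans (*-monoˡ-≤ (sumN k βs) {14} {16} (m≤m+n 14 2)) bad-sum))) ⟩
      3 ^ (θ * k)                  ≡⟨ sym (^-*-assoc 3 θ k) ⟩
      (3 ^ θ) ^ k                  ∎
      where
      open ≤-Reasoning
      ring : ∀ a b c → a * b * c ≡ b * (a * c)
      ring = solve-∀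

    3^13≥2^20 : 2 ^ 20 ≤ 3 ^ 13
    3^13≥2^20 = ≤ᵇ⇒≤ (2 ^ 20) (3 ^ 13) tt

    -- Of the 16θ powers of 3 won by the search, 2θ are lost at good vertices and θ to bad ones. The
    -- remaining 13θ outweigh the factor 2^L per leaf and still leave 2^(4θ), which is the fourth
    -- root of k.
    growth : 2 ^ (4 * θ) * 2 ^ L ≤ 3 ^ (13 * θ)
    growth = begin
      2 ^ (4 * θ) * 2 ^ L     ≡⟨ sym (^-distribˡ-+-* 2 (4 * θ) L) ⟩
      2 ^ (4 * θ + 16 * θ)    ≡⟨ cong (2 ^_) (sym (*-distribʳ-+ θ 4 16)) ⟩
      2 ^ (20 * θ)            ≡⟨ sym (^-*-assoc 2 20 θ) ⟩
      (2 ^ 20) ^ θ            ≤⟨ ^-monoˡ-≤ θ 3^13≥2^20 ⟩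
      (3 ^ 13) ^ θ            ≡⟨ ^-*-assoc 3 13 θ ⟩
      3 ^ (13 * θ)            ∎
      where open ≤-Reasoning

    P = pow k X (x k) * pow k Y (x 0)

    main-chain : (e * 2 ^ (4 * θ)) ^ k * P ≤ (16 * ν) ^ k
    main-chain = cancelˡ (γ ^ k) (m^n>0 γ {{>-nonZero γ>0}} k) (begin
      γ ^ k * ((e * 2 ^ (4 * θ)) ^ k * P)    ≡⟨ trans (sym (*-assoc (γ ^ k) _ P)) (cong (_* P) (sym (*-^ γ (e * 2 ^ (4 * θ)) k))) ⟩
      (γ * (e * 2 ^ (4 * θ))) ^ k * P        ≤⟨ *-monoˡ-≤ P (^-monoˡ-≤ k base) ⟩
      (e * 2 ^ L * (K * W)) ^ k * P          ≡⟨ cong (_* P) (trans (*-^ (e * 2 ^ L) (K * W) k)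
                                                  (cong (_* (K * W) ^ k) (*-^ e (2 ^ L) k))) ⟩
      e ^ k * (2 ^ L) ^ k * (K * W) ^ k * P  ≡⟨ *-assoc (e ^ k * (2 ^ L) ^ k) ((K * W) ^ k) P ⟩
      e ^ k * (2 ^ L) ^ k * ((K * W) ^ k * P)
        ≤⟨ *-monoʳ-≤ (e ^ k * (2 ^ L) ^ k) walk-product ⟩
      e ^ k * (2 ^ L) ^ k * (W ^ sumN k βs * (2 ^ k * prodN k rs))
        ≡⟨ ring₁ (e ^ k) ((2 ^ L) ^ k) (W ^ sumN k βs) (2 ^ k) (prodN k rs) ⟩
      W ^ sumN k βs * 2 ^ k * (e ^ k * ((2 ^ L) ^ k * prodN k rs))
        ≤⟨ *-mono-≤ (*-monoˡ-≤ (2 ^ k) W-bound) (*-monoʳ-≤ (e ^ k) (am-gm L rs)) ⟩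
      (3 ^ θ) ^ k * 2 ^ k * (e ^ k * sumN k rs ^ k)
        ≡⟨ cong₂ _*_ (sym (*-^ (3 ^ θ) 2 k)) (sym (*-^ e (sumN k rs) k)) ⟩
      (3 ^ θ * 2) ^ k * (e * sumN k rs) ^ k
        ≤⟨ *-monoʳ-≤ ((3 ^ θ * 2) ^ k) (^-monoˡ-≤ k ratio-sum) ⟩
      (3 ^ θ * 2) ^ k * (8 * V) ^ k          ≡⟨ sym (*-^ (3 ^ θ * 2) (8 * V) k) ⟩
      (3 ^ θ * 2 * (8 * V)) ^ k              ≡⟨ cong (_^ k) collect ⟩
      (γ * (16 * ν)) ^ k                     ≡⟨ *-^ γ (16 * ν) k ⟩
      γ ^ k * (16 * ν) ^ k                   ∎)
      where
      open ≤-Reasoning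
      γ = 3 ^ θ * K * (2 ^ L * 2 ^ L)
      γ>0 : 0 < γ
      γ>0 = *-pos (*-pos (m^n>0 3 θ) (m^n>0 n {{>-nonZero n>0}} k)) (*-pos (m^n>0 2 L) (m^n>0 2 L))
      ring₁ : ∀ a b w t p → a * b * (w * (t * p)) ≡ w * t * (a * (b * p))
      ring₁ = solve-∀
      collect : 3 ^ θ * 2 * (8 * V) ≡ γ * (16 * ν)
      collect = trans (cong (λ q → 3 ^ θ * 2 * (8 * (K * q * ν))) (*-^ 2 2 L)) (ring (3 ^ θ) K (2 ^ L) ν)
        where
        ring : ∀ t K l n → t * 2 * (8 * (K * (l * l) * n)) ≡ t * K * (l * l) * (16 * n)
        ring = solve-∀
      base : γ * (e * 2 ^ (4 * θ)) ≤ e * 2 ^ L * (K * W)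
      base = begin
        3 ^ θ * K * (2 ^ L * 2 ^ L) * (e * 2 ^ (4 * θ))      ≡⟨ ring (3 ^ θ) K (2 ^ L) e (2 ^ (4 * θ)) ⟩
        e * 2 ^ L * (K * (3 ^ θ * (2 ^ (4 * θ) * 2 ^ L)))    ≤⟨ *-monoʳ-≤ (e * 2 ^ L) (*-monoʳ-≤ K (*-monoʳ-≤ (3 ^ θ) growth)) ⟩
        e * 2 ^ L * (K * (3 ^ θ * 3 ^ (13 * θ)))             ≡⟨ cong (λ m → e * 2 ^ L * (K * m)) (sym (^-distribˡ-+-* 3 θ (13 * θ))) ⟩
        e * 2 ^ L * (K * W)                                  ∎
        where
        ring : ∀ t K l e f → t * K * (l * l) * (e * f) ≡ e * l * (K * (t * (f * l)))
        ring = solve-∀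

    -- `P` is what telescoping leaves over; the heaviness of both end points turns it into (G /
    -- 2^n)^2 up to a constant.
    rectangle-bound : (e * 2 ^ (4 * θ)) ^ k * (G * G) ≤ (16 * 2 ^ n) * (16 * 2 ^ n) * (16 * ν) ^ k
    rectangle-bound = begin
      Q * (G * G)                                  ≤⟨ *-monoʳ-≤ Q (*-mono-≤ end-heavy start-heavy) ⟩
      Q * (N * pow k X (x k) * (N * pow k Y (x 0)))  ≡⟨ ring Q N (pow k X (x k)) (pow k Y (x 0)) ⟩
      N * N * (Q * P)                              ≤⟨ *-monoʳ-≤ (N * N) main-chain ⟩
      N * N * (16 * ν) ^ k                         ∎
      where
      open ≤-Reasoning
      N = 16 * 2 ^ n
      Q = (e * 2 ^ (4 * θ)) ^ k
      ring : ∀ Q N a b → Q * (N * a * (N * b)) ≡ N * N * (Q * (a * b))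
      ring = solve-∀

-- Averaging the errors of a protocol over walks.

⟦⟧≤1 : ∀ b → ⟦ b ⟧ ≤ 1
⟦⟧≤1 true  = ≤-refl
⟦⟧≤1 false = z≤n

sumL : ∀ {A : Set} → List A → (A → ℕ) → ℕ
sumL []       f = 0
sumL (p ∷ ps) f = f p + sumL ps f

size : ∀ {A : Set} → List A → ℕ
size ps = sumL ps (λ _ → 1)

sumL-lin : ∀ {A : Set} (ps : List A) c d (f g : A → ℕ) →
           sumL ps (λ p → c * f p + d * g p) ≡ c * sumL ps f + d * sumL ps g
sumL-lin []       c d f g = sym (cong₂ _+_ (*-zeroʳ c) (*-zeroʳ d))
sumL-lin (p ∷ ps) c d f g = trans (cong (c * f p + d * g p +_) (sumL-lin ps c d f g)) (ring c d (f p) (g p) (sumL ps f) (sumL ps g))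
  where
  ring : ∀ c d a b x y → c * a + d * b + (c * x + d * y) ≡ c * (a + x) + d * (b + y)
  ring = solve-∀

sumL-mono : ∀ {A : Set} (ps : List A) {f g : A → ℕ} → (∀ p → f p ≤ g p) → sumL ps f ≤ sumL ps g
sumL-mono []       h = z≤n
sumL-mono (p ∷ ps) h = +-mono-≤ (h p) (sumL-mono ps h)

sumL-cong : ∀ {A : Set} (ps : List A) {f g : A → ℕ} → (∀ p → f p ≡ g p) → sumL ps f ≡ sumL ps g
sumL-cong []       h = refl
sumL-cong (p ∷ ps) h = cong₂ _+_ (h p) (sumL-cong ps h)

sumL-average : ∀ {A : Set} (ps : List A) (f : A → ℕ) c → 0 < size ps → sumL ps f ≤ size ps * c → Σ A λ p → f p ≤ c
sumL-average (p ∷ ps) f c _ le with f p ≤? c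
... | yes fp≤c = p , fp≤c
... | no  fp≰c = rest ps (+-cancelˡ-< c _ _ (<-≤-trans (+-monoˡ-< (sumL ps f) (≰⇒> fp≰c)) le))
  where
  rest : ∀ ps → sumL ps f < size ps * c → Σ _ λ p → f p ≤ c
  rest []       ()
  rest (p ∷ ps) lt = sumL-average (p ∷ ps) f c (s≤s z≤n) (<⇒≤ lt)

-- Summing over the end points of all t-walks stands in for summing over pairs at distance t;
-- `collisions` bounds the difference.
walkSum : ∀ {n} → ℕ → (Cube n → Cube n → ℕ) → ℕ
walkSum t h = sumV (λ x → pow t (h x) x)

walkSum-mono : ∀ {n} t {h h′ : Cube n → Cube n → ℕ} → (∀ x y → h x y ≤ h′ x y) → walkSum t h ≤ walkSum t h′
walkSum-mono t le = sumV-mono (λ x → pow-mono t (le x) x)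

walkSum-cong : ∀ {n} t {h h′ : Cube n → Cube n → ℕ} → (∀ x y → h x y ≡ h′ x y) → walkSum t h ≡ walkSum t h′
walkSum-cong t eq = sumV-cong (λ x → pow-cong t (eq x) x)

walkSum-+ : ∀ {n} t (h h′ : Cube n → Cube n → ℕ) →
            walkSum t (λ x y → h x y + h′ x y) ≡ walkSum t h + walkSum t h′
walkSum-+ t h h′ = trans (sumV-cong (λ x → pow-+ t (h x) (h′ x) x)) (sumV-+ (λ x → pow t (h x) x) (λ x → pow t (h′ x) x))

walkSum-* : ∀ {n} t c (h : Cube n → Cube n → ℕ) → walkSum t (λ x y → c * h x y) ≡ c * walkSum t h
walkSum-* t c h = trans (sumV-cong (λ x → pow-* t c (h x) x)) (sumV-* c (λ x → pow t (h x) x))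

walkSum-const : ∀ n t c → walkSum {n} t (λ _ _ → c) ≡ 2 ^ n * (n ^ t * c)
walkSum-const n t c = trans (sumV-cong {n} (λ x → pow-const t c x)) (sumV-const n (n ^ t * c))

walkSum-rectangle : ∀ {n} t (X Y : Cube n → ℕ) → walkSum t (λ x y → X x * Y y) ≡ ⟨ X , pow t Y ⟩
walkSum-rectangle t X Y = sumV-cong (λ x → pow-* t (X x) Y x)

walkSum-sumL : ∀ {n} {A : Set} t (ps : List A) (φ : A → Cube n → Cube n → ℕ) →
               sumL ps (λ p → walkSum t (φ p)) ≡ walkSum t (λ x y → sumL ps (λ p → φ p x y))
walkSum-sumL {n} t []       φ = sym (trans (walkSum-const n t 0) (trans (cong (2 ^ n *_) (*-zeroʳ (n ^ t))) (*-zeroʳ (2 ^ n))))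
walkSum-sumL     t (p ∷ ps) φ = trans (cong (walkSum t (φ p) +_) (walkSum-sumL t ps φ))
                                      (sym (walkSum-+ t (φ p) (λ x y → sumL ps (λ q → φ q x y))))

off : ∀ {n} → ℕ → Cube n → Cube n → ℕ
off t x y = ⟦ not (ham x y ≡ᵇ t) ⟧

≡ᵇ-refl : ∀ m → (m ≡ᵇ m) ≡ true
≡ᵇ-refl zero    = refl
≡ᵇ-refl (suc m) = ≡ᵇ-refl m

ham-refl : ∀ {n} (x : Cube n) → ham x x ≡ 0
ham-refl []          = refl
ham-refl (true ∷ x)  = ham-refl x
ham-refl (false ∷ x) = ham-refl x

-- The distance fails to grow only when a coordinate is flipped in which x and y already differ.
turning-back : ∀ {n} (x y : Cube n) → adj (off (suc (ham x y)) x) y ≤ ham x y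
turning-back []          []          = z≤n
turning-back (true ∷ x)  (true ∷ y)  rewrite ≡ᵇ-refl (ham x y) = turning-back x y
turning-back (false ∷ x) (false ∷ y) rewrite ≡ᵇ-refl (ham x y) = turning-back x y
turning-back (true ∷ x)  (false ∷ y) = +-mono-≤ (⟦⟧≤1 _) (turning-back x y)
turning-back (false ∷ x) (true ∷ y)  = +-mono-≤ (⟦⟧≤1 _) (turning-back x y)

off-step : ∀ {n} t (x y : Cube n) → adj (off (suc t) x) y ≤ n * off t x y + t
off-step {n} t x y with ham x y ≡ᵇ t in eq
... | true  = ≤-trans (subst (λ s → adj (off (suc s) x) y ≤ s) (≡ᵇ⇒≡ (ham x y) t (subst IsTrue (sym eq) tt)) (turning-back x y))
                      (m≤n+m t (n * 0))
... | false = ≤-trans (≤-trans (adj-mono (λ z → ⟦⟧≤1 (not (ham x z ≡ᵇ suc t))) y) (≤-reflexive (adj-const 1 y)))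
                      (m≤m+n (n * 1) t)

-- Union bound over the steps: a walk that has reached distance s goes astray in at most s of the n
-- directions, and 0 + 1 + ... + (t - 1) ≤ t².
collisions : ∀ {n} t (x : Cube n) → n * pow t (off t x) x ≤ t * t * n ^ t
collisions {n} zero x rewrite ham-refl x = ≤-reflexive (*-zeroʳ n)
collisions {n} (suc t) x = begin
  n * pow (suc t) (off (suc t) x) x          ≡⟨ cong (n *_) (sym (pow-comm t (off (suc t) x) x)) ⟩
  n * pow t (adj (off (suc t) x)) x          ≤⟨ *-monoʳ-≤ n (pow-mono t (off-step t x) x) ⟩
  n * pow t (λ y → n * off t x y + t) x      ≡⟨ cong (n *_) (trans (pow-+ t (λ y → n * off t x y) (λ _ → t) x)
                                                  (cong₂ _+_ (pow-* t n (off t x) x) (pow-const t t x))) ⟩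
  n * (n * pow t (off t x) x + n ^ t * t)    ≤⟨ *-monoʳ-≤ n (+-monoˡ-≤ (n ^ t * t) (collisions t x)) ⟩
  n * (t * t * n ^ t + n ^ t * t)            ≤⟨ m≤m+n _ (suc t * (n * n ^ t)) ⟩
  n * (t * t * n ^ t + n ^ t * t) + suc t * (n * n ^ t)   ≡⟨ ring t n (n ^ t) ⟩
  suc t * suc t * n ^ suc t                  ∎
  where
  open ≤-Reasoning
  ring : ∀ t n q → n * (t * t * q + q * t) + (1 + t) * (n * q) ≡ (1 + t) * (1 + t) * (n * q)
  ring = solve-∀

-- Walks ending at distance t are covered by correctness; all others are charged in full, and
-- `collisions` makes them few.
walk-errors : ∀ {n} {A : Set} t D (ps : List A) (φ : A → Cube n → Cube n → ℕ) → (∀ p x y → φ p x y ≤ 1) →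
  (∀ x y → ham x y ≡ t → D * sumL ps (λ p → φ p x y) ≤ size ps) →
  n * (D * sumL ps (λ p → walkSum t (φ p))) ≤ size ps * (2 ^ n * n ^ t) * (n + D * (t * t))
walk-errors {n} t D ps φ φ≤1 good = begin
  n * (D * sumL ps (λ p → walkSum t (φ p)))      ≡⟨ cong (λ m → n * (D * m)) (walkSum-sumL t ps φ) ⟩
  n * (D * walkSum t Σφ)                         ≡⟨ cong (n *_) (sym (walkSum-* t D Σφ)) ⟩
  n * walkSum t (λ x y → D * Σφ x y)             ≤⟨ *-monoʳ-≤ n (walkSum-mono t pointwise) ⟩
  n * walkSum {n} t (λ x y → M + D * M * off t x y)
    ≡⟨ cong (n *_) (trans (walkSum-+ {n} t (λ _ _ → M) (λ x y → D * M * off t x y))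
                          (cong₂ _+_ (walkSum-const n t M) (walkSum-* {n} t (D * M) (off t)))) ⟩
  n * (2 ^ n * (n ^ t * M) + D * M * walkSum {n} t (off t))
    ≡⟨ ring₁ n (2 ^ n) (n ^ t) M D (walkSum {n} t (off t)) ⟩
  M * (2 ^ n * n ^ t) * n + D * M * (n * walkSum {n} t (off t))
    ≤⟨ +-monoʳ-≤ (M * (2 ^ n * n ^ t) * n) (*-monoʳ-≤ (D * M) offs) ⟩
  M * (2 ^ n * n ^ t) * n + D * M * (2 ^ n * (t * t * n ^ t))
    ≡⟨ ring₂ n (2 ^ n) (n ^ t) M D (t * t) ⟩
  M * (2 ^ n * n ^ t) * (n + D * (t * t)) ∎
  where
  open ≤-Reasoning
  M = size ps
  Σφ : Cube n → Cube n → ℕ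
  Σφ x y = sumL ps (λ p → φ p x y)
  pointwise : ∀ x y → D * Σφ x y ≤ M + D * M * off t x y
  pointwise x y with ham x y ≡ᵇ t in eq
  ... | true  = ≤-trans (good x y (≡ᵇ⇒≡ (ham x y) t (subst IsTrue (sym eq) tt))) (m≤m+n M _)
  ... | false = ≤-trans (*-monoʳ-≤ D (sumL-mono ps (λ p → φ≤1 p x y)))
                        (≤-trans (≤-reflexive (sym (*-identityʳ (D * M)))) (m≤n+m _ M))
  offs : n * walkSum {n} t (off t) ≤ 2 ^ n * (t * t * n ^ t)
  offs = begin
    n * walkSum {n} t (off t)                       ≡⟨ sym (sumV-* {n} n (λ x → pow t (off t x) x)) ⟩
    sumV {n} (λ x → n * pow t (off t x) x)          ≤⟨ sumV-mono {n} (collisions t) ⟩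
    sumV {n} (λ _ → t * t * n ^ t)              ≡⟨ sumV-const n _ ⟩
    2 ^ n * (t * t * n ^ t)                     ∎
  ring₁ : ∀ n N q M D o → n * (N * (q * M) + D * M * o) ≡ M * (N * q) * n + D * M * (n * o)
  ring₁ = solve-∀
  ring₂ : ∀ n N q M D s → M * (N * q) * n + D * M * (N * (s * q)) ≡ M * (N * q) * (n + D * s)
  ring₂ = solve-∀

-- Extracting an accepted rectangle from a protocol.

data Bounded (n : ℕ) : ℕ → Set where
  leaf  : ∀ {c} → Bool → Bounded n c
  alice : ∀ {c} → (Cube n → Bool) → Bounded n c → Bounded n c → Bounded n (suc c)
  bob   : ∀ {c} → (Cube n → Bool) → Bounded n c → Bounded n c → Bounded n (suc c)

out : ∀ {n c} → Bounded n c → Cube n → Cube n → Bool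
out (leaf o)      x y = o
out (alice f l r) x y = if f x then out l x y else out r x y
out (bob g l r)   x y = if g y then out l x y else out r x y

record Additive {n} (Φ : (Cube n → Cube n → ℕ) → ℕ) : Set where
  field
    Φ-cong : ∀ {h h′} → (∀ x y → h x y ≡ h′ x y) → Φ h ≡ Φ h′
    Φ-+    : ∀ h h′ → Φ (λ x y → h x y + h′ x y) ≡ Φ h + Φ h′
    Φ-zero : Φ (λ _ _ → 0) ≡ 0
open Additive

walkSum-additive : ∀ {n} t c → Additive {n} (λ h → c * walkSum t h)
walkSum-additive t c .Φ-cong eq = cong (c *_) (walkSum-cong t eq)
walkSum-additive t c .Φ-+ h h′  = trans (cong (c *_) (walkSum-+ t h h′)) (*-distribˡ-+ c _ _)
walkSum-additive {n} t c .Φ-zero = trans (cong (c *_) (trans (walkSum-const n t 0)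
  (trans (cong (2 ^ n *_) (*-zeroʳ (n ^ t))) (*-zeroʳ (2 ^ n))))) (*-zeroʳ c)

+-additive : ∀ {n} {Φ Ψ : (Cube n → Cube n → ℕ) → ℕ} → Additive Φ → Additive Ψ → Additive (λ h → Φ h + Ψ h)
+-additive a b .Φ-cong eq = cong₂ _+_ (Φ-cong a eq) (Φ-cong b eq)
+-additive {Φ = Φ} {Ψ} a b .Φ-+ h h′  = trans (cong₂ _+_ (Φ-+ a h h′) (Φ-+ b h h′)) (interchange (Φ h) (Φ h′) (Ψ h) (Ψ h′))
+-additive a b .Φ-zero    = cong₂ _+_ (Φ-zero a) (Φ-zero b)

halve : ∀ a₁ a₂ b₁ b₂ T → a₁ + a₂ + T ≤ b₁ + b₂ → (2 * a₁ + T ≤ 2 * b₁) ⊎ (2 * a₂ + T ≤ 2 * b₂)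
halve a₁ a₂ b₁ b₂ T le with 2 * a₁ + T ≤? 2 * b₁ | 2 * a₂ + T ≤? 2 * b₂
... | yes p | _     = inj₁ p
... | no _  | yes q = inj₂ q
... | no p  | no q  = ⊥-elim (<-irrefl refl (begin-strict
  2 * b₁ + 2 * b₂                    <⟨ +-mono-< (≰⇒> p) (≰⇒> q) ⟩
  (2 * a₁ + T) + (2 * a₂ + T)        ≡⟨ ring a₁ a₂ T ⟩
  2 * (a₁ + a₂ + T)                  ≤⟨ *-monoʳ-≤ 2 le ⟩
  2 * (b₁ + b₂)                      ≡⟨ *-distribˡ-+ 2 b₁ b₂ ⟩
  2 * b₁ + 2 * b₂                    ∎))
  where
  open ≤-Reasoning
  ring : ∀ a b T → (2 * a + T) + (2 * b + T) ≡ 2 * (a + b + T)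
  ring = solve-∀

AcceptedRectangle : ∀ {n} (Pos Neg : (Cube n → Cube n → ℕ) → ℕ) → ℕ → ℕ → Set
AcceptedRectangle {n} Pos Neg T σ =
  Σ (Cube n → ℕ) λ X → Σ (Cube n → ℕ) λ Y → (∀ z → X z ≤ 1) × (∀ z → Y z ≤ 1) ×
    σ * Neg (λ x y → X x * Y y) + T ≤ σ * Pos (λ x y → X x * Y y)

-- Splitting the input rectangle at every node, some accepting leaf keeps a 2^-c share of T.
module _ {n} (Pos Neg : (Cube n → Cube n → ℕ) → ℕ) (pos : Additive Pos) (neg : Additive Neg) (T : ℕ) (T>0 : 0 < T) where

  acc : ∀ {c} → Bounded n c → (X Y : Cube n → ℕ) → Cube n → Cube n → ℕ
  acc p X Y x y = X x * Y y * ⟦ out p x y ⟧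

  rectangle : ∀ {c} (p : Bounded n c) (X Y : Cube n → ℕ) → (∀ z → X z ≤ 1) → (∀ z → Y z ≤ 1) → ∀ σ →
    σ * Neg (acc p X Y) + T ≤ σ * Pos (acc p X Y) → AcceptedRectangle Pos Neg T (σ * 2 ^ c)

  branch : ∀ {c} (l r : Bounded n c) (X₁ Y₁ X₂ Y₂ : Cube n → ℕ) (h : Cube n → Cube n → ℕ) →
    (∀ z → X₁ z ≤ 1) → (∀ z → Y₁ z ≤ 1) → (∀ z → X₂ z ≤ 1) → (∀ z → Y₂ z ≤ 1) →
    (∀ x y → h x y ≡ acc l X₁ Y₁ x y + acc r X₂ Y₂ x y) → ∀ σ →
    σ * Neg h + T ≤ σ * Pos h → AcceptedRectangle Pos Neg T (σ * 2 ^ suc c)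
  branch {c} l r X₁ Y₁ X₂ Y₂ h bX₁ bY₁ bX₂ bY₂ eq σ le = pick (halve (σ * Neg h₁) (σ * Neg h₂) (σ * Pos h₁) (σ * Pos h₂) T
      (subst₂ (λ a b → a + T ≤ b) (splits Neg neg) (splits Pos pos) le))
    where
    h₁ = acc l X₁ Y₁
    h₂ = acc r X₂ Y₂
    splits : ∀ Φ → Additive Φ → σ * Φ h ≡ σ * Φ h₁ + σ * Φ h₂
    splits Φ add = trans (cong (σ *_) (trans (Φ-cong add eq) (Φ-+ add h₁ h₂))) (*-distribˡ-+ σ _ _)
    index : ∀ {σ c} → AcceptedRectangle Pos Neg T (2 * σ * 2 ^ c) → AcceptedRectangle Pos Neg T (σ * 2 ^ suc c)
    index {σ} {c} = subst (AcceptedRectangle Pos Neg T) (ring σ (2 ^ c))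
      where
      ring : ∀ s p → 2 * s * p ≡ s * (2 * p)
      ring = solve-∀
    assoc : ∀ {a b} → 2 * (σ * a) + T ≤ 2 * (σ * b) → 2 * σ * a + T ≤ 2 * σ * b
    assoc {a} {b} = subst₂ (λ s t → s + T ≤ t) (sym (*-assoc 2 σ a)) (sym (*-assoc 2 σ b))
    pick : (2 * (σ * Neg h₁) + T ≤ 2 * (σ * Pos h₁)) ⊎ (2 * (σ * Neg h₂) + T ≤ 2 * (σ * Pos h₂)) →
           AcceptedRectangle Pos Neg T (σ * 2 ^ suc c)
    pick (inj₁ q) = index {σ} {c} (rectangle l X₁ Y₁ bX₁ bY₁ (2 * σ) (assoc {Neg h₁} {Pos h₁} q))
    pick (inj₂ q) = index {σ} {c} (rectangle r X₂ Y₂ bX₂ bY₂ (2 * σ) (assoc {Neg h₂} {Pos h₂} q))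

  -- The leaf may lie above the full depth; the doublings not yet used are applied here.
  rectangle {c} (leaf true) X Y bX bY σ le = X , Y , bX , bY , (begin
    σ * 2 ^ c * Neg h + T          ≤⟨ +-monoʳ-≤ (σ * 2 ^ c * Neg h) (m≤n*m T (2 ^ c) {{m^n≢0 2 c}}) ⟩
    σ * 2 ^ c * Neg h + 2 ^ c * T  ≡⟨ ring₁ σ (2 ^ c) (Neg h) T ⟩
    2 ^ c * (σ * Neg h + T)        ≤⟨ *-monoʳ-≤ (2 ^ c) (subst₂ (λ a b → σ * a + T ≤ σ * b) (Φ-cong neg eq) (Φ-cong pos eq) le) ⟩
    2 ^ c * (σ * Pos h)            ≡⟨ ring₂ σ (2 ^ c) (Pos h) ⟩
    σ * 2 ^ c * Pos h              ∎)
    where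
    open ≤-Reasoning
    h = λ x y → X x * Y y
    eq : ∀ x y → X x * Y y * 1 ≡ X x * Y y
    eq x y = *-identityʳ (X x * Y y)
    ring₁ : ∀ s q a T → s * q * a + q * T ≡ q * (s * a + T)
    ring₁ = solve-∀
    ring₂ : ∀ s q a → q * (s * a) ≡ s * q * a
    ring₂ = solve-∀
  -- A rejecting leaf accepts no walk, so the inequality would force T to vanish.
  rectangle (leaf false) X Y bX bY σ le = ⊥-elim (<-irrefl refl (<-≤-trans T>0 (≤-trans (m≤n+m T _) (≤-trans le
    (≤-reflexive (trans (cong (σ *_) (trans (Φ-cong pos (λ x y → *-zeroʳ (X x * Y y))) (Φ-zero pos))) (*-zeroʳ σ)))))))
  rectangle (alice f l r) X Y bX bY σ le = branch l r (λ x → X x * ⟦ f x ⟧) Y (λ x → X x * ⟦ not (f x) ⟧) Y _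
      (λ x → *-mono-≤ (bX x) (⟦⟧≤1 (f x))) bY (λ x → *-mono-≤ (bX x) (⟦⟧≤1 (not (f x)))) bY
      (λ x y → eq x y (f x)) σ le
    where
    eq : ∀ x y b → X x * Y y * ⟦ if b then out l x y else out r x y ⟧ ≡
         X x * ⟦ b ⟧ * Y y * ⟦ out l x y ⟧ + X x * ⟦ not b ⟧ * Y y * ⟦ out r x y ⟧
    eq x y true  = ring (X x) (Y y) ⟦ out l x y ⟧ ⟦ out r x y ⟧
      where
      ring : ∀ a b c d → a * b * c ≡ a * 1 * b * c + a * 0 * b * d
      ring = solve-∀
    eq x y false = ring (X x) (Y y) ⟦ out l x y ⟧ ⟦ out r x y ⟧
      where
      ring : ∀ a b c d → a * b * d ≡ a * 0 * b * c + a * 1 * b * d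
      ring = solve-∀
  rectangle (bob g l r) X Y bX bY σ le = branch l r X (λ y → Y y * ⟦ g y ⟧) X (λ y → Y y * ⟦ not (g y) ⟧) _
      bX (λ y → *-mono-≤ (bY y) (⟦⟧≤1 (g y))) bX (λ y → *-mono-≤ (bY y) (⟦⟧≤1 (not (g y))))
      (λ x y → eq x y (g y)) σ le
    where
    eq : ∀ x y b → X x * Y y * ⟦ if b then out l x y else out r x y ⟧ ≡
         X x * (Y y * ⟦ b ⟧) * ⟦ out l x y ⟧ + X x * (Y y * ⟦ not b ⟧) * ⟦ out r x y ⟧
    eq x y true  = ring (X x) (Y y) ⟦ out l x y ⟧ ⟦ out r x y ⟧
      where
      ring : ∀ a b c d → a * b * c ≡ a * (b * 1) * c + a * (b * 0) * d
      ring = solve-∀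
    eq x y false = ring (X x) (Y y) ⟦ out l x y ⟧ ⟦ out r x y ⟧
      where
      ring : ∀ a b c d → a * b * d ≡ a * (b * 0) * c + a * (b * 1) * d
      ring = solve-∀

-- The cost bound when k is a power of 2^16.

Correct : ∀ {n c} → ℕ → ℕ → List (Bounded n c) → Set
Correct D k ps = ∀ x y →
  (ham x y ≡ k     → D * sumL ps (λ p → ⟦ not (out p x y) ⟧) ≤ size ps) ×
  (ham x y ≡ 2 + k → D * sumL ps (λ p → ⟦ out p x y ⟧) ≤ size ps)

accept reject : ∀ {n c} → Bounded n c → Cube n → Cube n → ℕ
accept p x y = ⟦ out p x y ⟧
reject p x y = ⟦ not (out p x y) ⟧

-- Some random string is no worse than the average. The factor n² brings the errors at distance k to
-- the scale of the (k+2)-walks.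
accurate-protocol : ∀ {n c} D k (ps : List (Bounded n c)) → Correct D k ps → 0 < size ps → 0 < n → 0 < k →
  k * k * D ≤ 2 * n →
  Σ (Bounded n c) λ p →
    D * (n * n * walkSum k (reject p) + walkSum (2 + k) (accept p)) ≤ 32 * (2 ^ n * n ^ (2 + k))
accurate-protocol {n} D k ps correct ps>0 n>0 k>0 close = sumL-average ps _ (32 * T) ps>0 (cancelˡ n n>0 (begin
  n * sumL ps (λ p → D * (ν * walkSum k (reject p) + walkSum (2 + k) (accept p)))
    ≡⟨ cong (n *_) (trans (sumL-cong ps (λ p → ring₁ D ν (walkSum k (reject p)) (walkSum (2 + k) (accept p))))
                          (sumL-lin ps (D * ν) D (λ p → walkSum k (reject p)) (λ p → walkSum (2 + k) (accept p)))) ⟩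
  n * (D * ν * e₀ + D * e₁)               ≡⟨ ring₂ n D ν e₀ e₁ ⟩
  ν * (n * (D * e₀)) + n * (D * e₁)
    ≤⟨ +-mono-≤ (*-monoʳ-≤ ν (walk-errors k D ps reject (λ p x y → ⟦⟧≤1 _) (λ x y → proj₁ (correct x y))))
                (walk-errors (2 + k) D ps accept (λ p x y → ⟦⟧≤1 _) (λ x y → proj₂ (correct x y))) ⟩
  ν * (M * (2 ^ n * n ^ k) * (n + D * (k * k))) + M * T * (n + D * ((2 + k) * (2 + k)))
    ≡⟨ ring₃ n M (2 ^ n) (n ^ k) (n + D * (k * k)) (n + D * ((2 + k) * (2 + k))) ⟩
  M * T * ((n + D * (k * k)) + (n + D * ((2 + k) * (2 + k))))
    ≤⟨ *-monoʳ-≤ (M * T) few ⟩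
  M * T * (32 * n)                        ≡⟨ ring₄ M T 32 n ⟩
  n * (M * (32 * T))                      ∎))
  where
  open ≤-Reasoning
  ν = n * n
  T = 2 ^ n * n ^ (2 + k)
  M = size ps
  e₀ = sumL ps (λ p → walkSum k (reject p))
  e₁ = sumL ps (λ p → walkSum (2 + k) (accept p))
  ring₁ : ∀ D v a b → D * (v * a + b) ≡ D * v * a + D * b
  ring₁ = solve-∀
  ring₂ : ∀ n D v a b → n * (D * v * a + D * b) ≡ v * (n * (D * a)) + n * (D * b)
  ring₂ = solve-∀
  ring₃ : ∀ n M N q a b → n * n * (M * (N * q) * a) + M * (N * (n * (n * q))) * b ≡ M * (N * (n * (n * q))) * (a + b)
  ring₃ = solve-∀
  ring₄ : ∀ M T c n → M * T * (c * n) ≡ n * (M * (c * T))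
  ring₄ = solve-∀
  2+k≤3k : 2 + k ≤ 3 * k
  2+k≤3k = ≤-trans (+-monoˡ-≤ k (*-monoʳ-≤ 2 k>0)) (≤-reflexive (ring k))
    where
    ring : ∀ k → 2 * k + k ≡ 3 * k
    ring = solve-∀
  -- The sum is at most 22 n; the bound 32 is a power of two and thus only shifts the exponent `l`.
  few : (n + D * (k * k)) + (n + D * ((2 + k) * (2 + k))) ≤ 32 * n
  few = begin
    (n + D * (k * k)) + (n + D * ((2 + k) * (2 + k)))
      ≤⟨ +-monoʳ-≤ (n + D * (k * k)) (+-monoʳ-≤ n (*-monoʳ-≤ D (*-mono-≤ 2+k≤3k 2+k≤3k))) ⟩
    (n + D * (k * k)) + (n + D * ((3 * k) * (3 * k)))  ≡⟨ ring₅ n D k ⟩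
    2 * n + 10 * (k * k * D)                           ≤⟨ +-monoʳ-≤ (2 * n) (*-monoʳ-≤ 10 close) ⟩
    2 * n + 10 * (2 * n)                               ≤⟨ m≤m+n _ (10 * n) ⟩
    2 * n + 10 * (2 * n) + 10 * n                      ≡⟨ ring₆ n ⟩
    32 * n                                             ∎
    where
    ring₅ : ∀ n D k → (n + D * (k * k)) + (n + D * ((3 * k) * (3 * k))) ≡ 2 * n + 10 * (k * k * D)
    ring₅ = solve-∀
    ring₆ : ∀ n → 2 * n + 10 * (2 * n) + 10 * n ≡ 32 * n
    ring₆ = solve-∀

accept+reject : ∀ {n c} t (p : Bounded n c) → walkSum t (accept p) + walkSum t (reject p) ≡ 2 ^ n * n ^ t
accept+reject {n} t p = trans (sym (walkSum-+ t (accept p) (reject p)))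
  (trans (walkSum-cong t (λ x y → one (out p x y))) (trans (walkSum-const n t 1) (cong (2 ^ n *_) (*-identityʳ (n ^ t)))))
  where
  one : ∀ b → ⟦ b ⟧ + ⟦ not b ⟧ ≡ 1
  one true  = refl
  one false = refl

-- For k = 1 there is no distance k ∸ 2, and its term is dropped.
back-weight : ℕ → ℕ → ℕ
back-weight n zero    = 0
back-weight n (suc θ) = n * n * (n * n)

back-weight-bound : ∀ n θ → back-weight n θ * n ^ (pow2 (16 * θ) ∸ 2) ≤ n ^ (2 + pow2 (16 * θ))
back-weight-bound n zero    = z≤n
back-weight-bound n (suc θ) = ≤-reflexive (go (pow2 (16 * suc θ)) (+-mono-≤ {1} {_} {1} (pow2>0 L) (pow2>0 L)))
  where
  L = θ + 15 * suc θ
  go : ∀ k → 2 ≤ k → n * n * (n * n) * n ^ (k ∸ 2) ≡ n ^ (2 + k)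
  go (suc (suc k)) (s≤s (s≤s z≤n)) = ring n (n ^ k)
    where
    ring : ∀ n q → n * n * (n * n) * q ≡ n * (n * (n * (n * q)))
    ring = solve-∀

2^-cancel : ∀ a b → 2 ^ a ≤ 2 ^ b → a ≤ b
2^-cancel a b le with a ≤? b
... | yes a≤b = a≤b
... | no a≰b  = ⊥-elim (<-irrefl refl (<-≤-trans (^-monoʳ-< 2 (s≤s (s≤s z≤n)) (≰⇒> a≰b)) le))

module _ {n c : ℕ} (θ l : ℕ) (26≤l : 26 ≤ l) (n>0 : 0 < n) where

  private
    k = pow2 (16 * θ)
    ν = n * n
    e = 2 ^ l
    H = 2 ^ n * n ^ k
    T = 2 ^ n * n ^ (2 + k)
    k>0 : 0 < k
    k>0 = pow2>0 (16 * θ)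
    ζ = back-weight n θ
    Pos Neg : (Cube n → Cube n → ℕ) → ℕ
    Pos h = 4 * ν * walkSum k h
    Neg h = e * walkSum (2 + k) h + ζ * walkSum (k ∸ 2) h
    T>0 : 0 < T
    T>0 = *-pos (m^n>0 2 n) (m^n>0 n {{>-nonZero n>0}} (2 + k))
    H>0 : 0 < H
    H>0 = *-pos (m^n>0 2 n) (m^n>0 n {{>-nonZero n>0}} k)
    T≡νH : T ≡ ν * H
    T≡νH = ring n (2 ^ n) (n ^ k)
      where
      ring : ∀ n N q → N * (n * (n * q)) ≡ n * n * (N * q)
      ring = solve-∀

  -- In units of `T`, all k-walks weigh 4 in `Pos` and the rejected ones at most 1; in `Neg` the
  -- accepted (k+2)-walks and the (k-2)-walks weigh at most 1 each. A surplus of 1 remains.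
  accepted-mass : ∀ D (p : Bounded n c) → 32 * e ≤ D →
    D * (ν * walkSum k (reject p) + walkSum (2 + k) (accept p)) ≤ 32 * T →
    Neg (accept p) + T ≤ Pos (accept p)
  accepted-mass D p e≤D err = begin
    Neg (accept p) + T                ≤⟨ +-monoˡ-≤ T (+-mono-≤ eb≤T ζ≤T) ⟩
    T + T + T                         ≤⟨ +-cancelʳ-≤ (4 * ν * a) _ _ (≤-trans (+-monoʳ-≤ (T + T + T) 4νa≤T) (≤-reflexive total)) ⟩
    Pos (accept p)                    ∎
    where
    open ≤-Reasoning
    a = walkSum k (reject p)
    b = walkSum (2 + k) (accept p)
    eb≤T : e * b ≤ T
    eb≤T = cancelˡ 32 (s≤s z≤n) (begin
      32 * (e * b)          ≡⟨ sym (*-assoc 32 e b) ⟩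
      32 * e * b            ≤⟨ *-monoˡ-≤ b e≤D ⟩
      D * b                 ≤⟨ *-monoʳ-≤ D (m≤n+m b (ν * a)) ⟩
      D * (ν * a + b)       ≤⟨ err ⟩
      32 * T                ∎)
    4≤e : 4 ≤ e
    4≤e = ^-monoʳ-≤ 2 {2} {l} (≤-trans (s≤s (s≤s z≤n)) 26≤l)
    4νa≤T : 4 * ν * a ≤ T
    4νa≤T = cancelˡ 32 (s≤s z≤n) (begin
      32 * (4 * ν * a)      ≡⟨ ring 32 4 ν a ⟩
      32 * 4 * (ν * a)      ≤⟨ *-monoˡ-≤ (ν * a) (≤-trans (*-monoʳ-≤ 32 4≤e) e≤D) ⟩
      D * (ν * a)           ≤⟨ *-monoʳ-≤ D (m≤m+n (ν * a) b) ⟩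
      D * (ν * a + b)       ≤⟨ err ⟩
      32 * T                ∎)
      where
      ring : ∀ x y v a → x * (y * v * a) ≡ x * y * (v * a)
      ring = solve-∀
    ζ≤T : ζ * walkSum (k ∸ 2) (accept p) ≤ T
    ζ≤T = begin
      ζ * walkSum (k ∸ 2) (accept p)     ≤⟨ *-monoʳ-≤ ζ (≤-trans (m≤m+n _ (walkSum (k ∸ 2) (reject p))) (≤-reflexive (accept+reject (k ∸ 2) p))) ⟩
      ζ * (2 ^ n * n ^ (k ∸ 2))          ≡⟨ swap ζ (2 ^ n) (n ^ (k ∸ 2)) ⟩
      2 ^ n * (ζ * n ^ (k ∸ 2))          ≤⟨ *-monoʳ-≤ (2 ^ n) (back-weight-bound n θ) ⟩
      T                                  ∎
      where
      swap : ∀ a b c → a * (b * c) ≡ b * (a * c)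
      swap = solve-∀
    total : T + T + T + T ≡ Pos (accept p) + 4 * ν * a
    total = begin-equality
      T + T + T + T                      ≡⟨ cong (λ t → t + t + t + t) T≡νH ⟩
      ν * H + ν * H + ν * H + ν * H      ≡⟨ ring ν H ⟩
      4 * ν * H                          ≡⟨ cong (4 * ν *_) (sym (accept+reject k p)) ⟩
      4 * ν * (walkSum k (accept p) + a) ≡⟨ *-distribˡ-+ (4 * ν) _ a ⟩
      Pos (accept p) + 4 * ν * a         ∎
      where
      ring : ∀ v h → v * h + v * h + v * h + v * h ≡ 4 * v * h
      ring = solve-∀

  -- The surplus `T` bounds G from below by 2^n n^k / (4 * 2^c), and the same inequality yields both
  -- sparsity hypotheses. What `rectangle-bound` then says is a comparison of powers of two.
  exponent-bound : AcceptedRectangle Pos Neg T (1 * 2 ^ c) → (l + 4 * θ) * k ≤ 12 + (c + c) + 4 * k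
  exponent-bound (X , Y , X≤1 , Y≤1 , le) = 2^-cancel ((l + 4 * θ) * k) (12 + (c + c) + 4 * k) (begin
    2 ^ ((l + 4 * θ) * k)          ≡⟨ trans (sym (^-*-assoc 2 (l + 4 * θ) k)) (cong (_^ k) (^-distribˡ-+-* 2 l (4 * θ))) ⟩
    Q                              ≤⟨ cancelʳ (H * H) (*-pos H>0 H>0) cleared ⟩
    2 ^ 12 * (2 ^ c * 2 ^ c) * (2 ^ 4) ^ k
      ≡⟨ cong₂ _*_ (trans (cong (2 ^ 12 *_) (sym (^-distribˡ-+-* 2 c c))) (sym (^-distribˡ-+-* 2 12 (c + c)))) (^-*-assoc 2 4 k) ⟩
    2 ^ (12 + (c + c)) * 2 ^ (4 * k)   ≡⟨ sym (^-distribˡ-+-* 2 (12 + (c + c)) (4 * k)) ⟩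
    2 ^ (12 + (c + c) + 4 * k)     ∎)
    where
    open ≤-Reasoning
    module R = Rectangle X Y X≤1 Y≤1 θ e 8192 128 n>0
    G = ⟨ X , pow k Y ⟩
    G₊ = ⟨ X , pow (2 + k) Y ⟩
    G₋ = ⟨ X , pow (k ∸ 2) Y ⟩
    Q = (e * 2 ^ (4 * θ)) ^ k
    q = 2 ^ c
    q>0 : 0 < q
    q>0 = m^n>0 2 c
    le′ : q * (e * G₊ + ζ * G₋) + T ≤ q * (4 * ν * G)
    le′ = subst₂ _≤_
      (cong₂ (λ s m → s * m + T) (*-identityˡ q)
        (cong₂ (λ a b → e * a + ζ * b) (walkSum-rectangle (2 + k) X Y) (walkSum-rectangle (k ∸ 2) X Y)))
      (cong₂ (λ s m → s * (4 * ν * m)) (*-identityˡ q) (walkSum-rectangle k X Y)) le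
    neg≤ : e * G₊ + ζ * G₋ ≤ 4 * ν * G
    neg≤ = cancelˡ q q>0 (≤-trans (m≤m+n _ T) le′)
    H≤ : H ≤ q * (4 * G)
    H≤ = cancelˡ ν (*-pos n>0 n>0) (begin
      ν * H               ≡⟨ sym T≡νH ⟩
      T                   ≤⟨ m≤n+m T _ ⟩
      _                   ≤⟨ le′ ⟩
      q * (4 * ν * G)     ≡⟨ ring q ν G ⟩
      ν * (q * (4 * G))   ∎)
      where
      ring : ∀ q v g → q * (4 * v * g) ≡ v * (q * (4 * g))
      ring = solve-∀
    G>0 : 0 < G
    G>0 = *-pos⁻¹ʳ 4 (*-pos⁻¹ʳ q (≤-trans H>0 H≤))
    sparse₊ : e * G₊ ≤ 4 * (ν * G)
    sparse₊ = ≤-trans (m≤m+n _ (ζ * G₋)) (≤-trans neg≤ (≤-reflexive (*-assoc 4 ν G)))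
    sparse₋ : 0 < θ → ν * G₋ ≤ 4 * G
    sparse₋ θ>0 = cancelˡ ν (*-pos n>0 n>0) (begin
      ν * (ν * G₋)        ≡⟨ sym (*-assoc ν ν G₋) ⟩
      ν * ν * G₋          ≡⟨ cong (_* G₋) (sym (ζ≡ θ θ>0)) ⟩
      ζ * G₋              ≤⟨ m≤n+m _ (e * G₊) ⟩
      e * G₊ + ζ * G₋     ≤⟨ neg≤ ⟩
      4 * ν * G           ≡⟨ ring ν G ⟩
      ν * (4 * G)         ∎)
      where
      ζ≡ : ∀ θ → 0 < θ → back-weight n θ ≡ ν * ν
      ζ≡ (suc θ) _ = refl
      ring : ∀ v g → 4 * v * g ≡ v * (4 * g)
      ring = solve-∀
    -- With c = 128 the threshold `Λ` is 128 * 64 = 8192 = 2^13, and c * 64 * Λ = 2^26: this is the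
    -- origin of 26 ≤ l.
    large : 128 * 64 * 8192 ≤ e
    large = ≤-trans (≤ᵇ⇒≤ (128 * 64 * 8192) (2 ^ 26) tt) (^-monoʳ-≤ 2 26≤l)
    bound : Q * (G * G) ≤ (16 * 2 ^ n) * (16 * 2 ^ n) * (16 * ν) ^ k
    bound = R.rectangle-bound G>0 sparse₊ sparse₋ refl (≤ᵇ⇒≤ (128 * 64) 8192 tt) large
    cleared : Q * (H * H) ≤ 2 ^ 12 * (q * q) * (2 ^ 4) ^ k * (H * H)
    cleared = begin
      Q * (H * H)                                      ≤⟨ *-monoʳ-≤ Q (*-mono-≤ H≤ H≤) ⟩
      Q * (q * (4 * G) * (q * (4 * G)))                ≡⟨ ring₁ Q q 4 G ⟩
      4 * 4 * (q * q) * (Q * (G * G))                  ≤⟨ *-monoʳ-≤ (4 * 4 * (q * q)) bound ⟩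
      4 * 4 * (q * q) * ((16 * 2 ^ n) * (16 * 2 ^ n) * (16 * ν) ^ k)
        ≡⟨ cong (λ m → 4 * 4 * (q * q) * ((16 * 2 ^ n) * (16 * 2 ^ n) * m)) (trans (*-^ 16 ν k) (cong (16 ^ k *_) (*-^ n n k))) ⟩
      4 * 4 * (q * q) * ((16 * 2 ^ n) * (16 * 2 ^ n) * (16 ^ k * (n ^ k * n ^ k)))
        ≡⟨ ring₂ 4 16 (q * q) (2 ^ n) (16 ^ k) (n ^ k) ⟩
      4 * 4 * (16 * 16) * (q * q) * 16 ^ k * (H * H)   ∎
      where
      ring₁ : ∀ Q q f G → Q * (q * (f * G) * (q * (f * G))) ≡ f * f * (q * q) * (Q * (G * G))
      ring₁ = solve-∀
      ring₂ : ∀ f s q N r m → f * f * q * ((s * N) * (s * N) * (r * (m * m))) ≡ f * f * (s * s) * q * r * ((N * m) * (N * m))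
      ring₂ = solve-∀

  cost-bound : ∀ D (ps : List (Bounded n c)) → Correct D k ps → 0 < size ps → 32 * e ≤ D →
    k * k * D ≤ 2 * n → k * (l + 4 * θ) ≤ 6 * c
  cost-bound D ps correct ps>0 e≤D close = finish (exponent-bound found)
    where
    open ≤-Reasoning
    chosen = accurate-protocol D k ps correct ps>0 n>0 k>0 close
    p = proj₁ chosen
    pos = walkSum-additive {n} k (4 * ν)
    neg = +-additive (walkSum-additive {n} (2 + k) e) (walkSum-additive {n} (k ∸ 2) ζ)
    one : ∀ x y → accept p x y ≡ 1 * 1 * accept p x y
    one x y = sym (+-identityʳ (accept p x y))
    found : AcceptedRectangle Pos Neg T (1 * 2 ^ c)
    found = rectangle Pos Neg pos neg T T>0 p (λ _ → 1) (λ _ → 1) (λ _ → ≤-refl) (λ _ → ≤-refl) 1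
      (subst₂ (λ a b → a + T ≤ b)
        (trans (Additive.Φ-cong neg one) (sym (*-identityˡ _)))
        (trans (Additive.Φ-cong pos one) (sym (*-identityˡ _)))
        (accepted-mass D p e≤D (proj₂ chosen)))
    w = l + 4 * θ
    -- Tripling the inequality absorbs 12 and 4k, which triple to at most 48k, because w is at least
    -- 26.
    finish : w * k ≤ 12 + (c + c) + 4 * k → k * w ≤ 6 * c
    finish le = +-cancelʳ-≤ (48 * k) _ _ (begin
      k * w + 48 * k                    ≤⟨ +-monoʳ-≤ (k * w) (*-monoˡ-≤ k (≤-trans (m≤m+n 48 4) (*-monoʳ-≤ 2 (≤-trans 26≤l (m≤m+n l (4 * θ)))))) ⟩
      k * w + 2 * w * k                 ≡⟨ ring₁ k w ⟩
      3 * (w * k)                       ≤⟨ *-monoʳ-≤ 3 le ⟩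
      3 * (12 + (c + c) + 4 * k)        ≤⟨ *-monoʳ-≤ 3 (+-monoˡ-≤ (4 * k) (+-monoˡ-≤ (c + c) (*-monoʳ-≤ 12 k>0))) ⟩
      3 * (12 * k + (c + c) + 4 * k)    ≡⟨ ring₂ k c ⟩
      6 * c + 48 * k                    ∎)
      where
      ring₁ : ∀ k w → k * w + 2 * w * k ≡ 3 * (w * k)
      ring₁ = solve-∀
      ring₂ : ∀ k c → 3 * (12 * k + (c + c) + 4 * k) ≡ 6 * c + 48 * k
      ring₂ = solve-∀

-- Truncating protocols and lowering k by padding.

-- A tree may have branches deeper than c that no input follows; under the hypothesis of
-- `out-truncate` the `leaf false` that cuts them off is never reached.
truncate : ∀ {n} c → Protocol (Cube n) (Cube n) → Bounded n c
truncate c       (leaf o)      = leaf o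
truncate zero    (alice f l r) = leaf false
truncate zero    (bob g l r)   = leaf false
truncate (suc c) (alice f l r) = alice f (truncate c l) (truncate c r)
truncate (suc c) (bob g l r)   = bob g (truncate c l) (truncate c r)

out-truncate : ∀ {n} c (p : Protocol (Cube n) (Cube n)) x y → bitsOn p x y ≤ c → out (truncate c p) x y ≡ run p x y
out-truncate c       (leaf o)      x y le = refl
out-truncate (suc c) (alice f l r) x y (s≤s le) with f x
... | true  = out-truncate c l x y le
... | false = out-truncate c r x y le
out-truncate (suc c) (bob g l r)   x y (s≤s le) with g y
... | true  = out-truncate c l x y le
... | false = out-truncate c r x y le

-- Fixing the first coordinate to differ turns a protocol for distance k + 1 into one for distance k.
pad : ∀ {n c} → Bounded (suc n) c → Bounded n c
pad (leaf o)      = leaf o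
pad (alice f l r) = alice (λ x → f (true ∷ x)) (pad l) (pad r)
pad (bob g l r)   = bob (λ y → g (false ∷ y)) (pad l) (pad r)

out-pad : ∀ {n c} (p : Bounded (suc n) c) x y → out (pad p) x y ≡ out p (true ∷ x) (false ∷ y)
out-pad (leaf o)      x y = refl
out-pad (alice f l r) x y rewrite out-pad l x y | out-pad r x y = refl
out-pad (bob g l r)   x y rewrite out-pad l x y | out-pad r x y = refl

sumL-map : ∀ {A B : Set} (ps : List A) (h : A → B) (f : B → ℕ) → sumL (map h ps) f ≡ sumL ps (λ p → f (h p))
sumL-map []       h f = refl
sumL-map (p ∷ ps) h f = cong (f (h p) +_) (sumL-map ps h f)

pad-correct : ∀ {n c} D k (ps : List (Bounded (suc n) c)) → Correct D (suc k) ps → Correct D k (map pad ps)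
pad-correct D k ps correct x y =
  (λ eq → subst₂ (λ a b → D * a ≤ b) (same not) (sym (sumL-map ps pad (λ _ → 1))) (proj₁ (correct (true ∷ x) (false ∷ y)) (cong suc eq))) ,
  (λ eq → subst₂ (λ a b → D * a ≤ b) (same (λ b → b)) (sym (sumL-map ps pad (λ _ → 1))) (proj₂ (correct (true ∷ x) (false ∷ y)) (cong suc eq)))
  where
  same : ∀ (ψ : Bool → Bool) → sumL ps (λ p → ⟦ ψ (out p (true ∷ x) (false ∷ y)) ⟧) ≡ sumL (map pad ps) (λ p → ⟦ ψ (out p x y) ⟧)
  same ψ = go ps
    where
    go : ∀ ps → sumL ps (λ p → ⟦ ψ (out p (true ∷ x) (false ∷ y)) ⟧) ≡ sumL (map pad ps) (λ p → ⟦ ψ (out p x y) ⟧)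
    go []       = refl
    go (p ∷ ps) = cong₂ _+_ (cong (λ b → ⟦ ψ b ⟧) (sym (out-pad p x y))) (go ps)

Solvable : ℕ → ℕ → ℕ → ℕ → Set
Solvable n c D k = Σ (List (Bounded n c)) λ ps → 0 < size ps × Correct D k ps

shrink : ∀ d n c D k → Solvable (d + n) c D (d + k) → Solvable n c D k
shrink zero    n c D k s = s
shrink (suc d) n c D k (ps , ps>0 , correct) =
  shrink d n c D k (map pad ps , subst (0 <_) (sym (sumL-map ps pad (λ _ → 1))) ps>0 , pad-correct D (d + k) ps correct)

-- Amplification by majority votes.

lift : ∀ {n c d} → c ≤ d → Bounded n c → Bounded n d
lift le       (leaf o)      = leaf o
lift (s≤s le) (alice f l r) = alice f (lift le l) (lift le r)
lift (s≤s le) (bob g l r)   = bob g (lift le l) (lift le r)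

out-lift : ∀ {n c d} (le : c ≤ d) (p : Bounded n c) x y → out (lift le p) x y ≡ out p x y
out-lift le       (leaf o)      x y = refl
out-lift (s≤s le) (alice f l r) x y rewrite out-lift le l x y | out-lift le r x y = refl
out-lift (s≤s le) (bob g l r)   x y rewrite out-lift le l x y | out-lift le r x y = refl

infixl 1 _>>=_
_>>=_ : ∀ {n c d} → Bounded n c → (Bool → Bounded n d) → Bounded n (c + d)
_>>=_ {c = c} {d} (leaf o) q = lift (m≤n+m d c) (q o)
alice f l r >>= q = alice f (l >>= q) (r >>= q)
bob g l r   >>= q = bob g (l >>= q) (r >>= q)

out->>= : ∀ {n c d} (p : Bounded n c) (q : Bool → Bounded n d) x y → out (p >>= q) x y ≡ out (q (out p x y)) x y
out->>= {c = c} {d} (leaf o) q x y = out-lift (m≤n+m d c) (q o) x y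
out->>= (alice f l r) q x y with f x
... | true  = out->>= l q x y
... | false = out->>= r q x y
out->>= (bob g l r) q x y with g y
... | true  = out->>= l q x y
... | false = out->>= r q x y

maj : Bool → Bool → Bool → Bool
maj a b c = if a then b ∨ c else b ∧ c

majority : ∀ {n c} → Bounded n c → Bounded n c → Bounded n c → Bounded n (c + (c + (c + 0)))
majority p q r = p >>= λ a → q >>= λ b → r >>= λ c → leaf (maj a b c)

out-majority : ∀ {n c} (p q r : Bounded n c) x y → out (majority p q r) x y ≡ maj (out p x y) (out q x y) (out r x y)
out-majority p q r x y = trans (out->>= p _ x y) (trans (out->>= q _ x y) (out->>= r _ x y))

-- All ordered triples are listed, so one uniform choice from the list amounts to three independent
-- runs.
amplify : ∀ {n c} → List (Bounded n c) → List (Bounded n (c + (c + (c + 0))))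
amplify ps = concatMap (λ p → concatMap (λ q → map (majority p q) ps) ps) ps

sumL-++ : ∀ {A : Set} (ps qs : List A) f → sumL (ps ++ qs) f ≡ sumL ps f + sumL qs f
sumL-++ []       qs f = refl
sumL-++ (p ∷ ps) qs f = trans (cong (f p +_) (sumL-++ ps qs f)) (sym (+-assoc (f p) _ _))

sumL-concatMap : ∀ {A B : Set} (ps : List A) (h : A → List B) (f : B → ℕ) →
                 sumL (concatMap h ps) f ≡ sumL ps (λ p → sumL (h p) f)
sumL-concatMap []       h f = refl
sumL-concatMap (p ∷ ps) h f = trans (sumL-++ (h p) (concatMap h ps) f) (cong (sumL (h p) f +_) (sumL-concatMap ps h f))

sumL-amplify : ∀ {n c} (ps : List (Bounded n c)) f →
               sumL (amplify ps) f ≡ sumL ps (λ p → sumL ps (λ q → sumL ps (λ r → f (majority p q r))))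
sumL-amplify ps f = trans (sumL-concatMap ps _ f) (sumL-cong ps (λ p →
  trans (sumL-concatMap ps _ f) (sumL-cong ps (λ q → sumL-map ps (majority p q) f))))

sumL-const : ∀ {A : Set} (ps : List A) c → sumL ps (λ _ → c) ≡ size ps * c
sumL-const []       c = refl
sumL-const (p ∷ ps) c = cong (c +_) (sumL-const ps c)

size-amplify : ∀ {n c} (ps : List (Bounded n c)) → size (amplify ps) ≡ size ps * (size ps * size ps)
size-amplify ps = trans (sumL-amplify ps (λ _ → 1)) (trans (sumL-cong ps (λ p → sumL-const ps (size ps))) (sumL-const ps _))

-- Sums out one of the three runs at a time: the majority indicator is affine in each run when the
-- other two are fixed.
sumL-affine : ∀ {A : Set} (ps : List A) (f w : A → ℕ) a b c → (∀ p → f p + a * w p ≡ b + c * w p) →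
              sumL ps f + a * sumL ps w ≡ size ps * b + c * sumL ps w
sumL-affine []       f w a b c eq = trans (*-zeroʳ a) (sym (*-zeroʳ c))
sumL-affine (p ∷ ps) f w a b c eq = trans (ring₁ (f p) a (w p) (sumL ps f) (sumL ps w))
  (trans (cong₂ _+_ (eq p) (sumL-affine ps f w a b c eq)) (ring₂ b c (w p) (size ps) (sumL ps w)))
  where
  ring₁ : ∀ f a w F W → f + F + a * (w + W) ≡ (f + a * w) + (F + a * W)
  ring₁ = solve-∀
  ring₂ : ∀ b c w s W → (b + c * w) + (s * b + c * W) ≡ (1 + s) * b + c * (w + W)
  ring₂ = solve-∀

-- The identity maj = ab + bc + ca - 2abc for values 0 and 1, with the subtraction moved to the left
-- and arranged to be affine in the last run.
IndicatorOfMajority : (Bool → ℕ) → Set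
IndicatorOfMajority ψ = ∀ a b c → ψ (maj a b c) + 2 * (ψ a * ψ b) * ψ c ≡ ψ a * ψ b + (ψ a + ψ b) * ψ c

accept-majority : IndicatorOfMajority ⟦_⟧
accept-majority true  true  true  = refl
accept-majority true  true  false = refl
accept-majority true  false true  = refl
accept-majority true  false false = refl
accept-majority false true  true  = refl
accept-majority false true  false = refl
accept-majority false false true  = refl
accept-majority false false false = refl

reject-majority : IndicatorOfMajority (λ b → ⟦ not b ⟧)
reject-majority true  true  true  = refl
reject-majority true  true  false = refl
reject-majority true  false true  = refl
reject-majority true  false false = refl
reject-majority false true  true  = refl
reject-majority false true  false = refl
reject-majority false false true  = refl
reject-majority false false false = refl

module _ {n c} (ps : List (Bounded n c)) (ψ : Bool → ℕ) (maj-ψ : IndicatorOfMajority ψ) (x y : Cube n) where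

  private
    M = size ps
    w : Bounded n c → ℕ
    w p = ψ (out p x y)
    E = sumL ps w
    E′ = sumL (amplify ps) (λ p → ψ (out p x y))

  amplified-errors : E′ + 2 * (E * E) * E ≡ 3 * (M * (E * E))
  amplified-errors = trans (cong (_+ 2 * (E * E) * E) (sumL-amplify ps (λ p → ψ (out p x y))))
    (trans (sumL-affine ps I₂ w (2 * (E * E)) (E * E) (2 * (M * E)) outer) (ring M E))
    where
    I₁ : Bounded n c → Bounded n c → ℕ
    I₁ p q = sumL ps (λ r → ψ (out (majority p q r) x y))
    I₂ : Bounded n c → ℕ
    I₂ p = sumL ps (I₁ p)
    ring : ∀ M E → M * (E * E) + 2 * (M * E) * E ≡ 3 * (M * (E * E))
    ring = solve-∀
    inner : ∀ p q → I₁ p q + 2 * (w p * w q) * E ≡ M * (w p * w q) + (w p + w q) * E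
    inner p q = sumL-affine ps _ w (2 * (w p * w q)) (w p * w q) (w p + w q) (λ r →
      trans (cong (λ b → ψ b + 2 * (w p * w q) * w r) (out-majority p q r x y)) (maj-ψ (out p x y) (out q x y) (out r x y)))
    middle : ∀ p → I₂ p + 2 * (w p * E) * E ≡ M * (w p * E) + (M * w p + E) * E
    middle p = sumL-affine ps (I₁ p) w (2 * (w p * E)) (w p * E) (M * w p + E) (λ q →
      trans (cong (I₁ p q +_) (ring₁ (w p) (w q) E)) (trans (inner p q) (ring₂ (w p) (w q) E M)))
      where
      ring₁ : ∀ a b E → 2 * (a * E) * b ≡ 2 * (a * b) * E
      ring₁ = solve-∀
      ring₂ : ∀ a b E M → M * (a * b) + (a + b) * E ≡ a * E + (M * a + E) * b
      ring₂ = solve-∀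
    outer : ∀ p → I₂ p + 2 * (E * E) * w p ≡ E * E + 2 * (M * E) * w p
    outer p = trans (cong (I₂ p +_) (ring₁ (w p) E)) (trans (middle p) (ring₂ (w p) E M))
      where
      ring₁ : ∀ a E → 2 * (E * E) * a ≡ 2 * (a * E) * E
      ring₁ = solve-∀
      ring₂ : ∀ a E M → M * (a * E) + (M * a + E) * E ≡ E * E + 2 * (M * E) * a
      ring₂ = solve-∀

  -- An error x ≤ 1/3 drops to 3x² - 2x³ ≤ 7/27. The cubic term is essential in this round, since
  -- 3x² has the fixed point 1/3.
  amplify-first : 3 * E ≤ M → 3 * E′ * 9 ≤ 7 * size (amplify ps)
  amplify-first 3E≤M = +-cancelʳ-≤ (27 * (2 * (E * E) * E)) _ _ (begin
    3 * E′ * 9 + 27 * (2 * (E * E) * E)         ≡⟨ ring₁ E′ (2 * (E * E) * E) ⟩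
    27 * (E′ + 2 * (E * E) * E)                 ≡⟨ cong (27 *_) amplified-errors ⟩
    27 * (3 * (M * (E * E)))                    ≤⟨ subst (λ M → 27 * (3 * (M * (E * E))) ≤ 7 * (M * (M * M)) + 27 * (2 * (E * E) * E))
                                                     (m+[n∸m]≡n 3E≤M) cubic ⟩
    7 * (M * (M * M)) + 27 * (2 * (E * E) * E)  ≡⟨ cong (λ s → 7 * s + 27 * (2 * (E * E) * E)) (sym (size-amplify ps)) ⟩
    7 * size (amplify ps) + 27 * (2 * (E * E) * E) ∎)
    where
    open ≤-Reasoning
    ring₁ : ∀ a b → 3 * a * 9 + 27 * b ≡ 27 * (a + b)
    ring₁ = solve-∀
    -- After the substitution M = 3E + v the difference of the two sides has nonnegative
    -- coefficients.
    v = M ∸ 3 * E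
    ring₂ : ∀ E v → 27 * (3 * ((3 * E + v) * (E * E))) + (108 * (E * E * v) + 63 * (E * v * v) + 7 * (v * v * v)) ≡
                    7 * ((3 * E + v) * ((3 * E + v) * (3 * E + v))) + 27 * (2 * (E * E) * E)
    ring₂ = solve-∀
    cubic : 27 * (3 * ((3 * E + v) * (E * E))) ≤ 7 * ((3 * E + v) * ((3 * E + v) * (3 * E + v))) + 27 * (2 * (E * E) * E)
    cubic = ≤-trans (m≤m+n _ (108 * (E * E * v) + 63 * (E * v * v) + 7 * (v * v * v))) (≤-reflexive (ring₂ E v))

  -- Dropping the cubic term gives 3x′ ≤ (3x)², so that the bound t/u on three times the error is
  -- squared in every round.
  amplify-next : ∀ u t → 3 * E * u ≤ t * M → 3 * E′ * (u * u) ≤ t * t * size (amplify ps)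
  amplify-next u t le = begin
    3 * E′ * (u * u)                      ≤⟨ *-monoˡ-≤ (u * u) (*-monoʳ-≤ 3 (≤-trans (m≤m+n E′ _) (≤-reflexive amplified-errors))) ⟩
    3 * (3 * (M * (E * E))) * (u * u)     ≡⟨ ring₁ M E u ⟩
    M * ((3 * E * u) * (3 * E * u))       ≤⟨ *-monoʳ-≤ M (*-mono-≤ le le) ⟩
    M * ((t * M) * (t * M))               ≡⟨ ring₂ M t ⟩
    t * t * (M * (M * M))                 ≡⟨ cong (t * t *_) (sym (size-amplify ps)) ⟩
    t * t * size (amplify ps)             ∎
    where
    open ≤-Reasoning
    ring₁ : ∀ M E u → 3 * (3 * (M * (E * E))) * (u * u) ≡ M * ((3 * E * u) * (3 * E * u))
    ring₁ = solve-∀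
    ring₂ : ∀ M t → M * ((t * M) * (t * M)) ≡ t * t * (M * (M * M))
    ring₂ = solve-∀

Amplified : ∀ {n c} → ℕ → ℕ → ℕ → List (Bounded n c) → Set
Amplified u t k ps = ∀ x y →
  (ham x y ≡ k     → 3 * sumL ps (λ p → ⟦ not (out p x y) ⟧) * u ≤ t * size ps) ×
  (ham x y ≡ 2 + k → 3 * sumL ps (λ p → ⟦ out p x y ⟧) * u ≤ t * size ps)

amplify-size>0 : ∀ {n c} (ps : List (Bounded n c)) → 0 < size ps → 0 < size (amplify ps)
amplify-size>0 ps ps>0 = subst (0 <_) (sym (size-amplify ps)) (*-pos ps>0 (*-pos ps>0 ps>0))

amplify-iterate : ∀ n c k → Solvable n c 3 k → ∀ j →
  Σ (List (Bounded n (3 ^ suc j * c))) λ ps → 0 < size ps × Amplified (9 ^ pow2 j) (7 ^ pow2 j) k ps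
amplify-iterate n c k (ps , ps>0 , correct) zero =
  subst (λ m → Σ (List (Bounded n m)) λ ps → 0 < size ps × Amplified 9 7 k ps) (ring c)
    (amplify ps , amplify-size>0 ps ps>0 , λ x y →
      (λ eq → amplify-first ps (λ b → ⟦ not b ⟧) reject-majority x y (proj₁ (correct x y) eq)) ,
      (λ eq → amplify-first ps ⟦_⟧ accept-majority x y (proj₂ (correct x y) eq)))
  where
  ring : ∀ c → c + (c + (c + 0)) ≡ 3 * 1 * c
  ring = solve-∀
amplify-iterate n c k s (suc j) = next (amplify-iterate n c k s j)
  where
  next : (Σ (List (Bounded n (3 ^ suc j * c))) λ ps → 0 < size ps × Amplified (9 ^ pow2 j) (7 ^ pow2 j) k ps) →
         Σ (List (Bounded n (3 ^ suc (suc j) * c))) λ ps → 0 < size ps × Amplified (9 ^ pow2 (suc j)) (7 ^ pow2 (suc j)) k ps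
  next (ps , ps>0 , amp) = subst (λ m → Σ (List (Bounded n m)) λ ps → 0 < size ps × Amplified (9 ^ pow2 (suc j)) (7 ^ pow2 (suc j)) k ps)
    (ring (3 ^ suc j) c)
    (amplify ps , amplify-size>0 ps ps>0 , subst₂ (λ u t → Amplified u t k (amplify ps))
      (sym (^-distribˡ-+-* 9 (pow2 j) (pow2 j))) (sym (^-distribˡ-+-* 7 (pow2 j) (pow2 j))) (λ x y →
        (λ eq → amplify-next ps (λ b → ⟦ not b ⟧) reject-majority x y (9 ^ pow2 j) (7 ^ pow2 j) (proj₁ (amp x y) eq)) ,
        (λ eq → amplify-next ps ⟦_⟧ accept-majority x y (9 ^ pow2 j) (7 ^ pow2 j) (proj₂ (amp x y) eq))))
    where
    ring : ∀ q c → q * c + (q * c + (q * c + 0)) ≡ 3 * q * c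
    ring = solve-∀

amplified-correct : ∀ {n c} u t D k (ps : List (Bounded n c)) → 0 < t → D * t ≤ 3 * u → Amplified u t k ps → Correct D k ps
amplified-correct u t D k ps t>0 le amp x y = (λ eq → clear _ (proj₁ (amp x y) eq)) , (λ eq → clear _ (proj₂ (amp x y) eq))
  where
  open ≤-Reasoning
  clear : ∀ E → 3 * E * u ≤ t * size ps → D * E ≤ size ps
  clear E h = cancelˡ t t>0 (begin
    t * (D * E)     ≡⟨ ring₁ t D E ⟩
    E * (D * t)     ≤⟨ *-monoʳ-≤ E le ⟩
    E * (3 * u)     ≡⟨ ring₂ E u ⟩
    3 * E * u       ≤⟨ h ⟩
    t * size ps     ∎)
    where
    ring₁ : ∀ t D E → t * (D * E) ≡ E * (D * t)
    ring₁ = solve-∀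
    ring₂ : ∀ E u → E * (3 * u) ≡ 3 * E * u
    ring₂ = solve-∀

boost : ∀ n c k j D → D * 7 ^ pow2 j ≤ 3 * 9 ^ pow2 j → Solvable n c 3 k → Solvable n (3 ^ suc j * c) D k
boost n c k j D le s = finish (amplify-iterate n c k s j)
  where
  finish : (Σ (List (Bounded n (3 ^ suc j * c))) λ ps → 0 < size ps × Amplified (9 ^ pow2 j) (7 ^ pow2 j) k ps) →
           Solvable n (3 ^ suc j * c) D k
  finish (ps , ps>0 , amp) = ps , ps>0 , amplified-correct (9 ^ pow2 j) (7 ^ pow2 j) D k ps (m^n>0 7 (pow2 j)) le amp

-- Arbitrary k and arbitrary error.

bracket : ∀ m → 0 < m → Σ ℕ λ t → 2 ^ t ≤ m × m < 2 ^ suc t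
bracket 1 _ = 0 , ≤-refl , s≤s (s≤s z≤n)
bracket (suc m@(suc _)) _ = next (bracket m (s≤s z≤n))
  where
  next : (Σ ℕ λ t → 2 ^ t ≤ m × m < 2 ^ suc t) → Σ ℕ λ t → 2 ^ t ≤ suc m × suc m < 2 ^ suc t
  next (t , lo , hi) with suc m <? 2 ^ suc t
  ... | yes lt = t , m≤n⇒m≤1+n lo , lt
  ... | no  ge = suc t , ≮⇒≥ ge , ≤-<-trans hi (^-monoʳ-< 2 (s≤s (s≤s z≤n)) (n<1+n (suc t)))

-- The search is built for k = 2^(16θ); rounding k down to this form costs at most a factor 2^16.
bracket₁₆ : ∀ k → 0 < k → Σ ℕ λ θ → pow2 (16 * θ) ≤ k × k ≤ 2 ^ (16 + 16 * θ)
bracket₁₆ k k>0 = coarsen (bracket k k>0)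
  where
  open ≤-Reasoning
  coarsen : (Σ ℕ λ t → 2 ^ t ≤ k × k < 2 ^ suc t) → Σ ℕ λ θ → pow2 (16 * θ) ≤ k × k ≤ 2 ^ (16 + 16 * θ)
  coarsen (t , lo , hi) = t / 16 ,
    ≤-trans (≤-reflexive (pow2≡2^ (16 * (t / 16)))) (≤-trans (^-monoʳ-≤ 2 (≤-trans (≤-reflexive (*-comm 16 (t / 16))) (m/n*n≤m t 16))) lo) ,
    ≤-trans (<⇒≤ hi) (^-monoʳ-≤ 2 (begin
      suc t                          ≡⟨ cong suc (m≡m%n+[m/n]*n t 16) ⟩
      suc (t % 16) + t / 16 * 16     ≤⟨ +-mono-≤ (m%n<n t 16) (≤-reflexive (*-comm (t / 16) 16)) ⟩
      16 + 16 * (t / 16)             ∎))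

-- Fixing d = k - k′ coordinates uses up at most half of the dimension because 2k ≤ n; the factor 2
-- in the condition `k * k * D ≤ 2 * n` of `cost-bound` pays for that.
padded-bound : ∀ n c D k θ l → pow2 (16 * θ) ≤ k → Solvable n c D k → 26 ≤ l → 32 * 2 ^ l ≤ D →
  pow2 (16 * θ) * pow2 (16 * θ) * D ≤ n → 2 * k ≤ n → 0 < k → pow2 (16 * θ) * (l + 4 * θ) ≤ 6 * c
padded-bound n c D k θ l k′≤k s 26≤l e≤D close 2k≤n k>0 = apply (shrink d n′ c D k′ (subst₂ (λ n k → Solvable n c D k) n≡ k≡ s))
  where
  open ≤-Reasoning
  k′ = pow2 (16 * θ)
  d = k ∸ k′
  n′ = n ∸ d
  d≤k : d ≤ k
  d≤k = m∸n≤m k k′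
  k≤n : k ≤ n
  k≤n = ≤-trans (m≤m+n k (k + 0)) 2k≤n
  n≡ : n ≡ d + n′
  n≡ = sym (m+[n∸m]≡n (≤-trans d≤k k≤n))
  k≡ : k ≡ d + k′
  k≡ = sym (m∸n+n≡m k′≤k)
  k≤n′ : k ≤ n′
  k≤n′ = +-cancelˡ-≤ d _ _ (begin
    d + k          ≤⟨ +-monoˡ-≤ k d≤k ⟩
    k + k          ≡⟨ cong (k +_) (sym (+-identityʳ k)) ⟩
    2 * k          ≤⟨ 2k≤n ⟩
    n              ≡⟨ n≡ ⟩
    d + n′         ∎)
  n≤2n′ : n ≤ 2 * n′
  n≤2n′ = begin
    n              ≡⟨ n≡ ⟩
    d + n′         ≤⟨ +-monoˡ-≤ n′ (≤-trans d≤k k≤n′) ⟩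
    n′ + n′        ≡⟨ cong (n′ +_) (sym (+-identityʳ n′)) ⟩
    2 * n′         ∎
  apply : Solvable n′ c D k′ → k′ * (l + 4 * θ) ≤ 6 * c
  apply (ps , ps>0 , correct) = cost-bound θ l 26≤l (≤-trans k>0 k≤n′) D ps correct ps>0 e≤D (≤-trans close n≤2n′)

scale : ∀ {k k′ w c c′ lg} s u → k ≤ s * k′ → k′ * w ≤ 6 * c′ → c′ ≤ u * c → lg ≤ 4 * w → k * lg ≤ s * 4 * 6 * u * c
scale {k} {k′} {w} {c} {c′} {lg} s u k≤ w≤ c′≤ lg≤ = begin
  k * lg                   ≤⟨ *-mono-≤ k≤ lg≤ ⟩
  s * k′ * (4 * w)         ≡⟨ ring₁ s k′ 4 w ⟩
  s * 4 * (k′ * w)         ≤⟨ *-monoʳ-≤ (s * 4) w≤ ⟩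
  s * 4 * (6 * c′)         ≤⟨ *-monoʳ-≤ (s * 4) (*-monoʳ-≤ 6 c′≤) ⟩
  s * 4 * (6 * (u * c))    ≡⟨ ring₂ (s * 4) 6 u c ⟩
  s * 4 * 6 * u * c        ∎
  where
  open ≤-Reasoning
  ring₁ : ∀ s k f w → s * k * (f * w) ≡ s * f * (k * w)
  ring₁ = solve-∀
  ring₂ : ∀ a b u c → a * (b * (u * c)) ≡ a * b * u * c
  ring₂ = solve-∀

-- For m ≥ 1 this encodes lg ≤ ⌈log₂ m⌉ in terms of powers of two only.
LogBound : ℕ → ℕ → Set
LogBound m lg = ∀ E → m ≤ 2 ^ E → lg ≤ E

product-exponent : ∀ k D s t → k ≤ 2 ^ s → D ≤ 2 ^ t → 2 * (k * D) ≤ 2 ^ suc (s + t)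
product-exponent k D s t k≤ D≤ = *-monoʳ-≤ 2 (≤-trans (*-mono-≤ k≤ D≤) (≤-reflexive (sym (^-distribˡ-+-* 2 s t))))

k*k≥k : ∀ k → 0 < k → k ≤ k * k
k*k≥k k k>0 = m≤m*n k k {{>-nonZero k>0}}

weaken : ∀ {n c D k} → 3 ≤ D → Solvable n c D k → Solvable n c 3 k
weaken 3≤D (ps , ps>0 , correct) = ps , ps>0 , λ x y →
  (λ eq → ≤-trans (*-monoˡ-≤ _ 3≤D) (proj₁ (correct x y) eq)) ,
  (λ eq → ≤-trans (*-monoˡ-≤ _ 3≤D) (proj₂ (correct x y) eq))

at-distance : ∀ n t → t ≤ n → Σ (Cube n) λ x → Σ (Cube n) λ y → ham x y ≡ t
at-distance zero    zero    z≤n = [] , [] , refl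
at-distance (suc n) zero    z≤n with at-distance n zero z≤n
... | x , y , eq = true ∷ x , true ∷ y , eq
at-distance (suc n) (suc t) (s≤s le) with at-distance n t le
... | x , y , eq = true ∷ x , false ∷ y , cong suc eq

silent : ∀ {n} (p : Bounded n 0) x y x′ y′ → out p x y ≡ out p x′ y′
silent (leaf o) x y x′ y′ = refl

-- Without communication the answer depends on the random string alone, so the error probabilities
-- at distances k and k + 2 add up to 1, although each is at most 1/3. For bounded k this is all
-- that the lower bound asks for.
communication-needed : ∀ n c D k → Solvable n c D k → 3 ≤ D → 2 + k ≤ n → 0 < c
communication-needed n (suc c) D k s 3≤D le = s≤s z≤n
communication-needed n zero    D k (ps , ps>0 , correct) 3≤D le =
  contradict (at-distance n k (≤-trans (m≤n+m k 2) le)) (at-distance n (2 + k) le)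
  where
  open ≤-Reasoning
  M = size ps
  contradict : (Σ (Cube n) λ x → Σ (Cube n) λ y → ham x y ≡ k) → (Σ (Cube n) λ x → Σ (Cube n) λ y → ham x y ≡ 2 + k) → 0 < 0
  contradict (x , y , near) (x′ , y′ , far) = ⊥-elim (<-irrefl refl (begin-strict
    M + M                       <⟨ m<m+n (M + M) ps>0 ⟩
    M + M + M                   ≡⟨ ring M ⟩
    3 * M                       ≤⟨ *-monoˡ-≤ M 3≤D ⟩
    D * M                       ≡⟨ cong (D *_) (trans (sumL-cong ps both) (sumL-plus ps)) ⟩
    D * (rej + acc′)            ≡⟨ *-distribˡ-+ D rej acc′ ⟩
    D * rej + D * acc′          ≤⟨ +-mono-≤ (proj₁ (correct x y) near) (proj₂ (correct x′ y′) far) ⟩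
    M + M                       ∎))
    where
    rej = sumL ps (λ p → ⟦ not (out p x y) ⟧)
    acc′ = sumL ps (λ p → ⟦ out p x′ y′ ⟧)
    ring : ∀ M → M + M + M ≡ 3 * M
    ring = solve-∀
    both : ∀ p → 1 ≡ ⟦ not (out p x y) ⟧ + ⟦ out p x′ y′ ⟧
    both p rewrite silent p x y x′ y′ = one (out p x′ y′)
      where
      one : ∀ b → 1 ≡ ⟦ not b ⟧ + ⟦ b ⟧
      one true  = refl
      one false = refl
    sumL-plus : ∀ ps → sumL ps (λ p → ⟦ not (out p x y) ⟧ + ⟦ out p x′ y′ ⟧) ≡
                       sumL ps (λ p → ⟦ not (out p x y) ⟧) + sumL ps (λ p → ⟦ out p x′ y′ ⟧)
    sumL-plus []       = refl
    sumL-plus (p ∷ ps) = trans (cong (⟦ not (out p x y) ⟧ + ⟦ out p x′ y′ ⟧ +_) (sumL-plus ps)) (interchange ⟦ not (out p x y) ⟧ _ _ _)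

2^-cancel-< : ∀ a b → 2 ^ a < 2 ^ b → a < b
2^-cancel-< a b lt with a <? b
... | yes a<b = a<b
... | no  a≮b = ⊥-elim (<-irrefl refl (<-≤-trans lt (^-monoʳ-≤ 2 (≮⇒≥ a≮b))))

-- The exponents 16 and 31 are variables so that the powers of two are never evaluated.
module _ (s t₀ : ℕ) (s≡16 : s ≡ 16) (t₀≡31 : t₀ ≡ 31)
         (n c D k lg : ℕ) (k>0 : 0 < k) (3≤D : 3 ≤ D) (close : k * k * D < n)
         (solvable : Solvable n c D k) (logBound : LogBound (2 * (k * D)) lg) where

  private
    3k≤n : 3 * k ≤ n
    3k≤n = ≤-trans (≤-trans (≤-reflexive (*-comm 3 k)) (*-mono-≤ (k*k≥k k k>0) 3≤D)) (<⇒≤ close)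
    2k≤n : 2 * k ≤ n
    2k≤n = ≤-trans (*-monoˡ-≤ k (n≤1+n 2)) 3k≤n
    k′*k′*D : ∀ k′ → k′ ≤ k → k′ * k′ * D ≤ n
    k′*k′*D k′ le = ≤-trans (*-monoˡ-≤ D (*-mono-≤ le le)) (<⇒≤ close)
    Block = Σ ℕ λ θ → pow2 (16 * θ) ≤ k × k ≤ 2 ^ (s + 16 * θ)
    block : Block
    block = subst (λ s → Σ ℕ λ θ → pow2 (16 * θ) ≤ k × k ≤ 2 ^ (s + 16 * θ)) (sym s≡16) (bracket₁₆ k k>0)
    2^[a+16θ] : ∀ a θ → 2 ^ (a + 16 * θ) ≡ 2 ^ a * pow2 (16 * θ)
    2^[a+16θ] a θ = trans (^-distribˡ-+-* 2 a (16 * θ)) (cong (2 ^ a *_) (sym (pow2≡2^ (16 * θ))))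

  small-error : 2 ^ t₀ ≤ D → k * lg ≤ 2 ^ s * 4 * 6 * 1 * c
  small-error large = go (bracket D (≤-trans (s≤s z≤n) 3≤D)) block
    where
    go : (Σ ℕ λ t → 2 ^ t ≤ D × D < 2 ^ suc t) → Block → k * lg ≤ 2 ^ s * 4 * 6 * 1 * c
    go (t , lo , hi) (θ , k′≤k , k≤) = scale {k′ = pow2 (16 * θ)} {l + 4 * θ} (2 ^ s) 1
        (≤-trans k≤ (≤-reflexive (2^[a+16θ] s θ)))
        (padded-bound n c D k θ l k′≤k solvable 26≤l
          (≤-trans (≤-reflexive (sym (^-distribˡ-+-* 2 5 l))) (subst (λ t → 2 ^ t ≤ D) t≡ lo))
          (k′*k′*D _ k′≤k) 2k≤n k>0)
        (≤-reflexive (sym (*-identityˡ c)))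
        (≤-trans (logBound (suc (s + 16 * θ + suc t)) (product-exponent k D (s + 16 * θ) (suc t) k≤ (<⇒≤ hi))) exponents)
      where
      31≤t : 31 ≤ t
      31≤t = subst (_≤ t) t₀≡31 (≤-pred (2^-cancel-< t₀ (suc t) (≤-<-trans large hi)))
      -- The 5 is the 32 = 2^5 of `accurate-protocol`; the threshold 31 for `t₀` is 5 + 26.
      l = t ∸ 5
      t≡ : t ≡ 5 + l
      t≡ = sym (m+[n∸m]≡n (≤-trans (m≤m+n 5 26) 31≤t))
      26≤l : 26 ≤ l
      26≤l = ∸-monoˡ-≤ 5 31≤t
      exponents : suc (s + 16 * θ + suc t) ≤ 4 * (l + 4 * θ)
      exponents = begin
        suc (s + 16 * θ + suc t)      ≡⟨ cong₂ (λ a b → suc (a + 16 * θ + suc b)) s≡16 t≡ ⟩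
        suc (16 + 16 * θ + (6 + l))   ≡⟨ ring₁ θ l ⟩
        23 + (16 * θ + l)             ≤⟨ +-monoˡ-≤ (16 * θ + l) (≤-trans (≤-trans (m≤m+n 23 3) 26≤l) (m≤m+n l (2 * l))) ⟩
        3 * l + (16 * θ + l)          ≡⟨ ring₂ θ l ⟩
        4 * (l + 4 * θ)               ∎
        where
        open ≤-Reasoning
        ring₁ : ∀ θ l → 1 + (16 + 16 * θ + (6 + l)) ≡ 23 + (16 * θ + l)
        ring₁ = solve-∀
        ring₂ : ∀ θ l → 3 * l + (16 * θ + l) ≡ 4 * (l + 4 * θ)
        ring₂ = solve-∀

  -- The error must be amplified; the room k² < n/3 then suffices only after shrinking k by 2^16.
  large-error : D ≤ 2 ^ t₀ → ∀ j → 2 ^ t₀ * 7 ^ pow2 j ≤ 3 * 9 ^ pow2 j →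
    k * lg ≤ 2 ^ (s + s) * 4 * 6 * 3 ^ suc j * c + 2 ^ s * suc (s + t₀) * c
  large-error small j amp = go block
    where
    open ≤-Reasoning
    C₁ = 2 ^ (s + s) * 4 * 6 * 3 ^ suc j
    C₂ = 2 ^ s * suc (s + t₀)
    go : Block → k * lg ≤ C₁ * c + C₂ * c
    -- Here k ≤ 2^16 and D ≤ 2^31, so the left side is bounded by a constant and one exchanged bit
    -- is enough.
    go (zero , _ , k≤) = ≤-trans (*-mono-≤ k≤2^s (logBound (suc (s + t₀)) (product-exponent k D s t₀ k≤2^s small)))
      (≤-trans (m≤m*n C₂ c {{>-nonZero c>0}}) (m≤n+m (C₂ * c) (C₁ * c)))
      where
      k≤2^s : k ≤ 2 ^ s
      k≤2^s = subst (λ a → k ≤ 2 ^ a) (+-identityʳ s) k≤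
      c>0 : 0 < c
      c>0 = communication-needed n c D k solvable 3≤D (≤-trans (+-monoˡ-≤ k (*-monoʳ-≤ 2 k>0)) (≤-trans (≤-reflexive (ring k)) 3k≤n))
        where
        ring : ∀ k → 2 * k + k ≡ 3 * k
        ring = solve-∀
    go (suc θ , k″≤k , k≤) = ≤-trans (scale {k′ = pow2 (16 * θ)} {26 + 4 * θ} (2 ^ (s + s)) (3 ^ suc j)
        (≤-trans k≤ (≤-reflexive (trans (cong (2 ^_) s+16[1+θ]) (2^[a+16θ] (s + s) θ))))
        (padded-bound n (3 ^ suc j * c) (2 ^ t₀) k θ 26 k′≤k (boost n c k j (2 ^ t₀) amp (weaken {n} {c} {D} {k} 3≤D solvable)) ≤-refl
          (≤-reflexive (trans (sym (^-distribˡ-+-* 2 5 26)) (cong (2 ^_) (sym t₀≡31)))) room 2k≤n k>0)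
        ≤-refl
        (≤-trans (logBound (suc (s + 16 * suc θ + t₀)) (product-exponent k D (s + 16 * suc θ) t₀ k≤ small)) exponents))
      (m≤m+n (C₁ * c) (C₂ * c))
      where
      k′ = pow2 (16 * θ)
      16[1+θ] : 16 * suc θ ≡ s + 16 * θ
      16[1+θ] = trans (*-suc 16 θ) (cong (_+ 16 * θ) (sym s≡16))
      s+16[1+θ] : s + 16 * suc θ ≡ s + s + 16 * θ
      s+16[1+θ] = trans (cong (s +_) 16[1+θ]) (sym (+-assoc s s (16 * θ)))
      2^s*k′≤k : 2 ^ s * k′ ≤ k
      2^s*k′≤k = ≤-trans (≤-reflexive (trans (sym (2^[a+16θ] s θ)) (trans (cong (2 ^_) (sym 16[1+θ])) (sym (pow2≡2^ (16 * suc θ)))))) k″≤k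
      k′≤k : k′ ≤ k
      k′≤k = ≤-trans (m≤n*m k′ (2 ^ s) {{m^n≢0 2 s}}) 2^s*k′≤k
      -- Dividing k by 2^16 frees a factor 2^32 in k², which has to hold the amplified 2^31.
      t₀≤s+s : t₀ ≤ s + s
      t₀≤s+s = subst₂ (λ t s → t ≤ s + s) (sym t₀≡31) (sym s≡16) (n≤1+n 31)
      room : k′ * k′ * 2 ^ t₀ ≤ n
      room = begin
        k′ * k′ * 2 ^ t₀                    ≤⟨ *-monoʳ-≤ (k′ * k′) (^-monoʳ-≤ 2 t₀≤s+s) ⟩
        k′ * k′ * 2 ^ (s + s)               ≡⟨ cong (k′ * k′ *_) (^-distribˡ-+-* 2 s s) ⟩
        k′ * k′ * (2 ^ s * 2 ^ s)           ≡⟨ ring (2 ^ s) k′ ⟩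
        (2 ^ s * k′) * (2 ^ s * k′)         ≤⟨ *-mono-≤ 2^s*k′≤k 2^s*k′≤k ⟩
        k * k                               ≤⟨ m≤m*n (k * k) D {{>-nonZero (≤-trans (s≤s z≤n) 3≤D)}} ⟩
        k * k * D                           ≤⟨ <⇒≤ close ⟩
        n                                   ∎
        where
        ring : ∀ s k → k * k * (s * s) ≡ (s * k) * (s * k)
        ring = solve-∀
      exponents : suc (s + 16 * suc θ + t₀) ≤ 4 * (26 + 4 * θ)
      exponents = ≤-trans (≤-reflexive (cong₂ (λ a b → suc (a + 16 * suc θ + b)) s≡16 t₀≡31))
                          (≤-trans (m≤m+n _ 40) (≤-reflexive (ring θ)))
        where
        ring : ∀ θ → 1 + (16 + 16 * (1 + θ) + 31) + 40 ≡ 4 * (26 + 4 * θ)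
        ring = solve-∀

  cost-lower-bound : ∀ j → 2 ^ t₀ * 7 ^ pow2 j ≤ 3 * 9 ^ pow2 j →
    k * lg ≤ (2 ^ s * 4 * 6 * 1 + (2 ^ (s + s) * 4 * 6 * 3 ^ suc j + 2 ^ s * suc (s + t₀))) * c
  cost-lower-bound j amp = combine (2 ^ s * 4 * 6 * 1) (2 ^ (s + s) * 4 * 6 * 3 ^ suc j) (2 ^ s * suc (s + t₀)) (≤-total (2 ^ t₀) D)
    (λ le → small-error le) (λ le → large-error le j amp)
    where
    combine : ∀ C₀ C₁ C₂ → 2 ^ t₀ ≤ D ⊎ D ≤ 2 ^ t₀ → (2 ^ t₀ ≤ D → k * lg ≤ C₀ * c) →
              (D ≤ 2 ^ t₀ → k * lg ≤ C₁ * c + C₂ * c) → k * lg ≤ (C₀ + (C₁ + C₂)) * c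
    combine C₀ C₁ C₂ (inj₁ le) f g = ≤-trans (f le) (*-monoˡ-≤ c (m≤m+n C₀ (C₁ + C₂)))
    combine C₀ C₁ C₂ (inj₂ le) f g = ≤-trans (g le) (≤-trans (≤-reflexive (sym (*-distribʳ-+ c C₁ C₂))) (*-monoˡ-≤ c (m≤n+m (C₁ + C₂) C₀)))

-- Public-coin protocols and the final constant.

countFin-tabulate : ∀ {A : Set} m (h : Fin m → A) (β : Fin m → Bool) (f : A → ℕ) →
                    (∀ r → ⟦ β r ⟧ ≡ f (h r)) → countFin m β ≡ sumL (tabulate h) f
countFin-tabulate zero    h β f eq = refl
countFin-tabulate (suc m) h β f eq =
  cong₂ _+_ (eq zero) (countFin-tabulate m (λ r → h (suc r)) (λ r → β (suc r)) f (λ r → eq (suc r)))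

size-tabulate : ∀ {A : Set} m (h : Fin m → A) → size (tabulate h) ≡ m
size-tabulate zero    h = refl
size-tabulate (suc m) h = cong suc (size-tabulate m (λ r → h (suc r)))

≤ᵇ-refl : ∀ k → (k ≤ᵇ k) ≡ true
≤ᵇ-refl k with k ≤ᵇ k | ≤⇒≤ᵇ (≤-refl {k})
... | true | _ = refl

2+k≰ᵇk : ∀ k → (2 + k ≤ᵇ k) ≡ false
2+k≰ᵇk k with 2 + k ≤ᵇ k | ≤ᵇ⇒≤ (2 + k) k
... | true  | le = ⊥-elim (<-irrefl refl (<-≤-trans (m<n+m k (s≤s z≤n)) (le tt)))
... | false | _  = refl

module _ (n k a b m c : ℕ) {{_ : NonZero a}} (P : PublicCoin n (suc m))
  (correct : (x y : Cube n) → Promise k (ham x y) → errors k P x y * b ≤ a * suc m)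
  (cheap : (x y : Cube n) (r : Fin (suc m)) → bitsOn (P r) x y ≤ c) where

  private
    -- The allowed error is δ = a / b, and rounding 1/δ down only weakens the correctness that is
    -- derived.
    D = b / a
    ps = tabulate (λ r → truncate c (P r))
    a>0 : 0 < a
    a>0 = >-nonZero⁻¹ a

  clear : ∀ E → E * b ≤ a * suc m → D * E ≤ size ps
  clear E le = cancelˡ a a>0 (begin
    a * (D * E)      ≡⟨ ring a D E ⟩
    E * (D * a)      ≤⟨ *-monoʳ-≤ E (m/n*n≤m b a) ⟩
    E * b            ≤⟨ le ⟩
    a * suc m        ≡⟨ cong (a *_) (sym (size-tabulate (suc m) (λ r → truncate c (P r)))) ⟩
    a * size ps      ∎)
    where
    open ≤-Reasoning
    ring : ∀ a D E → a * (D * E) ≡ E * (D * a)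
    ring = solve-∀

  error-count : ∀ x y (ψ : Bool → Bool) → (∀ v → v xor (ham x y ≤ᵇ k) ≡ ψ v) →
                errors k P x y ≡ sumL ps (λ p → ⟦ ψ (out p x y) ⟧)
  error-count x y ψ eq = countFin-tabulate (suc m) (λ r → truncate c (P r)) _ (λ p → ⟦ ψ (out p x y) ⟧)
    (λ r → cong ⟦_⟧ (trans (eq (run (P r) x y)) (cong ψ (sym (out-truncate c (P r) x y (cheap x y r))))))

  public-coin-solvable : Solvable n c D k
  public-coin-solvable = ps , s≤s z≤n , λ x y →
    (λ eq → subst (λ E → D * E ≤ size ps) (error-count x y not (λ v → trans (cong (v xor_) (accepted eq)) (xor-true v)))
              (clear (errors k P x y) (correct x y (inj₂ (inj₁ eq))))) ,
    (λ eq → subst (λ E → D * E ≤ size ps) (error-count x y (λ v → v) (λ v → trans (cong (v xor_) (rejected eq)) (xor-false v)))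
              (clear (errors k P x y) (correct x y (inj₂ (inj₂ (trans eq (+-comm 2 k)))))))
    where
    accepted : ∀ {d} → d ≡ k → (d ≤ᵇ k) ≡ true
    accepted refl = ≤ᵇ-refl k
    rejected : ∀ {d} → d ≡ 2 + k → (d ≤ᵇ k) ≡ false
    rejected refl = 2+k≰ᵇk k
    xor-true : ∀ v → v xor true ≡ not v
    xor-true true  = refl
    xor-true false = refl
    xor-false : ∀ v → v xor false ≡ v
    xor-false true  = refl
    xor-false false = refl

module _ (k a b : ℕ) {{_ : NonZero a}} where

  private
    D = b / a

  quotient-large : 3 * a ≤ b → 3 ≤ D
  quotient-large le = subst (_≤ D) (m*n/n≡m 3 a) (/-monoˡ-≤ a le)

  quotient-close : ∀ n → k * k * b < a * n → k * k * D < n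
  quotient-close n lt = *-cancelˡ-< a _ _ (≤-<-trans
    (≤-trans (≤-reflexive (ring a (k * k) D)) (*-monoʳ-≤ (k * k) (m/n*n≤m b a))) lt)
    where
    ring : ∀ a q D → a * (q * D) ≡ q * (D * a)
    ring = solve-∀

  -- Rounding b / a down to a positive `D` loses less than a factor 2, and the 2 inside `LogBound`
  -- makes up for it.
  quotient-log : 3 ≤ D → LogBound (2 * (k * D)) ⌊log₂ ((k * b) / a) ⌋
  quotient-log 3≤D E le = ≤-trans (⌊log₂⌋-mono-≤ (≤-trans quotient≤ le)) (≤-reflexive (⌊log₂[2^n]⌋≡n E))
    where
    open ≤-Reasoning
    b≤ : b ≤ 2 * D * a
    b≤ = begin
      b                ≡⟨ m≡m%n+[m/n]*n b a ⟩
      b % a + D * a    ≤⟨ +-monoˡ-≤ (D * a) (≤-trans (<⇒≤ (m%n<n b a)) (m≤n*m a D {{>-nonZero (≤-trans (s≤s z≤n) 3≤D)}})) ⟩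
      D * a + D * a    ≡⟨ ring D a ⟩
      2 * D * a        ∎
      where
      ring : ∀ D a → D * a + D * a ≡ 2 * D * a
      ring = solve-∀
    quotient≤ : (k * b) / a ≤ 2 * (k * D)
    quotient≤ = subst ((k * b) / a ≤_) (m*n/n≡m (2 * (k * D)) a) (/-monoˡ-≤ a
      (≤-trans (*-monoʳ-≤ k b≤) (≤-reflexive (ring k D a))))
      where
      ring : ∀ k D a → k * (2 * D * a) ≡ 2 * (k * D) * a
      ring = solve-∀

-- Eight rounds of majority voting bring the error from 1/3 to (1/3)(7/9)^128 < 2^-31.
seven-ninths : 2 ^ 31 * 7 ^ pow2 7 ≤ 3 * 9 ^ pow2 7
seven-ninths = ≤ᵇ⇒≤ (2 ^ 31 * 7 ^ pow2 7) (3 * 9 ^ pow2 7) tt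

theorem1p8 : Σ ℕ λ C → (0 < C) ×
    ((n k a b : ℕ) → {{_ : NonZero a}} → 1 ≤ k → 3 * a ≤ b
    → k * k * b < a * n
    → (m : ℕ) → (P : PublicCoin n (suc m))
    → ((x y : Vec Bool n) → Promise k (ham x y)
    → errors k P x y * b ≤ a * suc m)
    → (c : ℕ) → ((x y : Vec Bool n) → (r : _) → bitsOn (P r) x y ≤ c)
    → k * ⌊log₂ ((k * b) / a) ⌋ ≤ C * c)
theorem1p8 = general 16 31 7 refl refl seven-ninths
  where
  general : ∀ s t₀ j → s ≡ 16 → t₀ ≡ 31 → 2 ^ t₀ * 7 ^ pow2 j ≤ 3 * 9 ^ pow2 j → Σ ℕ λ C → (0 < C) ×
    ((n k a b : ℕ) → {{_ : NonZero a}} → 1 ≤ k → 3 * a ≤ b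
    → k * k * b < a * n
    → (m : ℕ) → (P : PublicCoin n (suc m))
    → ((x y : Vec Bool n) → Promise k (ham x y)
    → errors k P x y * b ≤ a * suc m)
    → (c : ℕ) → ((x y : Vec Bool n) → (r : _) → bitsOn (P r) x y ≤ c)
    → k * ⌊log₂ ((k * b) / a) ⌋ ≤ C * c)
  general s t₀ j s≡ t₀≡ amp = 2 ^ s * 4 * 6 * 1 + (2 ^ (s + s) * 4 * 6 * 3 ^ suc j + 2 ^ s * suc (s + t₀))
    , ≤-trans (*-pos (*-pos {2 ^ s * 4} {6} (*-pos {2 ^ s} {4} (m^n>0 2 s) (s≤s z≤n)) (s≤s z≤n)) (s≤s z≤n)) (m≤m+n _ _)
    , λ n k a b k>0 3a≤b close m P correct c cheap →
        let 3≤D = quotient-large k a b 3a≤b in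
        cost-lower-bound s t₀ s≡ t₀≡ n c (b / a) k ⌊log₂ ((k * b) / a) ⌋ k>0 3≤D (quotient-close k a b n close)
          (public-coin-solvable n k a b m c P correct cheap) (quotient-log k a b 3≤D) j amp
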